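{- For all integers $k\ge0$ and $n\ge0$, $$F_{2n}^{\delta_k}=(x+y)^n,\qquad F_{2n+1}^{\delta_k}=\begin{cases}(x+y)^n,& k\equiv0\pmod 4,\\ (x+y)^{n+1},& k\equiv1\pmod4,\\ xyz(x+y)^n,& k\equiv 2\pmod 4,\\ 0,& k\equiv 3\pmod 4.\end{cases}$$
   Context: $\delta_k=(k,k-1,\dots,1)$ (with $\delta_0=\emptyset$). Partitions are identified with Young diagrams (cell $(i,j)$ in row $i$, column $j$); for $\mu\subseteq\lambda$, $\lambda/\mu$ is the set of cells of $\lambda$ not in $\mu$, $\lambda/\mu\vdash n$ means it has $n$ cells. $v(\lambda/\mu)$, $h(\lambda/\mu)$, $d(\lambda/\mu)$ are the numbers of cells of $\lambda/\mu$ in even rows, in even columns, and in both even rows and even columns. A standard Young tableau (SYT) of shape $\lambda/\mu\vdash n$ is a bijection $T$ from its cells to $[n]$ with $T(i,j)\le T(i',j')$ whenever $i\le i',j\le j'$. For cells write $(i,j)\lhd(i',j')$ if $i<i'$ or ($i=i'$ and $j<j'$). For a SYT $T$ of straight shape $\lambda$, ${\rm sign}(T)=(-1)^{{\rm inv}(T)}$ with ${\rm inv}(T)=\#\{(a,b):a\lhd b,\ T(a)>T(b)\}$. For $T_1$ an SYT of shape $\nu/\mu\vdash k$ and $T_2$ of shape $\lambda/\nu$, $T_1\diamond T_2$ is the SYT of shape $\lambda/\mu$ equal to $T_1$ on $\nu/\mu$ and $T_2+k$ on $\lambda/\nu$. For an SYT $T$ of shape $\lambda/\mu$, ${\rm sign}(T)={\rm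 sign}(T_0){\rm sign}(T_0\diamond T)$ for any SYT $T_0$ of shape $\mu$ (independent of $T_0$). $I_{\lambda/\mu}=\sum_T{\rm sign}(T)$ over SYTs of shape $\lambda/\mu$. For a partition $\alpha$ and $n\ge0$, $F_n^\alpha=\sum_{\lambda:\ \lambda/\alpha\vdash n}x^{v(\lambda/\alpha)}y^{h(\lambda/\alpha)}z^{d(\lambda/\alpha)}I_{\lambda/\alpha}$. -}

module Defs where

open import Data.Nat using (ℕ; zero; suc; _+_; _*_; _∸_; _≡ᵇ_; _<ᵇ_; _≤ᵇ_)
open import Data.Nat.ListAction using (sum)
open import Relation.Binary.PropositionalEquality using (_≡_)
open import Data.Bool using (Bool; true; false; _∧_; _∨_; not; if_then_else_)
open import Data.List using (List; []; _∷_; _++_; length; map; concatMap; upTo; foldr)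
open import Data.Product using (_×_; _,_; proj₁; proj₂)
open import Data.Integer as ℤ using (ℤ; 0ℤ; 1ℤ; -_)

filterᵇ : {A : Set} → (A → Bool) → List A → List A
filterᵇ p [] = []
filterᵇ p (x ∷ xs) = if p x then x ∷ filterᵇ p xs else filterᵇ p xs

allᵇ : {A : Set} → (A → Bool) → List A → Bool
allᵇ p [] = true
allᵇ p (x ∷ xs) = p x ∧ allᵇ p xs

anyᵇ : {A : Set} → (A → Bool) → List A → Bool
anyᵇ p [] = false
anyᵇ p (x ∷ xs) = p x ∨ anyᵇ p xs

count : {A : Set} → (A → Bool) → List A → ℕ
count p xs = length (filterᵇ p xs)

sumℤ : List ℤ → ℤ
sumℤ = foldr ℤ._+_ 0ℤ

fromTo : ℕ → ℕ → List ℕ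
fromTo a b = map (a +_) (upTo (suc b ∸ a))

lists : ℕ → List ℕ → List (List ℕ)
lists zero xs = [] ∷ []
lists (suc n) xs = concatMap (λ x → map (x ∷_) (lists n xs)) xs

pairs : {A : Set} → List A → List (A × A)
pairs xs = concatMap (λ a → map (a ,_) xs) xs

isEven : ℕ → Bool
isEven zero = true
isEven (suc zero) = false
isEven (suc (suc n)) = isEven n

signPow : ℕ → ℤ
signPow zero = 1ℤ
signPow (suc n) = - signPow n

-- Partitions and Young diagrams
-- A partition is a list of parts λ₁ ≥ λ₂ ≥ … (trailing zeros allowed as
-- padding).  Rows and columns are indexed from 1; cell (i , j).

Cell : Set
Cell = ℕ × ℕ

row col : Cell → ℕ
row = proj₁
col = proj₂

at : List ℕ → ℕ → ℕ
at [] _ = 0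
at (x ∷ xs) zero = x
at (x ∷ xs) (suc i) = at xs i

part : List ℕ → ℕ → ℕ
part l i = at l (i ∸ 1)

size : List ℕ → ℕ
size = sum

δ : ℕ → List ℕ
δ zero = []
δ (suc k) = suc k ∷ δ k

weaklyDecreasing : List ℕ → Bool
weaklyDecreasing [] = true
weaklyDecreasing (x ∷ []) = true
weaklyDecreasing (x ∷ y ∷ xs) = (y ≤ᵇ x) ∧ weaklyDecreasing (y ∷ xs)

contained : List ℕ → List ℕ → Bool
contained μ l = allᵇ (λ i → part μ i ≤ᵇ part l i) (fromTo 1 (length μ))

inShape : List ℕ → Cell → Bool
inShape μ (i , j) = (1 ≤ᵇ i) ∧ (1 ≤ᵇ j) ∧ (j ≤ᵇ part μ i)

skewCells : List ℕ → List ℕ → List Cell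
skewCells l μ =
  concatMap (λ i → map (λ j → (i , j)) (fromTo (suc (part μ i)) (part l i)))
            (fromTo 1 (length l))

-- all partitions λ ⊇ α with λ/α ⊢ n, each listed exactly once
-- (as weakly decreasing lists of length |α|+n with entries ≤ |α|+n)
shapesOver : List ℕ → ℕ → List (List ℕ)
shapesOver α n =
  filterᵇ (λ l → weaklyDecreasing l ∧ (sum l ≡ᵇ N) ∧ contained α l)
          (lists N (fromTo 0 N))
  where N = size α + n

vStat hStat dStat : List ℕ → List ℕ → ℕ
vStat l μ = count (λ c → isEven (row c)) (skewCells l μ)
hStat l μ = count (λ c → isEven (col c)) (skewCells l μ)
dStat l μ = count (λ c → isEven (row c) ∧ isEven (col c)) (skewCells l μ)

Labelling : Set
Labelling = Cell → ℕ

cellEq : Cell → Cell → Bool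
cellEq (i , j) (i' , j') = (i ≡ᵇ i') ∧ (j ≡ᵇ j')

tab : List Cell → List ℕ → Labelling
tab [] _ c = 0
tab (_ ∷ _) [] c = 0
tab (a ∷ cs) (x ∷ xs) c = if cellEq a c then x else tab cs xs c

_⊲_ : Cell → Cell → Bool
(i , j) ⊲ (i' , j') = (i <ᵇ i') ∨ ((i ≡ᵇ i') ∧ (j <ᵇ j'))

isStandard : List Cell → Labelling → Bool
isStandard cs T =
  allᵇ (λ ab → not ((row (proj₁ ab) ≤ᵇ row (proj₂ ab)) ∧ (col (proj₁ ab) ≤ᵇ col (proj₂ ab)))
                ∨ (T (proj₁ ab) ≤ᵇ T (proj₂ ab)))
       (pairs cs)

-- SYTs of shape λ/μ, as label lists aligned with skewCells λ μ:
-- labels in [1..m] (m = number of cells), every label used (hence a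
-- bijection onto [m]), and standard.
syts : List ℕ → List ℕ → List (List ℕ)
syts l μ =
  filterᵇ (λ L → allᵇ (λ v → anyᵇ (v ≡ᵇ_) L) (fromTo 1 m) ∧ isStandard cs (tab cs L))
          (lists m (fromTo 1 m))
  where cs = skewCells l μ
        m = length cs

inv : List ℕ → Labelling → ℕ
inv l T = count (λ ab → (proj₁ ab ⊲ proj₂ ab) ∧ (T (proj₂ ab) <ᵇ T (proj₁ ab)))
                (pairs (skewCells l []))

signStraight : List ℕ → Labelling → ℤ
signStraight l T = signPow (inv l T)

-- a fixed SYT T₀ of shape μ: the row reading tableau
-- T₀(i,j) = μ₁ + … + μ_{i-1} + j
rowReading : List ℕ → Labelling
rowReading μ (i , j) = sum (map (part μ) (fromTo 1 (i ∸ 1))) + j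

_◇[_]_ : Labelling → List ℕ → Labelling → Labelling
(T₁ ◇[ μ ] T₂) c = if inShape μ c then T₁ c else T₂ c + size μ

signSkew : List ℕ → List ℕ → Labelling → ℤ
signSkew l μ T =
  signStraight μ (rowReading μ) ℤ.* signStraight l (rowReading μ ◇[ μ ] T)

I : List ℕ → List ℕ → ℤ
I l μ = sumℤ (map (λ L → signSkew l μ (tab (skewCells l μ) L)) (syts l μ))

-- Polynomials in ℤ[x,y,z] as finite formal sums of terms
-- (exponents of x, y, z ; coefficient); compared by coefficients.

Mono : Set
Mono = ℕ × ℕ × ℕ

Poly : Set
Poly = List (Mono × ℤ)

monoEq : Mono → Mono → Bool
monoEq (a , b , c) (a' , b' , c') = (a ≡ᵇ a') ∧ (b ≡ᵇ b') ∧ (c ≡ᵇ c')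

coeff : Poly → Mono → ℤ
coeff p m = sumℤ (map proj₂ (filterᵇ (λ t → monoEq (proj₁ t) m) p))

infix 4 _≈ₚ_

_≈ₚ_ : Poly → Poly → Set
p ≈ₚ q = ∀ a b c → coeff p (a , b , c) ≡ coeff q (a , b , c)

0ₚ 1ₚ X Y Z : Poly
0ₚ = []
1ₚ = ((0 , 0 , 0) , 1ℤ) ∷ []
X = ((1 , 0 , 0) , 1ℤ) ∷ []
Y = ((0 , 1 , 0) , 1ℤ) ∷ []
Z = ((0 , 0 , 1) , 1ℤ) ∷ []

infixl 6 _+ₚ_
infixl 7 _*ₚ_
infixr 8 _^ₚ_

_+ₚ_ : Poly → Poly → Poly
p +ₚ q = p ++ q

mulMono : Mono → Mono → Mono
mulMono (a , b , c) (a' , b' , c') = (a + a' , b + b' , c + c')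

_*ₚ_ : Poly → Poly → Poly
p *ₚ q = concatMap (λ s → map (λ t → (mulMono (proj₁ s) (proj₁ t) , proj₂ s ℤ.* proj₂ t)) q) p

_^ₚ_ : Poly → ℕ → Poly
p ^ₚ zero = 1ₚ
p ^ₚ suc n = p *ₚ (p ^ₚ n)

F : ℕ → List ℕ → Poly
F n α = map (λ l → ((vStat l α , hStat l α , dStat l α) , I l α)) (shapesOver α n)

{-# OPTIONS --safe #-}
module Submission where

-- Let U add a box to a partition in all ways, with sign (-1)^(number of boxes in lower rows), and let V
-- remove a box in all ways, with the same sign times an alternating sign for the row.  Removing the largest
-- label from a tableau shows that I l α is the coefficient of l in U^n α.
-- The operators satisfy U V + V U = 1, so U commutes with V².  Both U² and V² act by dominoes: two boxes
-- which do not form one can be added in two orders of opposite sign.  As δ k has no removable domino,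
-- V² U^n vanishes on it.  Let w be the weight in x, y, z.  A horizontal domino can be added to row r + 1
-- exactly when one can be removed from row r, a vertical domino can be added at the top of a run of at
-- least two equal rows and removed at its bottom, and the weights telescope to
-- w (U² l) = (x + y) w(l) + x²y²z w (V² l).  Iterating this at δ k leaves the powers of x + y and, in odd
-- degree, the signed weights of the k + 1 corners of δ k, which are periodic in k with period 4.
-- All of this is carried out on the dual side, on functions of partitions.

open import Defs
open import Data.Bool using (Bool; true; false; _∧_; _∨_; not; if_then_else_)
open import Data.Bool.Properties using (T-≡; ∧-assoc; ∧-identityʳ)
open import Data.Integer using (ℤ; 0ℤ; 1ℤ; -1ℤ; _+_; _*_; -_)
import Data.Integer.Properties as ℤₚ
open import Data.Integer.Tactic.RingSolver using (solve-∀)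
open import Data.List using (List; []; _∷_; _++_; map; concatMap; length; upTo; applyUpTo; drop)
import Data.List.Properties as Listₚ
open import Data.List.Membership.Propositional using (_∈_; _∉_)
open import Data.List.Membership.Propositional.Properties
  using (∈-concatMap⁻; ∈-map⁻; ∈-map⁺; ∈-++⁻; ∈-++⁺ˡ; ∈-++⁺ʳ; ∈-∃++; ∈-upTo⁺; ∈-upTo⁻)
open import Data.List.Membership.Propositional.Properties.WithK using (unique∧set⇒bag)
open import Data.List.Relation.Binary.BagAndSetEquality using (∼bag⇒↭)
open import Data.List.Relation.Binary.Permutation.Propositional using (_↭_; prep; swap)
  renaming (refl to ↭-refl; trans to ↭-trans)
open import Data.List.Relation.Unary.All as All using (All; []; _∷_)
open import Data.List.Relation.Unary.AllPairs using (AllPairs; []; _∷_)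
import Data.List.Relation.Unary.AllPairs.Properties as AllPairsₚ
open import Data.List.Relation.Unary.Any using (here; there; satisfied)
open import Data.List.Relation.Unary.Unique.Propositional using (Unique)
import Data.List.Relation.Unary.Unique.Propositional.Properties as Uniqueₚ
open import Data.Maybe using (Maybe; nothing; just)
open import Data.Nat using (ℕ; zero; suc; pred; _<ᵇ_; _≡ᵇ_; _≤ᵇ_; _≤_; _<_; z≤n; s≤s)
import Data.Nat as ℕ
open import Data.Nat.DivMod using (m≡m%n+[m/n]*n)
open import Data.Nat.ListAction using (sum)
import Data.Nat.Properties as ℕₚ
import Data.Nat.Tactic.RingSolver as ℕSolver
open import Data.Product using (_×_; _,_; proj₁; proj₂; ∃; ∃₂)
open import Data.Sum as Sum using (_⊎_; inj₁; inj₂)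
open import Data.Unit using (⊤; tt)
open import Function using (_∘_; id)
open import Function.Bundles using (Equivalence; mk⇔)
open import Relation.Binary.PropositionalEquality
open import Relation.Nullary using (contradiction)
open ≡-Reasoning

-- Adding and removing a box

-- The factor x + y is what the matching of added with removed dominoes leaves over. A horizontal
-- domino in the first row has no row above it to be matched with, and its monomial is y. The empty
-- rows form a run with a top but no bottom, so the vertical domino placed there stays unmatched
-- too, and its monomial is x. The monomial x²y²z is that of a 2 by 2 square: it is the product of
-- two horizontal dominoes in consecutive rows, and of two vertical ones in consecutive columns, so
-- multiplying by it trades the loss of one domino for the gain of its neighbour. The alternating
-- sign in V does two jobs. A removable box in a row and an addable box in the next row occur
-- together and receive opposite signs, which is why the anticommutator is 1; and a vertical domino
-- removed from column c receives the sign of one added to column c + 1. Polynomials enter through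
-- arbitrary functions `φ` of the weight, that is, linear functionals, on which multiplication by a
-- monomial acts by precomposition.

_when_ : ℤ → Bool → ℤ
z when true  = z
z when false = 0ℤ

infixl 3 _when_

when-0 : ∀ b → (0ℤ when b) ≡ 0ℤ
when-0 true  = refl
when-0 false = refl

*-when : ∀ a z b → a * (z when b) ≡ (a * z when b)
*-when a z true  = refl
*-when a z false = ℤₚ.*-zeroʳ a

when-+ : ∀ y z b → (y + z when b) ≡ (y when b) + (z when b)
when-+ y z true  = refl
when-+ y z false = refl

when-∧ : ∀ z b c → (z when b ∧ c) ≡ ((z when c) when b)
when-∧ z true  c = refl
when-∧ z false c = refl

signPow-+ : ∀ m n → signPow (m ℕ.+ n) ≡ signPow m * signPow n
signPow-+ zero    n = sym (ℤₚ.*-identityˡ (signPow n))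
signPow-+ (suc m) n = trans (cong -_ (signPow-+ m n)) (ℤₚ.neg-distribˡ-* (signPow m) (signPow n))

signPow-square : ∀ n → signPow n * signPow n ≡ 1ℤ
signPow-square zero    = refl
signPow-square (suc n) = trans (lemma (signPow n)) (signPow-square n)
  where lemma : ∀ a → - a * - a ≡ a * a
        lemma = solve-∀

hd : List ℕ → ℕ
hd l = at l 0

-- nothing stands for the absent row above the first one.
Bound : Set
Bound = Maybe ℕ

infix 5 _<ᴮ_ _≤ᴮ_

_<ᴮ_ : ℕ → Bound → Bool
x <ᴮ nothing = true
x <ᴮ just b  = x <ᵇ b

_≤ᴮ_ : ℕ → Bound → Set
x ≤ᴮ nothing = ⊤
x ≤ᴮ just b  = x ≤ b

data Partition : Bound → List ℕ → Set where
  []  : ∀ {b} → Partition b []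
  _∷_ : ∀ {b x xs} → x ≤ᴮ b → Partition (just x) xs → Partition b (x ∷ xs)

hd≤ : ∀ {x xs} → Partition (just x) xs → hd xs ≤ x
hd≤ []      = z≤n
hd≤ (p ∷ _) = p

-- The transpose of U: `g`, extended linearly, is evaluated at U `l`. The bound is the length of the
-- row above, so that the recursion can descend into the lower rows.
add : Bound → (List ℕ → ℤ) → List ℕ → ℤ
add b g []       = g (1 ∷ []) when 0 <ᴮ b
add b g (x ∷ xs) = (signPow (sum xs) * g (suc x ∷ xs) when x <ᴮ b) + add (just x) (g ∘ (x ∷_)) xs

-- The operator V of the introduction is remove -1ℤ, while remove 1ℤ is the adjoint of add.
remove : ℤ → (List ℕ → ℤ) → List ℕ → ℤ
remove ε g []       = 0ℤ
remove ε g (x ∷ xs) = (signPow (sum xs) * g (pred x ∷ xs) when hd xs <ᵇ x) + ε * remove ε (g ∘ (x ∷_)) xs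

data AddBox : Bound → List ℕ → List ℕ → Set where
  new   : ∀ {b} → 0 <ᴮ b ≡ true → AddBox b [] (1 ∷ [])
  here  : ∀ {b x xs} → x <ᴮ b ≡ true → AddBox b (x ∷ xs) (suc x ∷ xs)
  there : ∀ {b x xs ys} → AddBox (just x) xs ys → AddBox b (x ∷ xs) (x ∷ ys)

data RemoveBox : List ℕ → List ℕ → Set where
  here  : ∀ {x xs} → hd xs < suc x → RemoveBox (suc x ∷ xs) (x ∷ xs)
  there : ∀ {x xs ys} → RemoveBox xs ys → RemoveBox (x ∷ xs) (x ∷ ys)

<ᴮ⇒≤ᴮ : ∀ {x} b → x <ᴮ b ≡ true → suc x ≤ᴮ b
<ᴮ⇒≤ᴮ nothing  _ = tt
<ᴮ⇒≤ᴮ (just b) p = ℕₚ.<ᵇ⇒< _ b (subst Data.Bool.T (sym p) tt)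

≤ᴮ⇒<ᴮ : ∀ {x} b → suc x ≤ᴮ b → x <ᴮ b ≡ true
≤ᴮ⇒<ᴮ nothing  _ = refl
≤ᴮ⇒<ᴮ {zero}  (just (suc b)) (s≤s p) = refl
≤ᴮ⇒<ᴮ {suc x} (just (suc b)) (s≤s p) = ≤ᴮ⇒<ᴮ (just b) p

Partition-weaken : ∀ {x xs} → Partition (just x) xs → Partition (just (suc x)) xs
Partition-weaken []      = []
Partition-weaken (p ∷ q) = ℕₚ.m≤n⇒m≤1+n p ∷ q

AddBox-Partition : ∀ {b l m} → Partition b l → AddBox b l m → Partition b m
AddBox-Partition []      (new p)   = <ᴮ⇒≤ᴮ _ p ∷ []
AddBox-Partition (_ ∷ q) (here p)  = <ᴮ⇒≤ᴮ _ p ∷ Partition-weaken q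
AddBox-Partition (p ∷ q) (there c) = p ∷ AddBox-Partition q c

≤ᴮ-pred : ∀ {x} b → suc x ≤ᴮ b → x ≤ᴮ b
≤ᴮ-pred nothing  _ = tt
≤ᴮ-pred (just b) p = ℕₚ.<⇒≤ p

Partition-bound : ∀ {x y xs} → hd xs ≤ y → Partition (just x) xs → Partition (just y) xs
Partition-bound p []      = []
Partition-bound p (_ ∷ q) = p ∷ q

RemoveBox-Partition : ∀ {b l m} → Partition b l → RemoveBox l m → Partition b m
RemoveBox-Partition {b} (p ∷ q) (here (s≤s r)) = ≤ᴮ-pred b p ∷ Partition-bound r q
RemoveBox-Partition (p ∷ q) (there c) = p ∷ RemoveBox-Partition q c

AddBox-sum : ∀ {b l m} → AddBox b l m → sum m ≡ suc (sum l)
AddBox-sum (new _)   = refl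
AddBox-sum (here _)  = refl
AddBox-sum {l = x ∷ xs} (there c) = trans (cong (x ℕ.+_) (AddBox-sum c)) (ℕₚ.+-suc x _)

RemoveBox-sum : ∀ {l m} → RemoveBox l m → sum l ≡ suc (sum m)
RemoveBox-sum (here _) = refl
RemoveBox-sum {l = x ∷ xs} (there c) = trans (cong (x ℕ.+_) (RemoveBox-sum c)) (ℕₚ.+-suc x _)

-- The witness of `AddBox` given to the hypothesis is what later supplies the size of `m` and the
-- fact that it is a partition.
add-cong : ∀ {b g h} l → (∀ {m} → AddBox b l m → g m ≡ h m) → add b g l ≡ add b h l
add-cong {b} [] e with 0 <ᴮ b in p
... | true  = e (new p)
... | false = refl
add-cong {b} (x ∷ xs) e with x <ᴮ b in p
... | true  = cong₂ _+_ (cong (signPow (sum xs) *_) (e (here p))) (add-cong xs (e ∘ there))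
... | false = cong (0ℤ +_) (add-cong xs (e ∘ there))

remove-cong : ∀ {ε g h} l → (∀ {m} → RemoveBox l m → g m ≡ h m) → remove ε g l ≡ remove ε h l
remove-cong [] e = refl
remove-cong {ε} (zero ∷ xs) e with hd xs
... | _ = cong (0ℤ +_) (cong (ε *_) (remove-cong xs (e ∘ there)))
remove-cong {ε} (suc x ∷ xs) e with hd xs <ᵇ suc x in p
... | true  = cong₂ _+_ (cong (signPow (sum xs) *_) (e (here (<ᴮ⇒≤ᴮ (just (suc x)) p))))
                        (cong (ε *_) (remove-cong xs (e ∘ there)))
... | false = cong (0ℤ +_) (cong (ε *_) (remove-cong xs (e ∘ there)))

add-* : ∀ b a g l → add b (λ m → a * g m) l ≡ a * add b g l
add-* b a g [] = sym (*-when a _ (0 <ᴮ b))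
add-* b a g (x ∷ xs) rewrite add-* (just x) a (g ∘ (x ∷_)) xs with x <ᴮ b
... | true  = lemma (signPow (sum xs)) a _ _
  where lemma : ∀ s a g u → s * (a * g) + a * u ≡ a * (s * g + u)
        lemma = solve-∀
... | false = lemma a _
  where lemma : ∀ a u → 0ℤ + a * u ≡ a * (0ℤ + u)
        lemma = solve-∀

add-+ : ∀ b g h l → add b (λ m → g m + h m) l ≡ add b g l + add b h l
add-+ b g h [] = when-+ _ _ (0 <ᴮ b)
add-+ b g h (x ∷ xs) rewrite add-+ (just x) (g ∘ (x ∷_)) (h ∘ (x ∷_)) xs with x <ᴮ b
... | true  = lemma (signPow (sum xs)) _ _ _ _
  where lemma : ∀ s g h u v → s * (g + h) + (u + v) ≡ (s * g + u) + (s * h + v)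
        lemma = solve-∀
... | false = lemma (add (just x) (g ∘ (x ∷_)) xs) (add (just x) (h ∘ (x ∷_)) xs)
  where lemma : ∀ u v → 0ℤ + (u + v) ≡ (0ℤ + u) + (0ℤ + v)
        lemma = solve-∀

remove-* : ∀ ε a g l → remove ε (λ m → a * g m) l ≡ a * remove ε g l
remove-* ε a g [] = sym (ℤₚ.*-zeroʳ a)
remove-* ε a g (x ∷ xs) rewrite remove-* ε a (g ∘ (x ∷_)) xs with hd xs <ᵇ x
... | true  = lemma (signPow (sum xs)) ε a _ _
  where lemma : ∀ s ε a g u → s * (a * g) + ε * (a * u) ≡ a * (s * g + ε * u)
        lemma = solve-∀
... | false = lemma ε a _
  where lemma : ∀ ε a u → 0ℤ + ε * (a * u) ≡ a * (0ℤ + ε * u)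
        lemma = solve-∀

remove-+ : ∀ ε g h l → remove ε (λ m → g m + h m) l ≡ remove ε g l + remove ε h l
remove-+ ε g h [] = refl
remove-+ ε g h (x ∷ xs) rewrite remove-+ ε (g ∘ (x ∷_)) (h ∘ (x ∷_)) xs with hd xs <ᵇ x
... | true  = lemma (signPow (sum xs)) ε _ _ _ _
  where lemma : ∀ s ε g h u v → s * (g + h) + ε * (u + v) ≡ (s * g + ε * u) + (s * h + ε * v)
        lemma = solve-∀
... | false = lemma ε _ _
  where lemma : ∀ ε u v → 0ℤ + ε * (u + v) ≡ (0ℤ + ε * u) + (0ℤ + ε * v)
        lemma = solve-∀

add-0 : ∀ b l → add b (λ _ → 0ℤ) l ≡ 0ℤ
add-0 b l = trans (add-* b 0ℤ (λ _ → 0ℤ) l) (ℤₚ.*-zeroˡ (add b (λ _ → 0ℤ) l))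

remove-0 : ∀ ε l → remove ε (λ _ → 0ℤ) l ≡ 0ℤ
remove-0 ε l = trans (remove-* ε 0ℤ (λ _ → 0ℤ) l) (ℤₚ.*-zeroˡ (remove ε (λ _ → 0ℤ) l))

add-when : ∀ b g c l → add b (λ m → g m when c) l ≡ (add b g l when c)
add-when b g true  l = refl
add-when b g false l = add-0 b l

remove-when : ∀ ε g c l → remove ε (λ m → g m when c) l ≡ (remove ε g l when c)
remove-when ε g true  l = refl
remove-when ε g false l = remove-0 ε l

-- A new box in the lower rows flips the parity that an upper row sees. All cancellations between
-- moves in different rows come from this minus sign and the one in `remove-sign`.
add-sign : ∀ b g l →
  add b (λ m → signPow (sum m) * g m) l ≡ - signPow (sum l) * add b g l
add-sign b g l = trans (add-cong l λ {m} c → cong (λ n → signPow n * g m) (AddBox-sum c))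
                       (add-* b (- signPow (sum l)) g l)

remove-sign : ∀ ε g l →
  remove ε (λ m → signPow (sum m) * g m) l ≡ - signPow (sum l) * remove ε g l
remove-sign ε g l = trans (remove-cong l λ {m} c → cong (_* g m) (flip c))
                          (remove-* ε (- signPow (sum l)) g l)
  where flip : ∀ {m} → RemoveBox l m → signPow (sum m) ≡ - signPow (sum l)
        flip {m} c = trans (sym (ℤₚ.neg-involutive (signPow (sum m))))
                           (cong -_ (sym (cong signPow (RemoveBox-sum c))))

-- After a box has been added below, the row of length `x` can still lose one only if the row under
-- it stayed shorter than `x`. This amounts to adding the box under a row that was already shortened
-- to `pred x`.
add-below : ∀ x g l →
  add (just x) (λ m → g m when hd m <ᵇ x) l ≡ (add (just (pred x)) g l when hd l <ᵇ x)
add-below zero          g []       = refl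
add-below (suc zero)    g []       = refl
add-below (suc (suc x)) g []       = refl
add-below zero g (y ∷ ys) = trans (ℤₚ.+-identityˡ _) (add-0 (just y) ys)
add-below (suc x) g (y ∷ ys) rewrite add-when (just y) (g ∘ (y ∷_)) (y <ᵇ suc x) ys
  with y <ᵇ suc x
... | true  = cong (_+ add (just y) (g ∘ (y ∷_)) ys) (*-when (signPow (sum ys)) (g (suc y ∷ ys)) (y <ᵇ x))
... | false = refl

-- Removing the only box of `1 ∷ []` leaves `0 ∷ []` and not `[]`, so adding and then removing a box
-- returns to the same list only up to a trailing zero.
TrailingZero : (List ℕ → ℤ) → Set
TrailingZero g = ∀ l → g (l ++ 0 ∷ []) ≡ g l

hd-++0 : ∀ l → hd (l ++ 0 ∷ []) ≡ hd l
hd-++0 []      = refl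
hd-++0 (_ ∷ _) = refl

sum-++0 : ∀ l → sum (l ++ 0 ∷ []) ≡ sum l
sum-++0 []       = refl
sum-++0 (x ∷ xs) = cong (x ℕ.+_) (sum-++0 xs)

add-TrailingZero : ∀ b g → TrailingZero g → TrailingZero (add b g)
add-TrailingZero b g t [] = trans (cong (_+ 0ℤ) (cong (_when 0 <ᴮ b) (ℤₚ.*-identityˡ (g (1 ∷ [])))))
                                  (ℤₚ.+-identityʳ _)
add-TrailingZero b g t (x ∷ xs)
  rewrite sum-++0 xs | t (suc x ∷ xs) | add-TrailingZero (just x) (g ∘ (x ∷_)) (t ∘ (x ∷_)) xs = refl

remove-TrailingZero : ∀ ε g → TrailingZero g → TrailingZero (remove ε g)
remove-TrailingZero ε g t [] = trans (ℤₚ.+-identityˡ _) (ℤₚ.*-zeroʳ ε)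
remove-TrailingZero ε g t (x ∷ xs)
  rewrite sum-++0 xs | hd-++0 xs | t (pred x ∷ xs)
        | remove-TrailingZero ε (g ∘ (x ∷_)) (t ∘ (x ∷_)) xs = refl

removeAlt : (List ℕ → ℤ) → List ℕ → ℤ
removeAlt = remove -1ℤ

-- Moves in two different rows cancel, because doing the lower one first flips the sign of the upper
-- one. Adding and removing in the same row gives `g l` up to the alternating sign: once for each
-- row that can grow and once for each row that can shrink. A row can grow exactly when the row
-- above it can shrink, so these terms telescope, and only the question whether the first row can
-- grow under `b` is left.
anticommutator : ∀ {b l} g → TrailingZero g → Partition b l →
  add b (removeAlt g) l + removeAlt (add b g) l ≡ (g l when hd l <ᴮ b)
anticommutator {b} g t [] = trans (ℤₚ.+-identityʳ _) (cong (_when 0 <ᴮ b) lemma)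
  where lemma : 1ℤ * g (0 ∷ []) + 0ℤ ≡ g []
        lemma = trans (ℤₚ.+-identityʳ _) (trans (ℤₚ.*-identityˡ _) (t []))
anticommutator {b} {x ∷ xs} g t (p ∷ q) = begin
  add b (removeAlt g) (x ∷ xs) + removeAlt (add b g) (x ∷ xs)
    ≡⟨ cong₂ _+_ (cong₂ _+_ add-first add-rest) (cong₂ _+_ remove-first (cong (-1ℤ *_) remove-rest)) ⟩
  ((σ * (σ * G + -1ℤ * R) when x <ᴮ b) + ((- σ * A when hd xs <ᵇ x) + -1ℤ * AR))
    + ((σ * (σ * G + A) when hd xs <ᵇ x) + -1ℤ * ((- σ * R when x <ᴮ b) + RA))
    ≡⟨ regroup (x <ᴮ b) (hd xs <ᵇ x) σσG ⟩
  ((G when x <ᴮ b) + (G when hd xs <ᵇ x)) + -1ℤ * (AR + RA)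
    ≡⟨ cong (λ z → ((G when x <ᴮ b) + (G when hd xs <ᵇ x)) + -1ℤ * z)
            (anticommutator (g ∘ (x ∷_)) (t ∘ (x ∷_)) q) ⟩
  ((G when x <ᴮ b) + (G when hd xs <ᵇ x)) + -1ℤ * (G when hd xs <ᵇ x)
    ≡⟨ cancel _ _ ⟩
  (G when x <ᴮ b) ∎
  where
  σ = signPow (sum xs)
  G = g (x ∷ xs)
  R = removeAlt (g ∘ (suc x ∷_)) xs
  A = add (just (pred x)) (g ∘ (pred x ∷_)) xs
  AR = add (just x) (removeAlt (g ∘ (x ∷_))) xs
  RA = removeAlt (add (just x) (g ∘ (x ∷_))) xs

  add-first : (σ * removeAlt g (suc x ∷ xs) when x <ᴮ b) ≡ (σ * (σ * G + -1ℤ * R) when x <ᴮ b)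
  add-first = cong (λ c → σ * ((σ * G when c) + -1ℤ * R) when x <ᴮ b)
                   (≤ᴮ⇒<ᴮ (just (suc x)) (s≤s (hd≤ q)))

  add-rest : add (just x) (λ ys → removeAlt g (x ∷ ys)) xs ≡ (- σ * A when hd xs <ᵇ x) + -1ℤ * AR
  add-rest = begin
    add (just x) (λ ys → removeAlt g (x ∷ ys)) xs
      ≡⟨ add-+ (just x) _ _ xs ⟩
    add (just x) (λ ys → signPow (sum ys) * g (pred x ∷ ys) when hd ys <ᵇ x) xs
      + add (just x) (λ ys → -1ℤ * removeAlt (g ∘ (x ∷_)) ys) xs
      ≡⟨ cong₂ _+_ (trans (add-below x _ xs) (cong (_when hd xs <ᵇ x) (add-sign (just (pred x)) _ xs)))
                   (add-* (just x) -1ℤ _ xs) ⟩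
    (- σ * A when hd xs <ᵇ x) + -1ℤ * AR ∎

  remove-first : (σ * add b g (pred x ∷ xs) when hd xs <ᵇ x) ≡ (σ * (σ * G + A) when hd xs <ᵇ x)
  remove-first with hd xs <ᵇ x in r
  ... | false = refl
  ... | true  = cong (σ *_) (first x r p)
    where
    first : ∀ x → (hd xs <ᵇ x) ≡ true → x ≤ᴮ b →
      add b g (pred x ∷ xs) ≡ σ * g (x ∷ xs) + add (just (pred x)) (g ∘ (pred x ∷_)) xs
    -- The box just taken from the first row can always be put back, since `suc x` is within the
    -- bound.
    first (suc x) _ p = cong (λ c → (σ * g (suc x ∷ xs) when c) + add (just x) (g ∘ (x ∷_)) xs) (≤ᴮ⇒<ᴮ b p)

  remove-rest : removeAlt (λ ys → add b g (x ∷ ys)) xs ≡ (- σ * R when x <ᴮ b) + RA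
  remove-rest = begin
    removeAlt (λ ys → add b g (x ∷ ys)) xs
      ≡⟨ remove-+ -1ℤ _ _ xs ⟩
    removeAlt (λ ys → signPow (sum ys) * g (suc x ∷ ys) when x <ᴮ b) xs + RA
      ≡⟨ cong (_+ RA) (trans (remove-when -1ℤ _ (x <ᴮ b) xs) (cong (_when x <ᴮ b) (remove-sign -1ℤ _ xs))) ⟩
    (- σ * R when x <ᴮ b) + RA ∎

  σσG : σ * σ * G ≡ G
  σσG = trans (cong (_* G) (signPow-square (sum xs))) (ℤₚ.*-identityˡ G)

  regroup : ∀ c d → σ * σ * G ≡ G →
    ((σ * (σ * G + -1ℤ * R) when c) + ((- σ * A when d) + -1ℤ * AR))
      + ((σ * (σ * G + A) when d) + -1ℤ * ((- σ * R when c) + RA))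
    ≡ ((G when c) + (G when d)) + -1ℤ * (AR + RA)
  regroup false false _ = lemma AR RA
    where lemma : ∀ u v → (0ℤ + (0ℤ + -1ℤ * u)) + (0ℤ + -1ℤ * (0ℤ + v)) ≡ (0ℤ + 0ℤ) + -1ℤ * (u + v)
          lemma = solve-∀
  regroup false true e = trans (lemma σ G A AR RA) (cong (λ z → 0ℤ + z + -1ℤ * (AR + RA)) e)
    where lemma : ∀ s g a u v →
            (0ℤ + (- s * a + -1ℤ * u)) + (s * (s * g + a) + -1ℤ * (0ℤ + v)) ≡ (0ℤ + s * s * g) + -1ℤ * (u + v)
          lemma = solve-∀
  regroup true false e = trans (lemma σ G R AR RA) (cong (λ z → z + 0ℤ + -1ℤ * (AR + RA)) e)
    where lemma : ∀ s g r u v →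
            (s * (s * g + -1ℤ * r) + (0ℤ + -1ℤ * u)) + (0ℤ + -1ℤ * (- s * r + v))
            ≡ (s * s * g + 0ℤ) + -1ℤ * (u + v)
          lemma = solve-∀
  regroup true true e = trans (lemma σ G R A AR RA) (cong (λ z → z + z + -1ℤ * (AR + RA)) e)
    where lemma : ∀ s g r a u v →
            (s * (s * g + -1ℤ * r) + (- s * a + -1ℤ * u)) + (s * (s * g + a) + -1ℤ * (- s * r + v))
            ≡ (s * s * g + s * s * g) + -1ℤ * (u + v)
          lemma = solve-∀

  cancel : ∀ u v → (u + v) + -1ℤ * v ≡ u
  cancel = solve-∀

-- Adding and removing a domino

up down : (List ℕ → ℤ) → List ℕ → ℤ
up   = add nothing
down = removeAlt

down-up : ∀ {l} g → TrailingZero g → Partition nothing l →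
  down (up g) l ≡ g l + -1ℤ * up (down g) l
down-up {l} g t p = trans (lemma (up (down g) l) _) (cong (_+ -1ℤ * up (down g) l) (anticommutator g t p))
  where lemma : ∀ u v → v ≡ (u + v) + -1ℤ * u
        lemma = solve-∀

-- Each of the two exchanges produces a term `down g`; the second exchange happens behind a minus
-- sign, so these terms cancel.
down²-up : ∀ {l} g → TrailingZero g → Partition nothing l →
  down (down (up g)) l ≡ up (down (down g)) l
down²-up {l} g t p = begin
  down (down (up g)) l
    ≡⟨ remove-cong l (λ c → down-up g t (RemoveBox-Partition p c)) ⟩
  down (λ m → g m + -1ℤ * up (down g) m) l
    ≡⟨ remove-+ -1ℤ g _ l ⟩
  down g l + down (λ m → -1ℤ * up (down g) m) l
    ≡⟨ cong (down g l +_) (remove-* -1ℤ -1ℤ _ l) ⟩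
  down g l + -1ℤ * down (up (down g)) l
    ≡⟨ cong (λ z → down g l + -1ℤ * z) (down-up (down g) (remove-TrailingZero -1ℤ g t) p) ⟩
  down g l + -1ℤ * (down g l + -1ℤ * up (down (down g)) l)
    ≡⟨ lemma (down g l) _ ⟩
  up (down (down g)) l ∎
  where lemma : ∀ d u → d + -1ℤ * (d + -1ℤ * u) ≡ u
        lemma = solve-∀

up^ : ℕ → (List ℕ → ℤ) → List ℕ → ℤ
up^ zero    g = g
up^ (suc n) g = up (up^ n g)

up^-TrailingZero : ∀ n {g} → TrailingZero g → TrailingZero (up^ n g)
up^-TrailingZero zero    t = t
up^-TrailingZero (suc n) t = add-TrailingZero nothing _ (up^-TrailingZero n t)

up^-cong : ∀ n {g h l} → Partition nothing l → (∀ {m} → Partition nothing m → g m ≡ h m) → up^ n g l ≡ up^ n h l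
up^-cong zero    p e = e p
up^-cong (suc n) {l = l} p e = add-cong l (λ c → up^-cong n (AddBox-Partition p c) e)

up^-+ : ∀ n g h l → up^ n (λ m → g m + h m) l ≡ up^ n g l + up^ n h l
up^-+ zero    g h l = refl
up^-+ (suc n) g h l = trans (add-cong l (λ {m} _ → up^-+ n g h m)) (add-+ nothing _ _ l)

up^-* : ∀ n a g l → up^ n (λ m → a * g m) l ≡ a * up^ n g l
up^-* zero    a g l = refl
up^-* (suc n) a g l = trans (add-cong l (λ {m} _ → up^-* n a g m)) (add-* nothing a _ l)

up^-suc : ∀ n g l → up^ (suc n) g l ≡ up^ n (up g) l
up^-suc zero    g l = refl
up^-suc (suc n) g l = add-cong l (λ {m} _ → up^-suc n g m)

down²-up^ : ∀ n {l} g → TrailingZero g → Partition nothing l →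
  down (down (up^ n g)) l ≡ up^ n (down (down g)) l
down²-up^ zero    g t p = refl
down²-up^ (suc n) {l} g t p = trans (down²-up (up^ n g) (up^-TrailingZero n t) p)
  (add-cong l (λ c → down²-up^ n g t (AddBox-Partition p c)))

raiseHd lowerHd : List ℕ → List ℕ
raiseHd []       = 1 ∷ []
raiseHd (x ∷ xs) = suc x ∷ xs
lowerHd []       = []
lowerHd (x ∷ xs) = pred x ∷ xs

tl : List ℕ → List ℕ
tl []       = []
tl (_ ∷ xs) = xs

-- Two boxes added to one row have equal signs, so a horizontal domino has none. In a vertical one
-- the upper box comes first and sees the `x` cells of the lower row in addition to everything the
-- lower box sees, whence `signPow x`.
addHorizontal addVertical : Bound → (List ℕ → ℤ) → List ℕ → ℤ
addHorizontal b g []       = g (2 ∷ []) when 1 <ᴮ b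
addHorizontal b g (x ∷ xs) = (g (suc (suc x) ∷ xs) when suc x <ᴮ b) + addHorizontal (just x) (g ∘ (x ∷_)) xs
addVertical b g []       = g (1 ∷ 1 ∷ []) when 0 <ᴮ b
addVertical b g (x ∷ xs) = ((signPow x * g (suc x ∷ raiseHd xs) when x <ᴮ b) when hd xs ≡ᵇ x)
                           + addVertical (just x) (g ∘ (x ∷_)) xs

-- In a vertical domino the lower box goes first, and the upper one then sees `pred x` more cells
-- than it did. The alternating signs of two neighbouring rows contribute one further minus, which
-- makes `signPow x`.
removeHorizontal removeVertical : (List ℕ → ℤ) → List ℕ → ℤ
removeHorizontal g []       = 0ℤ
removeHorizontal g (x ∷ xs) = (g (pred (pred x) ∷ xs) when suc (hd xs) <ᵇ x) + removeHorizontal (g ∘ (x ∷_)) xs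
removeVertical g []       = 0ℤ
removeVertical g (x ∷ xs) = ((signPow x * g (pred x ∷ lowerHd xs) when hd (tl xs) <ᵇ x) when hd xs ≡ᵇ x)
                            + removeVertical (g ∘ (x ∷_)) xs

<ᴮ-pred : ∀ {x} b → suc x <ᴮ b ≡ true → x <ᴮ b ≡ true
<ᴮ-pred {x} b p = ≤ᴮ⇒<ᴮ b (≤ᴮ-pred b (<ᴮ⇒≤ᴮ b p))

≡ᵇ-refl : ∀ x → (x ≡ᵇ x) ≡ true
≡ᵇ-refl zero    = refl
≡ᵇ-refl (suc x) = ≡ᵇ-refl x

≡ᵇ⇒≡ : ∀ x y → (x ≡ᵇ y) ≡ true → x ≡ y
≡ᵇ⇒≡ zero    zero    _ = refl
≡ᵇ⇒≡ (suc x) (suc y) p = cong suc (≡ᵇ⇒≡ x y p)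

split-≤ : ∀ z {y x} → y ≤ x → z ≡ (z when y ≡ᵇ x) + (z when y <ᵇ x)
split-≤ z {x = zero}  z≤n     = sym (ℤₚ.+-identityʳ z)
split-≤ z {x = suc x} z≤n     = sym (ℤₚ.+-identityˡ z)
split-≤ z (s≤s p) = split-≤ z p

-- A longer row above frees one new position, at the end of the first row of `xs` if that has length
-- `x`: the lower half of a vertical domino.
add-widen : ∀ {x xs} g → Partition (just x) xs →
  add (just (suc x)) g xs ≡ (signPow (sum (tl xs)) * g (raiseHd xs) when hd xs ≡ᵇ x) + add (just x) g xs
add-widen {x} g [] = trans (split-≤ (g (1 ∷ [])) {0} {x} z≤n)
  (cong (λ z → (z when 0 ≡ᵇ x) + (g (1 ∷ []) when 0 <ᵇ x)) (sym (ℤₚ.*-identityˡ (g (1 ∷ [])))))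
add-widen {x} {y ∷ ys} g (p ∷ q) rewrite ≤ᴮ⇒<ᴮ (just (suc x)) (s≤s p) =
  trans (cong (_+ add (just y) (g ∘ (y ∷_)) ys) (split-≤ (signPow (sum ys) * g (suc y ∷ ys)) p))
        (ℤₚ.+-assoc ((signPow (sum ys) * g (suc y ∷ ys)) when y ≡ᵇ x) _ _)

signPow-cancel : ∀ m n z → signPow (m ℕ.+ n) * (signPow n * z) ≡ signPow m * z
signPow-cancel m n z rewrite signPow-+ m n = begin
  signPow m * signPow n * (signPow n * z) ≡⟨ lemma (signPow m) (signPow n) z ⟩
  signPow m * (signPow n * signPow n * z) ≡⟨ cong (λ u → signPow m * (u * z)) (signPow-square n) ⟩
  signPow m * (1ℤ * z)                    ≡⟨ cong (signPow m *_) (ℤₚ.*-identityˡ z) ⟩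
  signPow m * z                           ∎
  where lemma : ∀ a b z → a * b * (b * z) ≡ a * (b * b * z)
        lemma = solve-∀

signPow-self : ∀ n z → signPow n * (signPow n * z) ≡ z
signPow-self n z = trans (signPow-cancel 0 n z) (ℤₚ.*-identityˡ z)

sum≡ : ∀ l → sum l ≡ hd l ℕ.+ sum (tl l)
sum≡ []      = refl
sum≡ (_ ∷ _) = refl

add² : ∀ {b l} g → Partition b l → add b (add b g) l ≡ addHorizontal b g l + addVertical b g l
add² {b} g [] = begin
  ((1ℤ * g (2 ∷ []) when 1 <ᴮ b) + g (1 ∷ 1 ∷ []) when 0 <ᴮ b)
    ≡⟨ cong (λ z → (z when 1 <ᴮ b) + g (1 ∷ 1 ∷ []) when 0 <ᴮ b) (ℤₚ.*-identityˡ (g (2 ∷ []))) ⟩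
  ((g (2 ∷ []) when 1 <ᴮ b) + g (1 ∷ 1 ∷ []) when 0 <ᴮ b)
    ≡⟨ merge ⟩
  (g (2 ∷ []) when 1 <ᴮ b) + (g (1 ∷ 1 ∷ []) when 0 <ᴮ b) ∎
  where
  merge : ((g (2 ∷ []) when 1 <ᴮ b) + g (1 ∷ 1 ∷ []) when 0 <ᴮ b)
          ≡ (g (2 ∷ []) when 1 <ᴮ b) + (g (1 ∷ 1 ∷ []) when 0 <ᴮ b)
  merge with 1 <ᴮ b in e
  ... | false = trans (cong (_when 0 <ᴮ b) (ℤₚ.+-identityˡ _)) (sym (ℤₚ.+-identityˡ _))
  ... | true rewrite <ᴮ-pred b e = refl
add² {b} {x ∷ xs} g (p ∷ q) = begin
  (σ * ((σ * g (suc (suc x) ∷ xs) when suc x <ᴮ b) + add (just (suc x)) k xs) when x <ᴮ b)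
    + add (just x) (λ ys → (signPow (sum ys) * k ys when x <ᴮ b) + add (just x) (g ∘ (x ∷_)) ys) xs
    ≡⟨ cong₂ _+_ (cong (λ z → σ * ((σ * G when suc x <ᴮ b) + z) when x <ᴮ b) (add-widen k q))
                 (trans (add-+ (just x) _ _ xs) (cong₂ _+_ (trans (add-when (just x) _ (x <ᴮ b) xs)
                    (cong (_when x <ᴮ b) (add-sign (just x) k xs))) (add² (g ∘ (x ∷_)) q))) ⟩
  (σ * ((σ * G when suc x <ᴮ b) + ((signPow (sum (tl xs)) * K when hd xs ≡ᵇ x) + A)) when x <ᴮ b)
    + ((- σ * A when x <ᴮ b) + (H + V))
    ≡⟨ regroup ⟩
  ((G when suc x <ᴮ b) + H) + (((signPow x * K when x <ᴮ b) when hd xs ≡ᵇ x) + V) ∎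
  where
  σ = signPow (sum xs)
  G = g (suc (suc x) ∷ xs)
  k = g ∘ (suc x ∷_)
  K = k (raiseHd xs)
  A = add (just x) k xs
  H = addHorizontal (just x) (g ∘ (x ∷_)) xs
  V = addVertical (just x) (g ∘ (x ∷_)) xs

  vertical : σ * (signPow (sum (tl xs)) * K when hd xs ≡ᵇ x) ≡ (signPow x * K when hd xs ≡ᵇ x)
  vertical with hd xs ≡ᵇ x in e
  ... | false = ℤₚ.*-zeroʳ σ
  ... | true  = trans (cong (λ n → signPow n * (signPow (sum (tl xs)) * K)) (sum≡ xs))
                  (trans (signPow-cancel (hd xs) (sum (tl xs)) K) (cong (λ n → signPow n * K) (≡ᵇ⇒≡ (hd xs) x e)))

  horizontal : σ * (σ * G when suc x <ᴮ b) ≡ (G when suc x <ᴮ b)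
  horizontal = trans (*-when σ _ (suc x <ᴮ b)) (cong (_when suc x <ᴮ b) (signPow-self (sum xs) G))

  regroup : (σ * ((σ * G when suc x <ᴮ b) + ((signPow (sum (tl xs)) * K when hd xs ≡ᵇ x) + A)) when x <ᴮ b)
              + ((- σ * A when x <ᴮ b) + (H + V))
            ≡ ((G when suc x <ᴮ b) + H) + (((signPow x * K when x <ᴮ b) when hd xs ≡ᵇ x) + V)
  regroup with x <ᴮ b in c
  ... | true = trans (lemma σ (σ * G when suc x <ᴮ b) (signPow (sum (tl xs)) * K when hd xs ≡ᵇ x) A H V)
                 (cong₂ (λ u v → (u + H) + (v + V)) horizontal vertical)
    where lemma : ∀ s g k a h v → s * (g + (k + a)) + (- s * a + (h + v)) ≡ (s * g + h) + (s * k + v)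
          lemma = solve-∀
  ... | false with suc x <ᴮ b in c′
  ...   | true  = contradiction (trans (sym c) (<ᴮ-pred b c′)) λ ()
  ...   | false rewrite when-0 (hd xs ≡ᵇ x) = lemma H V
    where lemma : ∀ h v → 0ℤ + (0ℤ + (h + v)) ≡ (0ℤ + h) + (0ℤ + v)
          lemma = solve-∀

<ᵇ-irrefl : ∀ k → (k <ᵇ k) ≡ false
<ᵇ-irrefl zero    = refl
<ᵇ-irrefl (suc k) = <ᵇ-irrefl k

<⇒≢ᵇ : ∀ y x → (y <ᵇ x) ≡ true → (y ≡ᵇ x) ≡ false
<⇒≢ᵇ zero    (suc x) _ = refl
<⇒≢ᵇ (suc y) (suc x) p = <⇒≢ᵇ y x p

<-or-≡ : ∀ {y x} → y ≤ x → (y <ᵇ x) ≡ true ⊎ y ≡ x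
<-or-≡ {x = zero}  z≤n = inj₂ refl
<-or-≡ {x = suc x} z≤n = inj₁ refl
<-or-≡ (s≤s p) = Sum.map₂ (cong suc) (<-or-≡ p)

remove-narrow-equal : ∀ y ys (g : List ℕ → ℤ) → down (λ m → signPow (sum m) * g m when hd m <ᵇ y) (y ∷ ys)
  ≡ -1ℤ * (signPow y * g (pred y ∷ ys) when hd ys <ᵇ y)
remove-narrow-equal zero ys g rewrite remove-0 -1ℤ ys = refl
remove-narrow-equal (suc y) ys g
  rewrite ≤ᴮ⇒<ᴮ (just (suc y)) (ℕₚ.n<1+n y) | <ᵇ-irrefl y | remove-0 -1ℤ ys with hd ys <ᵇ suc y
... | false = refl
... | true  = begin
  signPow (sum ys) * (signPow (y ℕ.+ sum ys) * g (y ∷ ys)) + 0ℤ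
    ≡⟨ lemma₁ (signPow (sum ys)) (signPow (y ℕ.+ sum ys)) (g (y ∷ ys)) ⟩
  signPow (y ℕ.+ sum ys) * (signPow (sum ys) * g (y ∷ ys))
    ≡⟨ signPow-cancel y (sum ys) (g (y ∷ ys)) ⟩
  signPow y * g (y ∷ ys)
    ≡⟨ lemma₂ (signPow y) (g (y ∷ ys)) ⟩
  -1ℤ * (- signPow y * g (y ∷ ys)) ∎
  where
  lemma₁ : ∀ s t z → s * (t * z) + 0ℤ ≡ t * (s * z)
  lemma₁ = solve-∀
  lemma₂ : ∀ s z → s * z ≡ -1ℤ * (- s * z)
  lemma₂ = solve-∀

-- The condition says that the row of length `x` above can lose a box afterwards. If the first row
-- of `xs` is shorter than `x`, this is no restriction. If it has length `x`, the box must have come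
-- from its end: the lower half of a vertical domino.
remove-narrow : ∀ {x xs} g → Partition (just x) xs →
  down (λ m → signPow (sum m) * g m when hd m <ᵇ x) xs
  ≡ (- signPow (sum xs) * down g xs when hd xs <ᵇ x)
    + -1ℤ * ((signPow x * g (lowerHd xs) when hd (tl xs) <ᵇ x) when hd xs ≡ᵇ x)
remove-narrow {x} g [] = trans (lemma (signPow x * g []) (0 <ᵇ x)) (cong (λ z → ((-1ℤ * 0ℤ when 0 <ᵇ x)) + -1ℤ * z) (side x))
  where
  lemma : ∀ z c → 0ℤ ≡ (-1ℤ * 0ℤ when c) + -1ℤ * 0ℤ
  lemma z false = refl
  lemma z true  = refl
  side : ∀ x → 0ℤ ≡ ((signPow x * g [] when 0 <ᵇ x) when 0 ≡ᵇ x)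
  side zero    = refl
  side (suc x) = refl
remove-narrow {x} {y ∷ ys} g (p ∷ q) with <-or-≡ p
... | inj₂ refl = trans (remove-narrow-equal y ys g) (sym (right (<ᵇ-irrefl y) (≡ᵇ-refl y)))
  where
  right : ∀ {c d u v} → c ≡ false → d ≡ true → (u when c) + -1ℤ * (v when d) ≡ -1ℤ * v
  right refl refl = ℤₚ.+-identityˡ _
... | inj₁ c = trans (remove-cong (y ∷ ys) below)
    (trans (remove-sign -1ℤ g (y ∷ ys)) (sym (left c (<⇒≢ᵇ y x c))))
  where
  left : ∀ {c d u v} → c ≡ true → d ≡ false → (u when c) + -1ℤ * (v when d) ≡ u
  left refl refl = ℤₚ.+-identityʳ _
  <⇒below : ∀ {z} → z ≤ y → (z <ᵇ x) ≡ true
  <⇒below r = ≤ᴮ⇒<ᴮ (just x) (ℕₚ.≤-<-trans r (<ᴮ⇒≤ᴮ (just x) c))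
  below : ∀ {m} → RemoveBox (y ∷ ys) m →
    (signPow (sum m) * g m when hd m <ᵇ x) ≡ signPow (sum m) * g m
  below {m} (here {x = z} _) = cong (signPow (sum m) * g m when_) (<⇒below (ℕₚ.n≤1+n z))
  below {m} (there _) = cong (signPow (sum m) * g m when_) c

down² : ∀ {b l} g → Partition b l → down (down g) l ≡ removeHorizontal g l + removeVertical g l
down² g [] = refl
down² {l = x ∷ xs} g (p ∷ q) = begin
  (σ * down g (pred x ∷ xs) when hd xs <ᵇ x)
    + -1ℤ * down (λ ys → (signPow (sum ys) * k ys when hd ys <ᵇ x) + -1ℤ * down (g ∘ (x ∷_)) ys) xs
    ≡⟨ cong (λ z → (σ * down g (pred x ∷ xs) when hd xs <ᵇ x) + -1ℤ * z)
         (trans (remove-+ -1ℤ _ _ xs) (cong₂ _+_ (remove-narrow k q)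
           (trans (remove-* -1ℤ -1ℤ _ xs) (cong (-1ℤ *_) (down² (g ∘ (x ∷_)) q))))) ⟩
  (σ * ((σ * G when hd xs <ᵇ pred x) + -1ℤ * D) when hd xs <ᵇ x)
    + -1ℤ * (((- σ * D when hd xs <ᵇ x) + -1ℤ * W) + -1ℤ * (H + V))
    ≡⟨ regroup (hd xs) x ⟩
  ((G when suc (hd xs) <ᵇ x) + H) + (W + V) ∎
  where
  σ = signPow (sum xs)
  G = g (pred (pred x) ∷ xs)
  k = g ∘ (pred x ∷_)
  D = down k xs
  W = (signPow x * k (lowerHd xs) when hd (tl xs) <ᵇ x) when hd xs ≡ᵇ x
  H = removeHorizontal (g ∘ (x ∷_)) xs
  V = removeVertical (g ∘ (x ∷_)) xs

  none : ∀ s d w h v → 0ℤ + -1ℤ * ((0ℤ + -1ℤ * w) + -1ℤ * (h + v)) ≡ (0ℤ + h) + (w + v)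
  none = solve-∀

  some : ∀ s g d w h v →
    s * (g + -1ℤ * d) + -1ℤ * ((- s * d + -1ℤ * w) + -1ℤ * (h + v)) ≡ (s * g + h) + (w + v)
  some = solve-∀

  regroup : ∀ y x →
    (σ * ((σ * G when y <ᵇ pred x) + -1ℤ * D) when y <ᵇ x)
      + -1ℤ * (((- σ * D when y <ᵇ x) + -1ℤ * W) + -1ℤ * (H + V))
    ≡ ((G when suc y <ᵇ x) + H) + (W + V)
  regroup y zero = none σ D W H V
  regroup y (suc x) with y <ᵇ suc x in c
  ... | true  = trans (some σ (σ * G when y <ᵇ x) D W H V) (cong (λ z → (z + H) + (W + V))
                  (trans (*-when σ _ (y <ᵇ x)) (cong (_when y <ᵇ x) (signPow-self (sum xs) G))))
  ... | false with y <ᵇ x in c′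
  ...   | true  = contradiction (trans (sym c) (≤ᴮ⇒<ᴮ (just (suc x)) (ℕₚ.m≤n⇒m≤1+n (<ᴮ⇒≤ᴮ (just x) c′)))) λ ()
  ...   | false = none σ D W H V

n≢ᵇ1+n : ∀ k → (k ≡ᵇ suc k) ≡ false
n≢ᵇ1+n zero    = refl
n≢ᵇ1+n (suc k) = n≢ᵇ1+n k

hd-δ : ∀ k → hd (δ k) ≡ k
hd-δ zero    = refl
hd-δ (suc k) = refl

δ-Partition : ∀ {b} k → k ≤ᴮ b → Partition b (δ k)
δ-Partition zero    p = []
δ-Partition (suc k) p = p ∷ δ-Partition k (ℕₚ.n≤1+n k)

removeHorizontal-δ : ∀ k g → removeHorizontal g (δ k) ≡ 0ℤ
removeHorizontal-δ zero g = refl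
removeHorizontal-δ (suc k) g rewrite hd-δ k | <ᵇ-irrefl k = trans (ℤₚ.+-identityˡ _) (removeHorizontal-δ k _)

removeVertical-δ : ∀ k g → removeVertical g (δ k) ≡ 0ℤ
removeVertical-δ zero g = refl
removeVertical-δ (suc k) g rewrite hd-δ k | n≢ᵇ1+n k = trans (ℤₚ.+-identityˡ _) (removeVertical-δ k _)

down²-δ : ∀ k g → down (down g) (δ k) ≡ 0ℤ
down²-δ k g = trans (down² {nothing} g (δ-Partition k tt)) (cong₂ _+_ (removeHorizontal-δ k g) (removeVertical-δ k g))

up^-down²-δ : ∀ k n g → TrailingZero g → up^ n (down (down g)) (δ k) ≡ 0ℤ
up^-down²-δ k n g t = trans (sym (down²-up^ n g t (δ-Partition k tt))) (down²-δ k (up^ n g))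

-- Weights

infixl 7 _·_
_·_ : Mono → Mono → Mono
_·_ = mulMono

mono-≡ : ∀ {a a′ b b′ c c′ : ℕ} → a ≡ a′ → b ≡ b′ → c ≡ c′ → (a , b , c) ≡ (a′ , b′ , c′)
mono-≡ refl refl refl = refl

·-assoc : ∀ p q r → (p · q) · r ≡ p · (q · r)
·-assoc (a , b , c) (a′ , b′ , c′) (a″ , b″ , c″) =
  mono-≡ (ℕₚ.+-assoc a a′ a″) (ℕₚ.+-assoc b b′ b″) (ℕₚ.+-assoc c c′ c″)

·-comm : ∀ p q → p · q ≡ q · p
·-comm (a , b , c) (a′ , b′ , c′) = mono-≡ (ℕₚ.+-comm a a′) (ℕₚ.+-comm b b′) (ℕₚ.+-comm c c′)

·-swap : ∀ p q r → p · (q · r) ≡ q · (p · r)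
·-swap p q r = trans (sym (·-assoc p q r)) (trans (cong (_· r) (·-comm p q)) (·-assoc q p r))

bit : Bool → ℕ
bit true  = 1
bit false = 0

parityWeight : Bool → Bool → Mono
parityWeight p q = bit p , bit q , bit (p ∧ q)

cellWeight : ℕ → ℕ → Mono
cellWeight i j = parityWeight (isEven i) (isEven j)

rowWeight : ℕ → ℕ → Mono
rowWeight r zero    = 0 , 0 , 0
rowWeight r (suc x) = rowWeight r x · cellWeight r (suc x)

weight : ℕ → List ℕ → Mono
weight r []       = 0 , 0 , 0
weight r (x ∷ xs) = rowWeight r x · weight (suc r) xs

weight-TrailingZero : ∀ φ r → TrailingZero (φ ∘ weight r)
weight-TrailingZero φ r []       = refl
weight-TrailingZero φ r (x ∷ xs) = weight-TrailingZero (φ ∘ (rowWeight r x ·_)) (suc r) xs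

isEven-suc : ∀ n → isEven (suc n) ≡ not (isEven n)
isEven-suc zero          = refl
isEven-suc (suc zero)    = refl
isEven-suc (suc (suc n)) = isEven-suc n

horizontalWeight : ℕ → Mono
horizontalWeight r with isEven r
... | true  = 2 , 1 , 1
... | false = 0 , 1 , 0

-- The monomial of a vertical domino in column x + 1; in the identities below it carries the sign (-1)^x.
verticalWeight : ℕ → Mono
verticalWeight x with isEven x
... | true  = 1 , 0 , 0
... | false = 1 , 2 , 1

total : Mono
total = 2 , 2 , 1

xMono yMono : Mono
xMono = 1 , 0 , 0
yMono = 0 , 1 , 0

-- Of two neighbouring columns exactly one is even, so the monomial depends on the row only.
horizontal-cells : ∀ r j → cellWeight r j · cellWeight r (suc j) ≡ horizontalWeight r
horizontal-cells r j rewrite isEven-suc j with isEven r | isEven j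
... | false | false = refl
... | false | true  = refl
... | true  | false = refl
... | true  | true  = refl

horizontal-total : ∀ r → horizontalWeight r · horizontalWeight (suc r) ≡ total
horizontal-total r rewrite isEven-suc r with isEven r
... | false = refl
... | true  = refl

vertical-cells : ∀ r x → cellWeight r (suc x) · cellWeight (suc r) (suc x) ≡ verticalWeight x
vertical-cells r x rewrite isEven-suc r | isEven-suc x with isEven r | isEven x
... | false | false = refl
... | false | true  = refl
... | true  | false = refl
... | true  | true  = refl

vertical-total : ∀ x → verticalWeight x · verticalWeight (suc x) ≡ total
vertical-total x rewrite isEven-suc x with isEven x
... | false = refl
... | true  = refl

horizontal-added : ∀ r x w → rowWeight r (suc (suc x)) · w ≡ horizontalWeight r · (rowWeight r x · w)
horizontal-added r x w = begin
  ((ρ · c) · d) · w ≡⟨ cong (_· w) (trans (·-assoc ρ c d) (·-comm ρ (c · d))) ⟩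
  ((c · d) · ρ) · w ≡⟨ cong (λ z → (z · ρ) · w) (horizontal-cells r (suc x)) ⟩
  (h · ρ) · w       ≡⟨ ·-assoc h ρ w ⟩
  h · (ρ · w)       ∎
  where
  ρ = rowWeight r x
  c = cellWeight r (suc x)
  d = cellWeight r (suc (suc x))
  h = horizontalWeight r

-- Losing a domino divides the weight by `horizontalWeight r`, and `total` is this monomial times
-- that of row `suc r`. The identity is written without division.
horizontal-removed : ∀ r x w → total · (rowWeight r x · w)
  ≡ rowWeight r (suc (suc x)) · (horizontalWeight (suc r) · w)
horizontal-removed r x w = begin
  total · (ρ · w)     ≡⟨ cong (_· (ρ · w)) (sym (horizontal-total r)) ⟩
  (h · h′) · (ρ · w)  ≡⟨ ·-assoc h h′ (ρ · w) ⟩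
  h · (h′ · (ρ · w))  ≡⟨ cong (h ·_) (·-swap h′ ρ w) ⟩
  h · (ρ · (h′ · w))  ≡⟨ sym (horizontal-added r x (h′ · w)) ⟩
  rowWeight r (suc (suc x)) · (h′ · w) ∎
  where
  ρ = rowWeight r x
  h = horizontalWeight r
  h′ = horizontalWeight (suc r)

vertical-added : ∀ r x w → rowWeight r (suc x) · (rowWeight (suc r) (suc x) · w)
  ≡ verticalWeight x · (rowWeight r x · (rowWeight (suc r) x · w))
vertical-added r x w = begin
  (ρ · c) · ((ρ′ · c′) · w)   ≡⟨ ·-assoc ρ c _ ⟩
  ρ · (c · ((ρ′ · c′) · w))   ≡⟨ cong (λ z → ρ · (c · z)) (trans (·-assoc ρ′ c′ w) (·-swap ρ′ c′ w)) ⟩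
  ρ · (c · (c′ · (ρ′ · w)))   ≡⟨ cong (ρ ·_) (sym (·-assoc c c′ _)) ⟩
  ρ · ((c · c′) · (ρ′ · w))   ≡⟨ ·-swap ρ (c · c′) _ ⟩
  (c · c′) · (ρ · (ρ′ · w))   ≡⟨ cong (_· (ρ · (ρ′ · w))) (vertical-cells r x) ⟩
  verticalWeight x · (ρ · (ρ′ · w)) ∎
  where
  ρ = rowWeight r x
  ρ′ = rowWeight (suc r) x
  c = cellWeight r (suc x)
  c′ = cellWeight (suc r) (suc x)

-- The domino lost lies in column `suc x`, with monomial `verticalWeight x`; the complementary
-- factor of `total` is the monomial of the next column.
vertical-removed : ∀ r x w → total · (rowWeight r x · (rowWeight (suc r) x · w))
  ≡ verticalWeight (suc x) · (rowWeight r (suc x) · (rowWeight (suc r) (suc x) · w))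
vertical-removed r x w = begin
  total · ρρw       ≡⟨ cong (_· ρρw) (trans (sym (vertical-total x)) (·-comm ν ν′)) ⟩
  (ν′ · ν) · ρρw    ≡⟨ ·-assoc ν′ ν ρρw ⟩
  ν′ · (ν · ρρw)    ≡⟨ cong (ν′ ·_) (sym (vertical-added r x w)) ⟩
  ν′ · (rowWeight r (suc x) · (rowWeight (suc r) (suc x) · w)) ∎
  where
  ρρw = rowWeight r x · (rowWeight (suc r) x · w)
  ν = verticalWeight x
  ν′ = verticalWeight (suc x)

removeHorizontal-cong : ∀ {g h} l → (∀ m → g m ≡ h m) → removeHorizontal g l ≡ removeHorizontal h l
removeHorizontal-cong []       e = refl
removeHorizontal-cong (x ∷ xs) e =
  cong₂ _+_ (cong (_when suc (hd xs) <ᵇ x) (e _)) (removeHorizontal-cong xs (e ∘ (x ∷_)))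

removeVertical-cong : ∀ {g h} l → (∀ m → g m ≡ h m) → removeVertical g l ≡ removeVertical h l
removeVertical-cong []       e = refl
removeVertical-cong (x ∷ xs) e =
  cong₂ _+_ (cong (λ z → (signPow x * z when hd (tl xs) <ᵇ x) when hd xs ≡ᵇ x) (e _))
            (removeVertical-cong xs (e ∘ (x ∷_)))

-- Adding a horizontal domino to row r + 1 is possible exactly when removing one from row r is.
horizontal-telescope : ∀ b φ r l →
  addHorizontal b (φ ∘ weight r) l
  ≡ removeHorizontal (φ ∘ (total ·_) ∘ weight r) l + (φ (horizontalWeight r · weight r l) when suc (hd l) <ᴮ b)
horizontal-telescope b φ r [] =
  trans (cong (λ m → φ m when 1 <ᴮ b) (horizontal-added r 0 (0 , 0 , 0))) (sym (ℤₚ.+-identityˡ _))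
horizontal-telescope b φ r (x ∷ xs) = begin
  (φ (rowWeight r (suc (suc x)) · w) when suc x <ᴮ b) + addHorizontal (just x) (φ′ ∘ weight (suc r)) xs
    ≡⟨ cong₂ _+_ (cong (λ m → φ m when suc x <ᴮ b) (horizontal-added r x w)) (horizontal-telescope (just x) φ′ (suc r) xs) ⟩
  top + (removeHorizontal (φ′ ∘ (total ·_) ∘ weight (suc r)) xs + (φ′ (horizontalWeight (suc r) · w) when suc (hd xs) <ᵇ x))
    ≡⟨ lemma top (removeHorizontal (φ′ ∘ (total ·_) ∘ weight (suc r)) xs) _ ⟩
  ((φ′ (horizontalWeight (suc r) · w) when suc (hd xs) <ᵇ x) + removeHorizontal (φ′ ∘ (total ·_) ∘ weight (suc r)) xs) + top
    ≡⟨ cong (_+ top) (cong₂ _+_ (removed x) (removeHorizontal-cong xs λ m → cong φ (·-swap (rowWeight r x) total (weight (suc r) m)))) ⟩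
  removeHorizontal (φ ∘ (total ·_) ∘ weight r) (x ∷ xs) + top ∎
  where
  w = weight (suc r) xs
  φ′ = φ ∘ (rowWeight r x ·_)
  top = φ (horizontalWeight r · (rowWeight r x · w)) when suc x <ᴮ b
  lemma : ∀ t u v → t + (u + v) ≡ (v + u) + t
  lemma = solve-∀
  removed : ∀ x → (φ (rowWeight r x · (horizontalWeight (suc r) · w)) when suc (hd xs) <ᵇ x)
                  ≡ (φ (total · (rowWeight r (pred (pred x)) · w)) when suc (hd xs) <ᵇ x)
  removed zero          = refl
  removed (suc zero)    = refl
  removed (suc (suc x)) = cong (λ m → φ m when suc (hd xs) <ᵇ suc (suc x)) (sym (horizontal-removed r x w))

_==ᴮ_ : ℕ → Bound → Bool
x ==ᴮ nothing = false
x ==ᴮ just b  = x ≡ᵇ b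

-- The term on the left accounts for a run of equal rows that starts above l, in the row of length b.
vertical-telescope : ∀ {b} φ r l → Partition b l →
  addVertical b (φ ∘ weight r) l
    + ((signPow (hd l) * φ (verticalWeight (hd l) · weight r l) when hd l ==ᴮ b) when hd (tl l) ≡ᵇ hd l)
  ≡ removeVertical (φ ∘ (total ·_) ∘ weight r) l + φ (xMono · weight r l)
vertical-telescope {b} φ r [] p =
  trans (cong₂ _+_ (cong (λ m → φ m when 0 <ᴮ b) (vertical-added r 0 (0 , 0 , 0)))
                   (cong (_when 0 ==ᴮ b) (ℤₚ.*-identityˡ (φ xMono)))) (start b)
  where
  -- The empty rows form one endless run. It starts here unless the row above has length 0, in which
  -- case the second term accounts for it; either way its domino in column 1 is counted once and has
  -- no removable partner.
  start : ∀ b → (φ xMono when 0 <ᴮ b) + (φ xMono when 0 ==ᴮ b) ≡ 0ℤ + φ xMono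
  start nothing        = ℤₚ.+-comm (φ xMono) 0ℤ
  start (just zero)    = refl
  start (just (suc b)) = ℤₚ.+-comm (φ xMono) 0ℤ
vertical-telescope {b} φ r (x ∷ xs) (p ∷ q) = begin
  (((signPow x * φ (weight r (suc x ∷ raiseHd xs)) when x <ᴮ b) when c) + AV) + ((N when x ==ᴮ b) when c)
    ≡⟨ cong (λ z → z + AV + ((N when x ==ᴮ b) when c)) (on-equal (λ e → cong (λ m → signPow x * φ m when x <ᴮ b) (raised xs e))) ⟩
  (((N when x <ᴮ b) when c) + AV) + ((N when x ==ᴮ b) when c)
    ≡⟨ regroup c induction ⟩
  (((N when hd (tl xs) <ᵇ x) when c) + RV) + Φ
    ≡⟨ cong (λ z → z + RV + Φ) (on-equal (lowered xs)) ⟩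
  (((signPow x * φ (total · weight r (pred x ∷ lowerHd xs)) when hd (tl xs) <ᵇ x) when c) + RV) + Φ
    ≡⟨ cong₂ (λ u v → (((signPow x * φ (total · weight r (pred x ∷ lowerHd xs)) when hd (tl xs) <ᵇ x) when c) + u) + v)
         (removeVertical-cong xs λ m → cong φ (·-swap (rowWeight r x) total (weight (suc r) m)))
         (cong φ (·-swap (rowWeight r x) xMono w)) ⟩
  removeVertical (φ ∘ (total ·_) ∘ weight r) (x ∷ xs) + φ (xMono · weight r (x ∷ xs)) ∎
  where
  c = hd xs ≡ᵇ x
  w = weight (suc r) xs
  φ′ = φ ∘ (rowWeight r x ·_)
  N = signPow x * φ (verticalWeight x · weight r (x ∷ xs))
  AV = addVertical (just x) (φ′ ∘ weight (suc r)) xs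
  RV = removeVertical (φ′ ∘ (total ·_) ∘ weight (suc r)) xs
  Φ = φ′ (xMono · w)

  on-equal : ∀ {u v} → (hd xs ≡ x → u ≡ v) → (u when c) ≡ (v when c)
  on-equal f with hd xs ≡ᵇ x in e
  ... | true  = f (≡ᵇ⇒≡ (hd xs) x e)
  ... | false = refl

  raised : ∀ xs → hd xs ≡ x → weight r (suc x ∷ raiseHd xs) ≡ verticalWeight x · weight r (x ∷ xs)
  raised []       refl = vertical-added r 0 (0 , 0 , 0)
  raised (x ∷ ys) refl = vertical-added r x (weight (suc (suc r)) ys)

  lowered : ∀ xs → hd xs ≡ x →
    (signPow x * φ (verticalWeight x · weight r (x ∷ xs)) when hd (tl xs) <ᵇ x)
    ≡ (signPow x * φ (total · weight r (pred x ∷ lowerHd xs)) when hd (tl xs) <ᵇ x)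
  lowered []           refl = refl
  lowered (zero ∷ ys)  refl = refl
  lowered (suc y ∷ ys) refl = cong (λ m → signPow x * φ m when hd ys <ᵇ suc y)
                                (sym (vertical-removed r y (weight (suc (suc r)) ys)))

  hd-tl≤ : ∀ {xs} → Partition (just x) xs → hd (tl xs) ≤ x
  hd-tl≤ []      = z≤n
  hd-tl≤ (p ∷ q) = ℕₚ.≤-trans (hd≤ q) p

  induction : AV + ((N when hd (tl xs) ≡ᵇ x) when c) ≡ RV + Φ
  induction = trans (cong (AV +_) boundary) (vertical-telescope φ′ (suc r) xs q)
    where
    boundary : ((N when hd (tl xs) ≡ᵇ x) when c)
      ≡ ((signPow (hd xs) * φ′ (verticalWeight (hd xs) · w) when hd xs ≡ᵇ x) when hd (tl xs) ≡ᵇ hd xs)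
    boundary with hd xs ≡ᵇ x in e
    ... | false = sym (when-0 (hd (tl xs) ≡ᵇ hd xs))
    ... | true with refl ← ≡ᵇ⇒≡ (hd xs) x e =
      cong (λ m → signPow x * φ m when hd (tl xs) ≡ᵇ x) (·-swap (verticalWeight x) (rowWeight r x) w)

  split-bound : ∀ b → x ≤ᴮ b → N ≡ (N when x ==ᴮ b) + (N when x <ᴮ b)
  split-bound nothing  _ = sym (ℤₚ.+-identityˡ N)
  split-bound (just b) p = split-≤ N p

  regroup : ∀ c → AV + ((N when hd (tl xs) ≡ᵇ x) when c) ≡ RV + Φ →
    (((N when x <ᴮ b) when c) + AV) + ((N when x ==ᴮ b) when c)
    ≡ (((N when hd (tl xs) <ᵇ x) when c) + RV) + Φ
  regroup false e = trans (lemma AV) (trans e (lemma′ RV Φ))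
    where
    lemma : ∀ a → (0ℤ + a) + 0ℤ ≡ a + 0ℤ
    lemma = solve-∀
    lemma′ : ∀ a b → a + b ≡ (0ℤ + a) + b
    lemma′ = solve-∀
  -- The first two rows are equal, so they belong to one run, and `N` is the same for every pair of
  -- rows in it. On the adding side the run starts either here or above, on the removing side it
  -- ends either here or below, so `N` is split along `b` and recombined along `hd (tl xs)`.
  regroup true e = begin
    (N₁ + AV) + N₀            ≡⟨ lemma₁ N₁ AV N₀ ⟩
    (N₀ + N₁) + AV            ≡⟨ cong (_+ AV) (trans (sym (split-bound b p)) (split-≤ N (hd-tl≤ q))) ⟩
    (N₂ + N₃) + AV            ≡⟨ lemma₂ N₂ N₃ AV ⟩
    N₃ + (AV + N₂)            ≡⟨ cong (N₃ +_) e ⟩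
    N₃ + (RV + Φ)             ≡⟨ sym (ℤₚ.+-assoc N₃ RV Φ) ⟩
    (N₃ + RV) + Φ             ∎
    where
    N₀ = N when x ==ᴮ b
    N₁ = N when x <ᴮ b
    N₂ = N when hd (tl xs) ≡ᵇ x
    N₃ = N when hd (tl xs) <ᵇ x
    lemma₁ : ∀ u v w → (u + v) + w ≡ (w + u) + v
    lemma₁ = solve-∀
    lemma₂ : ∀ u v w → (u + v) + w ≡ v + (w + u)
    lemma₂ = solve-∀

-- With no row above, the last term of `horizontal-telescope` is always present and gives `yMono`,
-- while the extra term on the left of `vertical-telescope` vanishes, and the empty rows give
-- `xMono`.
up²-weight : ∀ φ {l} → Partition nothing l →
  up (up (φ ∘ weight 1)) l
  ≡ (φ (xMono · weight 1 l) + φ (yMono · weight 1 l)) + down (down (φ ∘ (total ·_) ∘ weight 1)) l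
up²-weight φ {l} p = begin
  up (up (φ ∘ weight 1)) l
    ≡⟨ add² _ p ⟩
  addHorizontal nothing (φ ∘ weight 1) l + AV
    ≡⟨ cong (_+ AV) (horizontal-telescope nothing φ 1 l) ⟩
  (RH + φ (yMono · weight 1 l)) + AV
    ≡⟨ cong ((RH + φ (yMono · weight 1 l)) +_) (trans (trans (sym (ℤₚ.+-identityʳ AV))
         (cong (AV +_) (sym (when-0 (hd (tl l) ≡ᵇ hd l))))) (vertical-telescope φ 1 l p)) ⟩
  (RH + φ (yMono · weight 1 l)) + (RV + φ (xMono · weight 1 l))
    ≡⟨ lemma RH _ RV _ ⟩
  (φ (xMono · weight 1 l) + φ (yMono · weight 1 l)) + (RH + RV)
    ≡⟨ cong ((φ (xMono · weight 1 l) + φ (yMono · weight 1 l)) +_) (sym (down² _ p)) ⟩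
  (φ (xMono · weight 1 l) + φ (yMono · weight 1 l)) + down (down (φ ∘ (total ·_) ∘ weight 1)) l ∎
  where
  AV = addVertical nothing (φ ∘ weight 1) l
  RH = removeHorizontal (φ ∘ (total ·_) ∘ weight 1) l
  RV = removeVertical (φ ∘ (total ·_) ∘ weight 1) l
  lemma : ∀ a b c d → (a + b) + (c + d) ≡ (d + b) + (a + c)
  lemma = solve-∀

-- The identity for two boxes concerns weights, so the two `up` next to the weight must be used.
-- They act on the partitions reached from `δ k` after `n` boxes, which is why the correction term
-- has to be moved through `up^ n` before it vanishes.
up^-step : ∀ n k φ → up^ (suc (suc n)) (φ ∘ weight 1) (δ k)
  ≡ up^ n (φ ∘ (xMono ·_) ∘ weight 1) (δ k) + up^ n (φ ∘ (yMono ·_) ∘ weight 1) (δ k)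
up^-step n k φ = begin
  up (up^ (suc n) g) (δ k)
    ≡⟨ add-cong (δ k) (λ {m} _ → up^-suc n g m) ⟩
  up^ (suc n) (up g) (δ k)
    ≡⟨ up^-suc n (up g) (δ k) ⟩
  up^ n (up (up g)) (δ k)
    ≡⟨ up^-cong n (δ-Partition k tt) (up²-weight φ) ⟩
  up^ n (λ m → (gx m + gy m) + down (down (φ ∘ (total ·_) ∘ weight 1)) m) (δ k)
    ≡⟨ up^-+ n _ _ (δ k) ⟩
  up^ n (λ m → gx m + gy m) (δ k) + up^ n (down (down (φ ∘ (total ·_) ∘ weight 1))) (δ k)
    ≡⟨ cong₂ _+_ (up^-+ n gx gy (δ k)) (up^-down²-δ k n _ (weight-TrailingZero (φ ∘ (total ·_)) 1)) ⟩
  (up^ n gx (δ k) + up^ n gy (δ k)) + 0ℤ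
    ≡⟨ ℤₚ.+-identityʳ _ ⟩
  up^ n gx (δ k) + up^ n gy (δ k) ∎
  where
  g = φ ∘ weight 1
  gx = φ ∘ (xMono ·_) ∘ weight 1
  gy = φ ∘ (yMono ·_) ∘ weight 1

-- Pairing polynomials with functions of monomials

eval : Poly → (Mono → ℤ) → ℤ
eval []            φ = 0ℤ
eval ((m , c) ∷ p) φ = c * φ m + eval p φ

eval-cong : ∀ p {φ ψ} → (∀ m → φ m ≡ ψ m) → eval p φ ≡ eval p ψ
eval-cong []            e = refl
eval-cong ((m , c) ∷ p) e = cong₂ _+_ (cong (c *_) (e m)) (eval-cong p e)

eval-++ : ∀ p q φ → eval (p ++ q) φ ≡ eval p φ + eval q φ
eval-++ []            q φ = sym (ℤₚ.+-identityˡ _)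
eval-++ ((m , c) ∷ p) q φ = trans (cong (c * φ m +_) (eval-++ p q φ)) (sym (ℤₚ.+-assoc (c * φ m) _ _))

eval-*ₚ : ∀ p q φ → eval (p *ₚ q) φ ≡ eval p (λ m → eval q (φ ∘ (m ·_)))
eval-*ₚ []            q φ = refl
eval-*ₚ ((m , c) ∷ p) q φ = trans (eval-++ (map _ q) (p *ₚ q) φ) (cong₂ _+_ (scaled q) (eval-*ₚ p q φ))
  where
  scaled : ∀ q → eval (map (λ t → (m · proj₁ t , c * proj₂ t)) q) φ ≡ c * eval q (φ ∘ (m ·_))
  scaled []             = sym (ℤₚ.*-zeroʳ c)
  scaled ((m′ , d) ∷ q) = trans (cong (c * d * φ (m · m′) +_) (scaled q)) (lemma c d (φ (m · m′)) _)
    where lemma : ∀ c d u v → c * d * u + c * v ≡ c * (d * u + v)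
          lemma = solve-∀

eval-X+Y : ∀ φ → eval (X +ₚ Y) φ ≡ φ xMono + φ yMono
eval-X+Y φ = lemma (φ xMono) (φ yMono)
  where lemma : ∀ u v → 1ℤ * u + (1ℤ * v + 0ℤ) ≡ u + v
        lemma = solve-∀

eval-1ₚ : ∀ φ → eval 1ₚ φ ≡ φ (0 , 0 , 0)
eval-1ₚ φ = trans (ℤₚ.+-identityʳ _) (ℤₚ.*-identityˡ _)

-- In the form `n ℕ.* 2 ℕ.+ j` the exponent of `suc n` unfolds to two further boxes by computation.
-- The remainder `j` is used with 0 and 1.
up^-even : ∀ n j k φ → up^ (n ℕ.* 2 ℕ.+ j) (φ ∘ weight 1) (δ k)
  ≡ eval ((X +ₚ Y) ^ₚ n) (λ m → up^ j (φ ∘ (m ·_) ∘ weight 1) (δ k))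
up^-even zero    j k φ = sym (eval-1ₚ (λ m → up^ j (φ ∘ (m ·_) ∘ weight 1) (δ k)))
up^-even (suc n) j k φ = begin
  up^ (suc (suc (n ℕ.* 2 ℕ.+ j))) (φ ∘ weight 1) (δ k)
    ≡⟨ up^-step (n ℕ.* 2 ℕ.+ j) k φ ⟩
  up^ (n ℕ.* 2 ℕ.+ j) (φ ∘ (xMono ·_) ∘ weight 1) (δ k) + up^ (n ℕ.* 2 ℕ.+ j) (φ ∘ (yMono ·_) ∘ weight 1) (δ k)
    ≡⟨ cong₂ _+_ (shift xMono) (shift yMono) ⟩
  eval P (λ t → Ψ (xMono · t)) + eval P (λ t → Ψ (yMono · t))
    ≡⟨ sym (eval-X+Y (λ s → eval P (λ t → Ψ (s · t)))) ⟩
  eval (X +ₚ Y) (λ s → eval P (λ t → Ψ (s · t)))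
    ≡⟨ sym (eval-*ₚ (X +ₚ Y) P Ψ) ⟩
  eval ((X +ₚ Y) *ₚ P) Ψ ∎
  where
  P = (X +ₚ Y) ^ₚ n
  Ψ : Mono → ℤ
  Ψ m = up^ j (φ ∘ (m ·_) ∘ weight 1) (δ k)
  shift : ∀ m → up^ (n ℕ.* 2 ℕ.+ j) (φ ∘ (m ·_) ∘ weight 1) (δ k) ≡ eval P (λ t → Ψ (m · t))
  shift m = trans (up^-even n j k (φ ∘ (m ·_)))
    (eval-cong P λ t → up^-cong j (δ-Partition k tt) λ {l} _ → cong φ (sym (·-assoc m t (weight 1 l))))

-- The corners of a staircase

-- The sum runs over the k + 1 boxes that can be added to `δ k`, from the top, where the first row
-- has number `r`. The last box, in column 1, has nothing below it and hence no sign.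
corners : ℕ → ℕ → (Mono → ℤ) → ℤ
corners r zero    φ = φ (cellWeight r 1)
corners r (suc k) φ = signPow (sum (δ k)) * φ (cellWeight r (suc (suc k))) + corners (suc r) k φ

corners-cong : ∀ r k {φ ψ} → (∀ m → φ m ≡ ψ m) → corners r k φ ≡ corners r k ψ
corners-cong r zero    e = e _
corners-cong r (suc k) e = cong₂ _+_ (cong (signPow (sum (δ k)) *_) (e _)) (corners-cong (suc r) k e)

add-δ : ∀ k g → add (just (suc k)) g (δ k) ≡ up g (δ k)
add-δ zero    g = refl
add-δ (suc k) g = cong (λ c → (signPow (sum (δ k)) * g (suc (suc k) ∷ δ k) when c) + add (just (suc k)) (g ∘ (suc k ∷_)) (δ k))
                       (≤ᴮ⇒<ᴮ (just (suc (suc k))) ℕₚ.≤-refl)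

up-δ : ∀ r k φ → up (φ ∘ weight r) (δ k) ≡ corners r k (λ m → φ (m · weight r (δ k)))
up-δ r zero    φ = refl
up-δ r (suc k) φ = cong₂ _+_
  (cong (λ m → signPow (sum (δ k)) * φ m) (trans (cong (_· w) (·-comm ρ c)) (·-assoc c ρ w)))
  (trans (add-δ k _) (trans (up-δ (suc r) k (φ ∘ (ρ ·_))) (corners-cong (suc r) k λ m → cong φ (·-swap ρ m w))))
  where
  ρ = rowWeight r (suc k)
  c = cellWeight r (suc (suc k))
  w = weight (suc r) (δ k)

-- The two new rows have 2k + 3 cells together, an odd number.
signPow-δ : ∀ k → signPow (sum (δ (suc (suc k)))) ≡ - signPow (sum (δ k))
signPow-δ k = begin
  signPow (suc (suc k) ℕ.+ (suc k ℕ.+ s))         ≡⟨ cong signPow (lemma k s) ⟩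
  - signPow (k ℕ.+ (k ℕ.+ (suc (suc s))))         ≡⟨ cong -_ (signPow-+ k (k ℕ.+ suc (suc s))) ⟩
  - (signPow k * signPow (k ℕ.+ suc (suc s)))     ≡⟨ cong (λ z → - (signPow k * z)) (signPow-+ k (suc (suc s))) ⟩
  - (signPow k * (signPow k * - - signPow s))     ≡⟨ cong -_ (signPow-self k _) ⟩
  - - - signPow s                                 ≡⟨ ℤₚ.neg-involutive (- signPow s) ⟩
  - signPow s                                     ∎
  where
  s = sum (δ k)
  lemma : ∀ k s → suc (suc k) ℕ.+ (suc k ℕ.+ s) ≡ suc (k ℕ.+ (k ℕ.+ suc (suc s)))
  lemma = ℕSolver.solve-∀

corners-row : ∀ r k φ → corners (suc (suc r)) k φ ≡ corners r k φ
corners-row r zero    φ = refl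
corners-row r (suc k) φ = cong (signPow (sum (δ k)) * φ (cellWeight r (suc (suc k))) +_) (corners-row (suc r) k φ)

-- Among the first four corners, those two rows apart have equal weights and opposite signs.
corners-period : ∀ r k φ → corners r (suc (suc (suc (suc k)))) φ ≡ corners r k φ
corners-period r k φ = trans
  (cong₂ _+_ (cong (_* a) (signPow-δ (suc k))) (cong₂ _+_ (cong (_* b) (signPow-δ k))
    (cong (λ z → s₁ * a + (s₀ * b + z)) (trans (corners-row (suc (suc r)) k φ) (corners-row r k φ)))))
  (lemma s₁ s₀ a b (corners r k φ))
  where
  s₀ = signPow (sum (δ k))
  s₁ = signPow (sum (δ (suc k)))
  a = φ (cellWeight r (suc (suc (suc k))))
  b = φ (cellWeight (suc r) (suc (suc k)))
  lemma : ∀ s t a b z → - s * a + (- t * b + (s * a + (t * b + z))) ≡ z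
  lemma = solve-∀

corners-mod : ∀ q i r φ → corners r (q ℕ.* 4 ℕ.+ i) φ ≡ corners r i φ
corners-mod zero    i r φ = refl
corners-mod (suc q) i r φ = trans (corners-period r (q ℕ.* 4 ℕ.+ i) φ) (corners-mod q i r φ)

corners-% : ∀ k {i} φ → k ℕ.% 4 ≡ i → corners 1 k φ ≡ corners 1 i φ
corners-% k φ refl = trans
  (cong (λ n → corners 1 n φ) (trans (m≡m%n+[m/n]*n k 4) (ℕₚ.+-comm (k ℕ.% 4) _)))
  (corners-mod (k ℕ./ 4) (k ℕ.% 4) 1 φ)

-- Coefficients in even and odd degree

eval-+ : ∀ p φ ψ → eval p (λ m → φ m + ψ m) ≡ eval p φ + eval p ψ
eval-+ []            φ ψ = refl
eval-+ ((m , c) ∷ p) φ ψ = trans (cong (c * (φ m + ψ m) +_) (eval-+ p φ ψ)) (lemma c (φ m) (ψ m) _ _)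
  where lemma : ∀ c u v x y → c * (u + v) + (x + y) ≡ (c * u + x) + (c * v + y)
        lemma = solve-∀

eval-0 : ∀ p → eval p (λ _ → 0ℤ) ≡ 0ℤ
eval-0 []            = refl
eval-0 ((m , c) ∷ p) = cong₂ _+_ (ℤₚ.*-zeroʳ c) (eval-0 p)

indicator : Mono → Mono → ℤ
indicator m t = 1ℤ when monoEq t m

coeff≡eval : ∀ p m → coeff p m ≡ eval p (indicator m)
coeff≡eval []            m = refl
coeff≡eval ((t , c) ∷ p) m with monoEq t m
... | true  = cong₂ _+_ (sym (ℤₚ.*-identityʳ c)) (coeff≡eval p m)
... | false = trans (coeff≡eval p m) (trans (sym (ℤₚ.+-identityˡ _)) (cong (_+ eval p (indicator m)) (sym (ℤₚ.*-zeroʳ c))))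

≡ᵇ-cancel : ∀ k a b → (k ℕ.+ a ≡ᵇ k ℕ.+ b) ≡ (a ≡ᵇ b)
≡ᵇ-cancel zero    a b = refl
≡ᵇ-cancel (suc k) a b = ≡ᵇ-cancel k a b

monoEq-cancel : ∀ w s m → monoEq (w · s) (w · m) ≡ monoEq s m
monoEq-cancel (a , b , c) (a₁ , b₁ , c₁) (a₂ , b₂ , c₂) =
  cong₂ _∧_ (≡ᵇ-cancel a a₁ a₂) (cong₂ _∧_ (≡ᵇ-cancel b b₁ b₂) (≡ᵇ-cancel c c₁ c₂))

indicator-cancel : ∀ w s m → indicator (w · m) (w · s) ≡ indicator m s
indicator-cancel w s m = cong (1ℤ when_) (monoEq-cancel w s m)

-- `weight` sees all cells of a diagram, the statistics of `F` only those outside `δ k`. Shifting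
-- the target monomial by the weight of `δ k` makes up for this without negative exponents.
shifted : ℕ → Mono → Mono → ℤ
shifted k m = indicator (weight 1 (δ k) · m)

even-coeff : ∀ k n m → up^ (n ℕ.* 2 ℕ.+ 0) (shifted k m ∘ weight 1) (δ k) ≡ coeff ((X +ₚ Y) ^ₚ n) m
even-coeff k n m = begin
  up^ (n ℕ.* 2 ℕ.+ 0) (shifted k m ∘ weight 1) (δ k)
    ≡⟨ up^-even n 0 k (shifted k m) ⟩
  eval P (λ s → shifted k m (s · w))
    ≡⟨ eval-cong P (λ s → trans (cong (shifted k m) (·-comm s w)) (indicator-cancel w s m)) ⟩
  eval P (indicator m)
    ≡⟨ sym (coeff≡eval P m) ⟩
  coeff P m ∎
  where
  P = (X +ₚ Y) ^ₚ n
  w = weight 1 (δ k)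

odd-coeff : ∀ k n m → up^ (n ℕ.* 2 ℕ.+ 1) (shifted k m ∘ weight 1) (δ k)
  ≡ eval ((X +ₚ Y) ^ₚ n) (λ s → corners 1 (k ℕ.% 4) (λ c → indicator m (c · s)))
odd-coeff k n m = begin
  up^ (n ℕ.* 2 ℕ.+ 1) (shifted k m ∘ weight 1) (δ k)
    ≡⟨ up^-even n 1 k (shifted k m) ⟩
  eval P (λ s → up (shifted k m ∘ (s ·_) ∘ weight 1) (δ k))
    ≡⟨ eval-cong P (λ s → trans (up-δ 1 k (shifted k m ∘ (s ·_))) (trans (corners-% k _ refl) (corners-cong 1 (k ℕ.% 4) (cancel s)))) ⟩
  eval P (λ s → corners 1 (k ℕ.% 4) (λ c → indicator m (c · s))) ∎
  where
  P = (X +ₚ Y) ^ₚ n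
  w = weight 1 (δ k)
  cancel : ∀ s c → shifted k m (s · (c · w)) ≡ indicator m (c · s)
  cancel s c = trans (cong (shifted k m) (trans (trans (·-swap s c w) (sym (·-assoc c s w))) (·-comm (c · s) w)))
                     (indicator-cancel w (c · s) m)

odd-coeff-0 : ∀ k n m → k ℕ.% 4 ≡ 0 →
  up^ (n ℕ.* 2 ℕ.+ 1) (shifted k m ∘ weight 1) (δ k) ≡ coeff ((X +ₚ Y) ^ₚ n) m
odd-coeff-0 k n m e with odd-coeff k n m
... | h rewrite e = trans h (sym (coeff≡eval ((X +ₚ Y) ^ₚ n) m))

-- The boxes (1,2) and (2,1) that can be added to `δ 1` have weights y and x, both with sign +, so
-- one more factor x + y appears.
odd-coeff-1 : ∀ k n m → k ℕ.% 4 ≡ 1 →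
  up^ (n ℕ.* 2 ℕ.+ 1) (shifted k m ∘ weight 1) (δ k) ≡ coeff ((X +ₚ Y) ^ₚ suc n) m
odd-coeff-1 k n m e with odd-coeff k n m
... | h rewrite e = trans h (trans (eval-cong P λ s → lemma (indicator m (xMono · s)) (indicator m (yMono · s))) (sym rhs))
  where
  P = (X +ₚ Y) ^ₚ n
  lemma : ∀ u v → 1ℤ * v + u ≡ u + v
  lemma = solve-∀
  rhs : coeff ((X +ₚ Y) *ₚ P) m ≡ eval P (λ s → indicator m (xMono · s) + indicator m (yMono · s))
  rhs = begin
    coeff ((X +ₚ Y) *ₚ P) m
      ≡⟨ coeff≡eval ((X +ₚ Y) *ₚ P) m ⟩
    eval ((X +ₚ Y) *ₚ P) (indicator m)
      ≡⟨ eval-*ₚ (X +ₚ Y) P (indicator m) ⟩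
    eval (X +ₚ Y) (λ s → eval P (indicator m ∘ (s ·_)))
      ≡⟨ eval-X+Y (λ s → eval P (indicator m ∘ (s ·_))) ⟩
    eval P (indicator m ∘ (xMono ·_)) + eval P (indicator m ∘ (yMono ·_))
      ≡⟨ sym (eval-+ P _ _) ⟩
    eval P (λ s → indicator m (xMono · s) + indicator m (yMono · s)) ∎

-- For `δ 2` the boxes (1,3), (2,2) and (3,1) contribute -1, xyz and 1.
odd-coeff-2 : ∀ k n m → k ℕ.% 4 ≡ 2 →
  up^ (n ℕ.* 2 ℕ.+ 1) (shifted k m ∘ weight 1) (δ k) ≡ coeff (X *ₚ Y *ₚ Z *ₚ (X +ₚ Y) ^ₚ n) m
odd-coeff-2 k n m e with odd-coeff k n m
... | h rewrite e = trans h (trans (eval-cong P λ s →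
    lemma (indicator m s) (indicator m ((1 , 1 , 1) · s))) (sym rhs))
  where
  P = (X +ₚ Y) ^ₚ n
  lemma : ∀ u v → - 1ℤ * u + (1ℤ * v + u) ≡ v
  lemma = solve-∀
  rhs : coeff (X *ₚ Y *ₚ Z *ₚ P) m ≡ eval P (λ s → indicator m ((1 , 1 , 1) · s))
  rhs = begin
    coeff (X *ₚ Y *ₚ Z *ₚ P) m
      ≡⟨ coeff≡eval (X *ₚ Y *ₚ Z *ₚ P) m ⟩
    eval (X *ₚ Y *ₚ Z *ₚ P) (indicator m)
      ≡⟨ eval-*ₚ (X *ₚ Y *ₚ Z) P (indicator m) ⟩
    1ℤ * eval P (λ s → indicator m ((1 , 1 , 1) · s)) + 0ℤ
      ≡⟨ trans (ℤₚ.+-identityʳ _) (ℤₚ.*-identityˡ _) ⟩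
    eval P (λ s → indicator m ((1 , 1 , 1) · s)) ∎

-- For `δ 3` the boxes (1,4), (2,3), (3,2) and (4,1) contribute -y, -x, y and x.
odd-coeff-3 : ∀ k n m → k ℕ.% 4 ≡ 3 → up^ (n ℕ.* 2 ℕ.+ 1) (shifted k m ∘ weight 1) (δ k) ≡ 0ℤ
odd-coeff-3 k n m e with odd-coeff k n m
... | h rewrite e = trans h (trans (eval-cong P λ s →
    lemma (indicator m (yMono · s)) (indicator m (xMono · s))) (eval-0 P))
  where
  P = (X +ₚ Y) ^ₚ n
  lemma : ∀ u v → - 1ℤ * u + (- 1ℤ * v + (1ℤ * u + v)) ≡ 0ℤ
  lemma = solve-∀

-- Cells of a skew shape

∑ : {A : Set} → List A → (A → ℤ) → ℤ
∑ xs f = sumℤ (map f xs)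

module _ {A : Set} where

  ∑-cong : ∀ (xs : List A) {f g} → (∀ {x} → x ∈ xs → f x ≡ g x) → ∑ xs f ≡ ∑ xs g
  ∑-cong []       e = refl
  ∑-cong (x ∷ xs) e = cong₂ _+_ (e (here refl)) (∑-cong xs (e ∘ there))

  ∑-0 : ∀ (xs : List A) → ∑ xs (λ _ → 0ℤ) ≡ 0ℤ
  ∑-0 []       = refl
  ∑-0 (x ∷ xs) = trans (ℤₚ.+-identityˡ _) (∑-0 xs)

  ∑-* : ∀ (xs : List A) a f → ∑ xs (λ x → a * f x) ≡ a * ∑ xs f
  ∑-* []       a f = sym (ℤₚ.*-zeroʳ a)
  ∑-* (x ∷ xs) a f = trans (cong (a * f x +_) (∑-* xs a f)) (sym (ℤₚ.*-distribˡ-+ a (f x) (∑ xs f)))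

  ∑-when : ∀ (xs : List A) f c → ∑ xs (λ x → f x when c) ≡ (∑ xs f when c)
  ∑-when xs f true  = refl
  ∑-when xs f false = ∑-0 xs

  ∑-++ : ∀ (xs ys : List A) f → ∑ (xs ++ ys) f ≡ ∑ xs f + ∑ ys f
  ∑-++ []       ys f = sym (ℤₚ.+-identityˡ _)
  ∑-++ (x ∷ xs) ys f = trans (cong (f x +_) (∑-++ xs ys f)) (sym (ℤₚ.+-assoc (f x) (∑ xs f) (∑ ys f)))

  ∑-filterᵇ : ∀ p (xs : List A) f → ∑ (filterᵇ p xs) f ≡ ∑ xs (λ x → f x when p x)
  ∑-filterᵇ p []       f = refl
  ∑-filterᵇ p (x ∷ xs) f with p x
  ... | true  = cong (f x +_) (∑-filterᵇ p xs f)
  ... | false = trans (∑-filterᵇ p xs f) (sym (ℤₚ.+-identityˡ _))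

  ∑-map : ∀ {B : Set} (h : B → A) xs f → ∑ (map h xs) f ≡ ∑ xs (f ∘ h)
  ∑-map h []       f = refl
  ∑-map h (x ∷ xs) f = cong (f (h x) +_) (∑-map h xs f)

  ∑-concatMap : ∀ {B : Set} (h : B → List A) xs f → ∑ (concatMap h xs) f ≡ ∑ xs (λ x → ∑ (h x) f)
  ∑-concatMap h []       f = refl
  ∑-concatMap h (x ∷ xs) f = trans (∑-++ (h x) (concatMap h xs) f) (cong (∑ (h x) f +_) (∑-concatMap h xs f))

rowCells : ℕ → ℕ → ℕ → List Cell
rowCells r a zero    = []
rowCells r a (suc n) = (r , suc a) ∷ rowCells r (suc a) n

cells : ℕ → List ℕ → List ℕ → List Cell
cells r []       μ = []
cells r (x ∷ xs) μ = rowCells r (hd μ) (x ℕ.∸ hd μ) ++ cells (suc r) xs (tl μ)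

rowCells-fromTo : ∀ r a x → map (λ j → (r , j)) (fromTo (suc a) x) ≡ rowCells r a (x ℕ.∸ a)
rowCells-fromTo r a x = trans (sym (Listₚ.map-∘ (upTo (x ℕ.∸ a))))
  (trans (Listₚ.map-upTo (λ j → (r , suc a ℕ.+ j)) (x ℕ.∸ a)) (apply a (x ℕ.∸ a) _ λ j → refl))
  where
  apply : ∀ a n (f : ℕ → Cell) → (∀ j → f j ≡ (r , suc a ℕ.+ j)) → applyUpTo f n ≡ rowCells r a n
  apply a zero    f e = refl
  apply a (suc n) f e = cong₂ _∷_ (trans (e 0) (cong (r ,_) (ℕₚ.+-identityʳ (suc a))))
    (apply (suc a) n (f ∘ suc) λ j → trans (e (suc j)) (cong (r ,_) (ℕₚ.+-suc (suc a) j)))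

at-tl : ∀ l i → at (tl l) i ≡ at l (suc i)
at-tl []      i = refl
at-tl (_ ∷ _) i = refl

skewCells≡cells : ∀ l μ → skewCells l μ ≡ cells 1 l μ
skewCells≡cells l μ = begin
  concatMap rowOf (map suc (upTo (length l)))   ≡⟨ cong (concatMap rowOf) (Listₚ.map-upTo suc (length l)) ⟩
  concatMap rowOf (applyUpTo suc (length l))    ≡⟨ go 1 l μ rowOf suc (λ i → refl)
    (λ i → rowCells-fromTo (suc i) (at μ i) (at l i)) ⟩
  cells 1 l μ ∎
  where
  rowOf : ℕ → List Cell
  rowOf i = map (λ j → (i , j)) (fromTo (suc (part μ i)) (part l i))
  go : ∀ r l μ (f : ℕ → List Cell) (h : ℕ → ℕ) → (∀ i → h i ≡ r ℕ.+ i) →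
    (∀ i → f (r ℕ.+ i) ≡ rowCells (r ℕ.+ i) (at μ i) (at l i ℕ.∸ at μ i)) →
    concatMap f (applyUpTo h (length l)) ≡ cells r l μ
  go r []       μ f h eh ef = refl
  go r (x ∷ xs) μ f h eh ef = cong₂ _++_
    (trans (cong f (eh 0)) (trans (ef 0) (cong (λ i → rowCells i (hd μ) (x ℕ.∸ hd μ)) (ℕₚ.+-identityʳ r))))
    (go (suc r) xs (tl μ) f (h ∘ suc) (λ i → trans (eh (suc i)) (ℕₚ.+-suc r i)) λ i →
      trans (cong f (sym (ℕₚ.+-suc r i))) (trans (ef (suc i))
        (cong₂ (λ j y → rowCells j y (at xs i ℕ.∸ y)) (ℕₚ.+-suc r i) (sym (at-tl μ i)))))

infix 4 _⊑_ _⊑ᵇ_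

-- The list `μ` may be the longer one as long as its surplus parts are zero, hence the condition on
-- the sum.
data _⊑_ : List ℕ → List ℕ → Set where
  []  : ∀ {μ} → sum μ ≡ 0 → μ ⊑ []
  _∷_ : ∀ {μ x xs} → hd μ ≤ x → tl μ ⊑ xs → μ ⊑ x ∷ xs

_⊑ᵇ_ : List ℕ → List ℕ → Bool
μ ⊑ᵇ []       = sum μ ≡ᵇ 0
μ ⊑ᵇ (x ∷ xs) = (hd μ ≤ᵇ x) ∧ (tl μ ⊑ᵇ xs)

weightCells : List Cell → Mono
weightCells []             = 0 , 0 , 0
weightCells ((i , j) ∷ cs) = cellWeight i j · weightCells cs

weightCells-++ : ∀ cs ds → weightCells (cs ++ ds) ≡ weightCells cs · weightCells ds
weightCells-++ []             ds = refl
weightCells-++ ((i , j) ∷ cs) ds = trans (cong (cellWeight i j ·_) (weightCells-++ cs ds))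
                                         (sym (·-assoc (cellWeight i j) (weightCells cs) (weightCells ds)))

rowWeight-+ : ∀ r a n → rowWeight r (a ℕ.+ n) ≡ rowWeight r a · weightCells (rowCells r a n)
rowWeight-+ r a zero    = trans (cong (rowWeight r) (ℕₚ.+-identityʳ a)) (·-comm (0 , 0 , 0) (rowWeight r a))
rowWeight-+ r a (suc n) = trans (cong (rowWeight r) (ℕₚ.+-suc a n))
  (trans (rowWeight-+ r (suc a) n) (·-assoc (rowWeight r a) (cellWeight r (suc a)) _))

weight-zero : ∀ r μ → sum μ ≡ 0 → weight r μ ≡ (0 , 0 , 0)
weight-zero r []         e = refl
weight-zero r (zero ∷ μ) e = weight-zero (suc r) μ e

weight-hd-tl : ∀ r μ → weight r μ ≡ rowWeight r (hd μ) · weight (suc r) (tl μ)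
weight-hd-tl r []      = refl
weight-hd-tl r (_ ∷ _) = refl

weight-skew : ∀ r {l μ} → μ ⊑ l → weight r l ≡ weight r μ · weightCells (cells r l μ)
weight-skew r {μ = μ} ([] e) rewrite weight-zero r μ e = refl
weight-skew r {x ∷ xs} {μ} (p ∷ q) = begin
  rowWeight r x · weight (suc r) xs
    ≡⟨ cong₂ _·_ (trans (cong (rowWeight r) (sym (ℕₚ.m+[n∸m]≡n p))) (rowWeight-+ r (hd μ) (x ℕ.∸ hd μ))) (weight-skew (suc r) q) ⟩
  (ρ · ρ′) · (w · w′)   ≡⟨ ·-assoc ρ ρ′ (w · w′) ⟩
  ρ · (ρ′ · (w · w′))   ≡⟨ cong (ρ ·_) (·-swap ρ′ w w′) ⟩
  ρ · (w · (ρ′ · w′))   ≡⟨ sym (·-assoc ρ w (ρ′ · w′)) ⟩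
  (ρ · w) · (ρ′ · w′)   ≡⟨ cong₂ _·_ (sym (weight-hd-tl r μ)) (sym (weightCells-++ (rowCells r (hd μ) (x ℕ.∸ hd μ)) _)) ⟩
  weight r μ · weightCells (cells r (x ∷ xs) μ) ∎
  where
  ρ = rowWeight r (hd μ)
  ρ′ = weightCells (rowCells r (hd μ) (x ℕ.∸ hd μ))
  w = weight (suc r) (tl μ)
  w′ = weightCells (cells (suc r) xs (tl μ))

weightCells-count : ∀ cs → weightCells cs ≡
  (count (λ c → isEven (row c)) cs , count (λ c → isEven (col c)) cs , count (λ c → isEven (row c) ∧ isEven (col c)) cs)
weightCells-count []             = refl
weightCells-count ((i , j) ∷ cs) rewrite weightCells-count cs with isEven i | isEven j
... | false | false = refl
... | false | true  = refl
... | true  | false = refl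
... | true  | true  = refl

weight-stats : ∀ {l μ} → μ ⊑ l → weight 1 l ≡ weight 1 μ · (vStat l μ , hStat l μ , dStat l μ)
weight-stats {l} {μ} p = trans (weight-skew 1 p) (cong (weight 1 μ ·_)
  (trans (weightCells-count (cells 1 l μ)) (cong (λ cs →
    (count (λ c → isEven (row c)) cs , count (λ c → isEven (col c)) cs , count (λ c → isEven (row c) ∧ isEven (col c)) cs))
    (sym (skewCells≡cells l μ)))))

-- Chains of partitions

infix 4 _≈ᵇ_

-- Equality of diagrams. It has to ignore trailing zeros because `shapesOver` pads all shapes to one
-- length, while `add` creates a row only when a box is put there.
_≈ᵇ_ : List ℕ → List ℕ → Bool
[]       ≈ᵇ []       = true
[]       ≈ᵇ (y ∷ ys) = (0 ≡ᵇ y) ∧ ([] ≈ᵇ ys)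
(x ∷ xs) ≈ᵇ []       = (x ≡ᵇ 0) ∧ (xs ≈ᵇ [])
(x ∷ xs) ≈ᵇ (y ∷ ys) = (x ≡ᵇ y) ∧ (xs ≈ᵇ ys)

∧-split : ∀ {b c} → b ∧ c ≡ true → b ≡ true × c ≡ true
∧-split {true} {true} _ = refl , refl

∧-join : ∀ {b c} → b ≡ true → c ≡ true → b ∧ c ≡ true
∧-join refl refl = refl

≈ᵇ⇒hd : ∀ xs ys → (xs ≈ᵇ ys) ≡ true → hd xs ≡ hd ys
≈ᵇ⇒hd []       []       e = refl
≈ᵇ⇒hd []       (y ∷ ys) e = ≡ᵇ⇒≡ 0 y (proj₁ (∧-split e))
≈ᵇ⇒hd (x ∷ xs) []       e = ≡ᵇ⇒≡ x 0 (proj₁ (∧-split e))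
≈ᵇ⇒hd (x ∷ xs) (y ∷ ys) e = ≡ᵇ⇒≡ x y (proj₁ (∧-split e))

≈ᵇ⇒sum : ∀ xs ys → (xs ≈ᵇ ys) ≡ true → sum xs ≡ sum ys
≈ᵇ⇒sum []       []       e = refl
≈ᵇ⇒sum []       (y ∷ ys) e = cong₂ ℕ._+_ (≡ᵇ⇒≡ 0 y (proj₁ (∧-split e))) (≈ᵇ⇒sum [] ys (proj₂ (∧-split e)))
≈ᵇ⇒sum (x ∷ xs) []       e =
  cong₂ ℕ._+_ (≡ᵇ⇒≡ x 0 (proj₁ (∧-split e))) (≈ᵇ⇒sum xs [] (proj₂ (∧-split {x ≡ᵇ 0} e)))
≈ᵇ⇒sum (x ∷ xs) (y ∷ ys) e =
  cong₂ ℕ._+_ (≡ᵇ⇒≡ x y (proj₁ (∧-split e))) (≈ᵇ⇒sum xs ys (proj₂ (∧-split {x ≡ᵇ y} e)))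

when-cong : ∀ {u v} c → (c ≡ true → u ≡ v) → (u when c) ≡ (v when c)
when-cong true  e = e refl
when-cong false e = refl

remove-zeros : ∀ {ε g l} → Partition (just 0) l → remove ε g l ≡ 0ℤ
remove-zeros [] = refl
remove-zeros {ε} (z≤n ∷ q) = trans (ℤₚ.+-identityˡ _) (trans (cong (ε *_) (remove-zeros q)) (ℤₚ.*-zeroʳ ε))

add-when-∧ : ∀ b c (d : List ℕ → Bool) l →
  add b (λ m → 1ℤ when c ∧ d m) l ≡ (add b (λ m → 1ℤ when d m) l when c)
add-when-∧ b true  d l = refl
add-when-∧ b false d l = add-0 b l

remove-when-∧ : ∀ ε c (d : List ℕ → Bool) l →
  remove ε (λ m → 1ℤ when c ∧ d m) l ≡ (remove ε (λ m → 1ℤ when d m) l when c)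
remove-when-∧ ε true  d l = refl
remove-when-∧ ε false d l = remove-0 ε l

removeBoxes : (List ℕ → ℤ) → List ℕ → ℤ
removeBoxes = remove 1ℤ

signed-zero : ∀ s c d → c ≡ false → (s * (1ℤ when c) when d) ≡ 0ℤ
signed-zero s c d refl = trans (cong (_when d) (ℤₚ.*-zeroʳ s)) (when-0 d)

-- Both sides are the entry of U between `xs` and `ys`: zero unless `ys` is `xs` with one more box,
-- and otherwise the sign of that box. The sign can be read off from either diagram, since they
-- agree below the box.
add-remove-adjoint : ∀ {b} xs ys → Partition b xs → Partition b ys →
  add b (λ m → 1ℤ when m ≈ᵇ ys) xs ≡ removeBoxes (λ m → 1ℤ when xs ≈ᵇ m) ys
add-remove-adjoint {b} [] [] p q = when-0 (0 <ᴮ b)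
add-remove-adjoint {b} [] (zero ∷ ys) p (_ ∷ q) =
  trans (when-0 (0 <ᴮ b)) (sym (trans (ℤₚ.+-identityˡ _) (trans (ℤₚ.*-identityˡ _) (remove-zeros q))))
add-remove-adjoint {b} [] (suc zero ∷ ys) p (q ∷ _) = sym (trans
  (cong₂ _+_ (trans (when-cong (hd ys <ᵇ 1) λ _ → refl) first) (trans (ℤₚ.*-identityˡ _) (remove-0 1ℤ ys))) (ℤₚ.+-identityʳ _))
  where
  first : (signPow (sum ys) * (1ℤ when [] ≈ᵇ ys) when hd ys <ᵇ 1) ≡ ((1ℤ when [] ≈ᵇ ys) when 0 <ᴮ b)
  first with [] ≈ᵇ ys in e
  ... | false = trans (signed-zero (signPow (sum ys)) false (hd ys <ᵇ 1) refl) (sym (when-0 (0 <ᴮ b)))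
  ... | true rewrite sym (≈ᵇ⇒sum [] ys e) | sym (≈ᵇ⇒hd [] ys e) | ≤ᴮ⇒<ᴮ b q = refl
add-remove-adjoint {b} [] (suc (suc y) ∷ ys) p q = trans (when-0 (0 <ᴮ b)) (sym (trans
  (cong₂ _+_ (signed-zero (signPow (sum ys)) false (hd ys <ᵇ suc (suc y)) refl)
             (trans (ℤₚ.*-identityˡ _) (remove-0 1ℤ ys))) (ℤₚ.+-identityʳ 0ℤ)))
add-remove-adjoint {b} (x ∷ xs) [] (p ∷ q) _ = cong₂ _+_
  (signed-zero (signPow (sum xs)) false (x <ᴮ b) refl)
  (trans (add-when-∧ (just x) (x ≡ᵇ 0) (_≈ᵇ []) xs)
    (trans (cong (_when x ≡ᵇ 0) (add-remove-adjoint xs [] q [])) (when-0 (x ≡ᵇ 0))))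
add-remove-adjoint {b} (x ∷ xs) (y ∷ ys) (p ∷ q) (p′ ∷ q′) = cong₂ _+_ (first y p′) (begin
  add (just x) (λ m → 1ℤ when (x ≡ᵇ y) ∧ (m ≈ᵇ ys)) xs
    ≡⟨ add-when-∧ (just x) (x ≡ᵇ y) (_≈ᵇ ys) xs ⟩
  (add (just x) (λ m → 1ℤ when m ≈ᵇ ys) xs when x ≡ᵇ y)
    ≡⟨ when-cong (x ≡ᵇ y) rest ⟩
  (removeBoxes (λ m → 1ℤ when xs ≈ᵇ m) ys when x ≡ᵇ y)
    ≡⟨ sym (remove-when-∧ 1ℤ (x ≡ᵇ y) (xs ≈ᵇ_) ys) ⟩
  removeBoxes (λ m → 1ℤ when (x ≡ᵇ y) ∧ (xs ≈ᵇ m)) ys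
    ≡⟨ sym (ℤₚ.*-identityˡ _) ⟩
  1ℤ * removeBoxes (λ m → 1ℤ when (x ≡ᵇ y) ∧ (xs ≈ᵇ m)) ys ∎)
  where
  rest : (x ≡ᵇ y) ≡ true →
    add (just x) (λ m → 1ℤ when m ≈ᵇ ys) xs ≡ removeBoxes (λ m → 1ℤ when xs ≈ᵇ m) ys
  rest e with refl ← ≡ᵇ⇒≡ x y e = add-remove-adjoint xs ys q q′

  first : ∀ y → y ≤ᴮ b → (signPow (sum xs) * (1ℤ when (suc x ≡ᵇ y) ∧ (xs ≈ᵇ ys)) when x <ᴮ b)
    ≡ (signPow (sum ys) * (1ℤ when (x ≡ᵇ pred y) ∧ (xs ≈ᵇ ys)) when hd ys <ᵇ y)
  first zero    _ = signed-zero (signPow (sum xs)) false (x <ᴮ b) refl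
  first (suc y) r with (x ≡ᵇ y) ∧ (xs ≈ᵇ ys) in e
  ... | false = trans (signed-zero (signPow (sum xs)) false (x <ᴮ b) refl)
                      (sym (signed-zero (signPow (sum ys)) false (hd ys <ᵇ suc y) refl))
  ... | true with ∧-split {x ≡ᵇ y} e
  ...   | e₁ , e₂ with refl ← ≡ᵇ⇒≡ x y e₁
    rewrite ≈ᵇ⇒sum xs ys e₂ | sym (≈ᵇ⇒hd xs ys e₂) | ≤ᴮ⇒<ᴮ b r | ≤ᴮ⇒<ᴮ (just (suc x)) (s≤s (hd≤ q)) = refl

-- The coefficient of `l` in U^n α, computed downwards from `l`. This direction matches the
-- recursion for tableaux, where the largest label is removed.
chains : List ℕ → ℕ → List ℕ → ℤ
chains α zero    l = 1ℤ when α ≈ᵇ l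
chains α (suc n) l = removeBoxes (chains α n) l

up^-0 : ∀ n l → up^ n (λ _ → 0ℤ) l ≡ 0ℤ
up^-0 zero    l = refl
up^-0 (suc n) l = trans (add-cong l λ {m} _ → up^-0 n m) (add-0 nothing l)

up^-when : ∀ n g c l → up^ n (λ m → g m when c) l ≡ (up^ n g l when c)
up^-when n g true  l = refl
up^-when n g false l = up^-0 n l

up^-∑ : ∀ {A : Set} n (xs : List A) (g : A → List ℕ → ℤ) l →
  up^ n (λ m → ∑ xs (λ x → g x m)) l ≡ ∑ xs (λ x → up^ n (g x) l)
up^-∑ n []       g l = up^-0 n l
up^-∑ n (x ∷ xs) g l = trans (up^-+ n (g x) _ l) (cong (up^ n (g x) l +_) (up^-∑ n xs g l))

-- The two operators act on different arguments of `h`, so they commute by linearity.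
up^-remove : ∀ n ε (h : List ℕ → List ℕ → ℤ) α l →
  up^ n (λ m → remove ε (λ k → h k m) l) α ≡ remove ε (λ k → up^ n (h k) α) l
up^-remove n ε h α []       = up^-0 n α
up^-remove n ε h α (x ∷ xs) = trans (up^-+ n _ _ α) (cong₂ _+_
  (trans (up^-when n _ (hd xs <ᵇ x) α) (cong (_when hd xs <ᵇ x) (up^-* n (signPow (sum xs)) (h (pred x ∷ xs)) α)))
  (trans (up^-* n ε _ α) (cong (ε *_) (up^-remove n ε (h ∘ (x ∷_)) α xs))))

up^-delta : ∀ n {α l} → Partition nothing α → Partition nothing l →
  up^ n (λ m → 1ℤ when m ≈ᵇ l) α ≡ chains α n l
up^-delta zero    p q = refl
up^-delta (suc n) {α} {l} p q = begin
  up^ (suc n) (λ m → 1ℤ when m ≈ᵇ l) α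
    ≡⟨ up^-suc n _ α ⟩
  up^ n (up (λ m → 1ℤ when m ≈ᵇ l)) α
    ≡⟨ up^-cong n p (λ {m} r → add-remove-adjoint m l r q) ⟩
  up^ n (λ m → removeBoxes (λ k → 1ℤ when m ≈ᵇ k) l) α
    ≡⟨ up^-remove n 1ℤ (λ k m → 1ℤ when m ≈ᵇ k) α l ⟩
  removeBoxes (λ k → up^ n (λ m → 1ℤ when m ≈ᵇ k) α) l
    ≡⟨ remove-cong l (λ c → up^-delta n p (RemoveBox-Partition q c)) ⟩
  removeBoxes (chains α n) l ∎

-- Reachability. The sum over all listed shapes can be evaluated only where size and length are
-- under control, and this supplies both.
data AddBoxes : ℕ → List ℕ → List ℕ → Set where
  done : ∀ {l} → AddBoxes 0 l l
  step : ∀ {n l m k} → AddBox nothing l m → AddBoxes n m k → AddBoxes (suc n) l k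

up^-cong-AddBoxes : ∀ n {g h l} → (∀ {m} → AddBoxes n l m → g m ≡ h m) → up^ n g l ≡ up^ n h l
up^-cong-AddBoxes zero    e = e done
up^-cong-AddBoxes (suc n) {l = l} e = add-cong l (λ c → up^-cong-AddBoxes n (e ∘ step c))

AddBoxes-Partition : ∀ {n l m} → Partition nothing l → AddBoxes n l m → Partition nothing m
AddBoxes-Partition p done       = p
AddBoxes-Partition p (step c r) = AddBoxes-Partition (AddBox-Partition p c) r

AddBoxes-sum : ∀ {n l m} → AddBoxes n l m → sum m ≡ sum l ℕ.+ n
AddBoxes-sum done = sym (ℕₚ.+-identityʳ _)
AddBoxes-sum {suc n} {l} (step c r) =
  trans (AddBoxes-sum r) (trans (cong (ℕ._+ n) (AddBox-sum c)) (sym (ℕₚ.+-suc (sum l) n)))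

AddBox-length : ∀ {b l m} → AddBox b l m → length m ≤ suc (length l)
AddBox-length (new _)   = ℕₚ.≤-refl
AddBox-length (here _)  = ℕₚ.n≤1+n _
AddBox-length (there c) = s≤s (AddBox-length c)

AddBoxes-length : ∀ {n l m} → AddBoxes n l m → length m ≤ length l ℕ.+ n
AddBoxes-length done = ℕₚ.≤-reflexive (sym (ℕₚ.+-identityʳ _))
AddBoxes-length {suc n} {l} (step c r) = ℕₚ.≤-trans (AddBoxes-length r)
  (ℕₚ.≤-trans (ℕₚ.+-monoˡ-≤ n (AddBox-length c)) (ℕₚ.≤-reflexive (sym (ℕₚ.+-suc (length l) n))))

hd≡0 : ∀ l → sum l ≡ 0 → hd l ≡ 0
hd≡0 []         e = refl
hd≡0 (zero ∷ l) e = refl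

sum-tl≡0 : ∀ l → sum l ≡ 0 → sum (tl l) ≡ 0
sum-tl≡0 []         e = refl
sum-tl≡0 (zero ∷ l) e = e

⊑-refl : ∀ l → l ⊑ l
⊑-refl []      = [] refl
⊑-refl (x ∷ l) = ℕₚ.≤-refl ∷ ⊑-refl l

⊑-AddBox : ∀ {μ b l m} → μ ⊑ l → AddBox b l m → μ ⊑ m
⊑-AddBox {μ} ([] e) (new _)   = subst (_≤ 1) (sym (hd≡0 μ e)) z≤n ∷ [] (sum-tl≡0 μ e)
⊑-AddBox (p ∷ q)    (here _)  = ℕₚ.m≤n⇒m≤1+n p ∷ q
⊑-AddBox (p ∷ q)    (there c) = p ∷ ⊑-AddBox q c

⊑-AddBoxes : ∀ {μ n l m} → μ ⊑ l → AddBoxes n l m → μ ⊑ m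
⊑-AddBoxes p done       = p
⊑-AddBoxes p (step c r) = ⊑-AddBoxes (⊑-AddBox p c) r

pad : ℕ → List ℕ → List ℕ
pad zero    l = []
pad (suc n) l = hd l ∷ pad n (tl l)

length-tl : ∀ {n} l → length l ≤ suc n → length (tl l) ≤ n
length-tl []      p       = z≤n
length-tl (_ ∷ l) (s≤s p) = p

sum-pad : ∀ n l → length l ≤ n → sum (pad n l) ≡ sum l
sum-pad zero    []      p = refl
sum-pad (suc n) l       p = trans (cong (hd l ℕ.+_) (sum-pad n (tl l) (length-tl l p))) (sym (sum≡ l))

weight-pad : ∀ r n l → length l ≤ n → weight r (pad n l) ≡ weight r l
weight-pad r zero    [] p = refl
weight-pad r (suc n) l  p =
  trans (cong (rowWeight r (hd l) ·_) (weight-pad (suc r) n (tl l) (length-tl l p))) (sym (weight-hd-tl r l))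

⊑-pad : ∀ {μ} n l → length l ≤ n → μ ⊑ l → μ ⊑ pad n l
⊑-pad zero    []      p q = q
⊑-pad {μ} (suc n) []  p ([] e) = subst (_≤ 0) (sym (hd≡0 μ e)) z≤n ∷ ⊑-pad n [] z≤n ([] (sum-tl≡0 μ e))
⊑-pad (suc n) (x ∷ l) (s≤s p) (q ∷ r) = q ∷ ⊑-pad n l p r

Partition-pad : ∀ {b} n l → Partition b l → Partition b (pad n l)
Partition-pad zero    l       p       = []
Partition-pad {b} (suc n) []  p       = 0≤ b ∷ Partition-pad n [] []
  where
  0≤ : ∀ b → 0 ≤ᴮ b
  0≤ nothing  = tt
  0≤ (just b) = z≤n
Partition-pad (suc n) (x ∷ l) (p ∷ q) = p ∷ Partition-pad n l q

∑-upTo-point : ∀ M y (k : ℕ → ℤ) → y < M → ∑ (upTo M) (λ x → k x when y ≡ᵇ x) ≡ k y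
∑-upTo-point (suc M) zero k _ = trans (cong (k 0 +_) (trans (cong (λ xs → ∑ xs _) (sym (Listₚ.map-upTo suc M)))
  (trans (∑-map suc (upTo M) _) (∑-0 (upTo M))))) (ℤₚ.+-identityʳ (k 0))
∑-upTo-point (suc M) (suc y) k (s≤s p) = trans (ℤₚ.+-identityˡ _)
  (trans (cong (λ xs → ∑ xs (λ x → k x when suc y ≡ᵇ x)) (sym (Listₚ.map-upTo suc M)))
    (trans (∑-map suc (upTo M) _) (∑-upTo-point M y (k ∘ suc) p)))

≈ᵇ-∷ : ∀ l x xs → (l ≈ᵇ x ∷ xs) ≡ (hd l ≡ᵇ x) ∧ (tl l ≈ᵇ xs)
≈ᵇ-∷ []      x xs = refl
≈ᵇ-∷ (_ ∷ _) x xs = refl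

-- Among the lists of length `n` exactly one represents the diagram of `m`, namely its padding. The
-- bound on the sum keeps every part in the range of entries.
∑-lists-point : ∀ n N m (h : List ℕ → ℤ) → length m ≤ n → sum m ≤ N →
  ∑ (lists n (fromTo 0 N)) (λ l → h l when m ≈ᵇ l) ≡ h (pad n m)
∑-lists-point zero    N []  h p q = ℤₚ.+-identityʳ _
∑-lists-point (suc n) N m h p q = begin
  ∑ (concatMap (λ x → map (x ∷_) L) R) (λ l → h l when m ≈ᵇ l)
    ≡⟨ ∑-concatMap (λ x → map (x ∷_) L) R _ ⟩
  ∑ R (λ x → ∑ (map (x ∷_) L) (λ l → h l when m ≈ᵇ l))
    ≡⟨ ∑-cong R (λ {x} _ → inner x) ⟩
  ∑ R (λ x → h (x ∷ pad n (tl m)) when hd m ≡ᵇ x)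
    ≡⟨ ∑-map id (upTo (suc N)) (λ x → h (x ∷ pad n (tl m)) when hd m ≡ᵇ x) ⟩
  ∑ (upTo (suc N)) (λ x → h (x ∷ pad n (tl m)) when hd m ≡ᵇ x)
    ≡⟨ ∑-upTo-point (suc N) (hd m) (λ x → h (x ∷ pad n (tl m))) (s≤s (ℕₚ.≤-trans (hd≤sum m) q)) ⟩
  h (hd m ∷ pad n (tl m)) ∎
  where
  R = fromTo 0 N
  L = lists n R
  hd≤sum : ∀ m → hd m ≤ sum m
  hd≤sum m = ℕₚ.≤-trans (ℕₚ.m≤m+n (hd m) (sum (tl m))) (ℕₚ.≤-reflexive (sym (sum≡ m)))
  sum-tl≤ : ∀ m → sum (tl m) ≤ sum m
  sum-tl≤ m = ℕₚ.≤-trans (ℕₚ.m≤n+m (sum (tl m)) (hd m)) (ℕₚ.≤-reflexive (sym (sum≡ m)))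
  inner : ∀ x → ∑ (map (x ∷_) L) (λ l → h l when m ≈ᵇ l) ≡ (h (x ∷ pad n (tl m)) when hd m ≡ᵇ x)
  inner x = begin
    ∑ (map (x ∷_) L) (λ l → h l when m ≈ᵇ l)
      ≡⟨ ∑-map (x ∷_) L _ ⟩
    ∑ L (λ l → h (x ∷ l) when m ≈ᵇ x ∷ l)
      ≡⟨ ∑-cong L (λ {l} _ → trans (cong (h (x ∷ l) when_) (≈ᵇ-∷ m x l)) (when-∧ (h (x ∷ l)) (hd m ≡ᵇ x) (tl m ≈ᵇ l))) ⟩
    ∑ L (λ l → (h (x ∷ l) when tl m ≈ᵇ l) when hd m ≡ᵇ x)
      ≡⟨ ∑-when L _ (hd m ≡ᵇ x) ⟩
    (∑ L (λ l → h (x ∷ l) when tl m ≈ᵇ l) when hd m ≡ᵇ x)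
      ≡⟨ cong (_when hd m ≡ᵇ x) (∑-lists-point n N (tl m) (h ∘ (x ∷_)) (length-tl m p) (ℕₚ.≤-trans (sum-tl≤ m) q)) ⟩
    (h (x ∷ pad n (tl m)) when hd m ≡ᵇ x) ∎

≤ᵇ-true : ∀ {m n} → m ≤ n → (m ≤ᵇ n) ≡ true
≤ᵇ-true p = Equivalence.to T-≡ (ℕₚ.≤⇒≤ᵇ p)

true-≤ : ∀ {m n} → (m ≤ᵇ n) ≡ true → m ≤ n
true-≤ {m} {n} e = ℕₚ.≤ᵇ⇒≤ m n (Equivalence.from T-≡ e)

Partition⇒decreasing : ∀ {b} l → Partition b l → weaklyDecreasing l ≡ true
Partition⇒decreasing []          p           = refl
Partition⇒decreasing (x ∷ [])    p           = refl
Partition⇒decreasing (x ∷ y ∷ l) (p ∷ q ∷ r) = ∧-join (≤ᵇ-true q) (Partition⇒decreasing (y ∷ l) (q ∷ r))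

decreasing⇒Partition : ∀ {b} l → hd l ≤ᴮ b → weaklyDecreasing l ≡ true → Partition b l
decreasing⇒Partition []          p e = []
decreasing⇒Partition (x ∷ [])    p e = p ∷ []
decreasing⇒Partition (x ∷ y ∷ l) p e =
  p ∷ decreasing⇒Partition (y ∷ l) (true-≤ (proj₁ (∧-split e))) (proj₂ (∧-split {y ≤ᵇ x} e))

contained-∷ : ∀ a μ l → contained (a ∷ μ) l ≡ (a ≤ᵇ hd l) ∧ contained μ (tl l)
contained-∷ a μ l = cong ((a ≤ᵇ hd l) ∧_) (begin
  allᵇ f (map suc (applyUpTo suc (length μ)))         ≡⟨ cong (allᵇ f) (Listₚ.map-applyUpTo suc suc (length μ)) ⟩
  allᵇ f (applyUpTo (suc ∘ suc) (length μ))           ≡⟨ all-applyUpTo (suc ∘ suc) suc (length μ) (λ i → cong (at μ i ≤ᵇ_) (sym (at-tl l i))) ⟩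
  allᵇ g (applyUpTo suc (length μ))                   ≡⟨ cong (allᵇ g) (sym (Listₚ.map-upTo suc (length μ))) ⟩
  contained μ (tl l) ∎)
  where
  f g : ℕ → Bool
  f i = part (a ∷ μ) i ≤ᵇ part l i
  g i = part μ i ≤ᵇ part (tl l) i
  all-applyUpTo : ∀ (h h′ : ℕ → ℕ) n → (∀ i → f (h i) ≡ g (h′ i)) →
    allᵇ f (applyUpTo h n) ≡ allᵇ g (applyUpTo h′ n)
  all-applyUpTo h h′ zero    e = refl
  all-applyUpTo h h′ (suc n) e = cong₂ _∧_ (e 0) (all-applyUpTo (h ∘ suc) (h′ ∘ suc) n (e ∘ suc))

⊑⇒contained : ∀ μ l → μ ⊑ l → contained μ l ≡ true
⊑⇒contained []      l p = refl
⊑⇒contained (a ∷ μ) [] ([] e) =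
  trans (contained-∷ a μ []) (∧-join (≤ᵇ-true (ℕₚ.≤-reflexive (hd≡0 (a ∷ μ) e))) (⊑⇒contained μ [] ([] (sum-tl≡0 (a ∷ μ) e))))
⊑⇒contained (a ∷ μ) (x ∷ l) (p ∷ q) = trans (contained-∷ a μ (x ∷ l)) (∧-join (≤ᵇ-true p) (⊑⇒contained μ l q))

[]⊑ : ∀ l → [] ⊑ l
[]⊑ []      = [] refl
[]⊑ (x ∷ l) = z≤n ∷ []⊑ l

contained⇒⊑ : ∀ μ l → contained μ l ≡ true → μ ⊑ l
contained⇒⊑ []      l e = []⊑ l
contained⇒⊑ (a ∷ μ) l e with ∧-split {a ≤ᵇ hd l} (trans (sym (contained-∷ a μ l)) e)
contained⇒⊑ (a ∷ μ) []      e | e₁ , e₂ with contained⇒⊑ μ [] e₂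
... | [] s = [] (trans (cong₂ ℕ._+_ (ℕₚ.n≤0⇒n≡0 (true-≤ e₁)) s) refl)
contained⇒⊑ (a ∷ μ) (x ∷ l) e | e₁ , e₂ = true-≤ e₁ ∷ contained⇒⊑ μ l e₂

lists-length : ∀ n xs {l} → l ∈ lists n xs → length l ≡ n
lists-length zero    xs (here refl) = refl
lists-length (suc n) xs p with satisfied (∈-concatMap⁻ (λ x → map (x ∷_) (lists n xs)) {xs = xs} p)
... | x , q with ∈-map⁻ (x ∷_) q
...   | l , r , refl = cong suc (lists-length n xs r)

-- Signed count of standard labellings

module _ {A : Set} where

  -- The number passed to `f` counts the elements after the chosen one: the inversions caused by the
  -- largest label in that place.
  ∑splits : List A → (A → List A → ℕ → ℤ) → ℤ
  ∑splits []       f = 0ℤ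
  ∑splits (c ∷ cs) f = f c cs (length cs) + ∑splits cs (λ d ds → f d (c ∷ ds))

  ∑splits-cong : ∀ cs {f g : A → List A → ℕ → ℤ} →
    (∀ as c bs → cs ≡ as ++ c ∷ bs → f c (as ++ bs) (length bs) ≡ g c (as ++ bs) (length bs)) →
    ∑splits cs f ≡ ∑splits cs g
  ∑splits-cong []       e = refl
  ∑splits-cong (c ∷ cs) e = cong₂ _+_ (e [] c cs refl)
    (∑splits-cong cs λ as d bs p → e (c ∷ as) d bs (cong (c ∷_) p))

  ∑splits-++ : ∀ as bs (f : A → List A → ℕ → ℤ) → ∑splits (as ++ bs) f
    ≡ ∑splits as (λ d ds k → f d (ds ++ bs) (k ℕ.+ length bs)) + ∑splits bs (λ d ds → f d (as ++ ds))
  ∑splits-++ []       bs f = sym (ℤₚ.+-identityˡ _)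
  ∑splits-++ (a ∷ as) bs f = trans
    (cong₂ _+_ (cong (f a (as ++ bs)) (Listₚ.length-++ as)) (∑splits-++ as bs (λ d ds → f d (a ∷ ds))))
    (sym (ℤₚ.+-assoc (f a (as ++ bs) _) _ _))

  ∑splits-0 : ∀ (cs : List A) → ∑splits cs (λ _ _ _ → 0ℤ) ≡ 0ℤ
  ∑splits-0 []       = refl
  ∑splits-0 (c ∷ cs) = trans (ℤₚ.+-identityˡ _) (∑splits-0 cs)

  ∑splits-+ : ∀ cs (f g : A → List A → ℕ → ℤ) →
    ∑splits cs (λ c ds k → f c ds k + g c ds k) ≡ ∑splits cs f + ∑splits cs g
  ∑splits-+ []       f g = refl
  ∑splits-+ (c ∷ cs) f g = trans (cong (f c cs (length cs) + g c cs (length cs) +_) (∑splits-+ cs _ _))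
    (lemma (f c cs (length cs)) (g c cs (length cs)) _ _)
    where lemma : ∀ a b c d → a + b + (c + d) ≡ (a + c) + (b + d)
          lemma = solve-∀

  ∑splits-* : ∀ a cs (f : A → List A → ℕ → ℤ) → ∑splits cs (λ c ds k → a * f c ds k) ≡ a * ∑splits cs f
  ∑splits-* a []       f = sym (ℤₚ.*-zeroʳ a)
  ∑splits-* a (c ∷ cs) f = trans (cong (a * f c cs (length cs) +_) (∑splits-* a cs _))
    (sym (ℤₚ.*-distribˡ-+ a (f c cs (length cs)) _))

  ∑splits-∑ : ∀ {B : Set} (xs : List B) cs (f : B → A → List A → ℕ → ℤ) →
    ∑ xs (λ x → ∑splits cs (f x)) ≡ ∑splits cs (λ c ds k → ∑ xs (λ x → f x c ds k))
  ∑splits-∑ []       cs f = sym (∑splits-0 cs)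
  ∑splits-∑ (x ∷ xs) cs f = trans (cong (∑splits cs (f x) +_) (∑splits-∑ xs cs f)) (sym (∑splits-+ cs (f x) _))

insertions : ℕ → List ℕ → List (List ℕ)
insertions v []       = (v ∷ []) ∷ []
insertions v (x ∷ xs) = (v ∷ x ∷ xs) ∷ map (x ∷_) (insertions v xs)

-- A place for `v` in the word `L` is the same as a choice of the cell that receives `v`, the other
-- labels going to the other cells in order.
∑-insertions : ∀ {A : Set} v cs L {f : List ℕ → ℤ} {g : A → List A → ℕ → ℤ} → length cs ≡ suc (length L) →
  (∀ as c bs L₁ L₂ → cs ≡ as ++ c ∷ bs → L ≡ L₁ ++ L₂ → length as ≡ length L₁ →
    f (L₁ ++ v ∷ L₂) ≡ g c (as ++ bs) (length bs)) →
  ∑ (insertions v L) f ≡ ∑splits cs g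
∑-insertions v (c ∷ [])      []      p e = cong (_+ 0ℤ) (e [] c [] [] [] refl refl refl)
∑-insertions v (c ∷ cs) (x ∷ L) {f} p e = cong₂ _+_ (e [] c cs [] (x ∷ L) refl refl refl)
  (trans (∑-map (x ∷_) (insertions v L) f) (∑-insertions v cs L (ℕₚ.suc-injective p)
    λ as d bs L₁ L₂ q r s → e (c ∷ as) d bs (x ∷ L₁) L₂ (cong (c ∷_) q) (cong (x ∷_) r) (cong suc s)))

∈-insertions⁻ : ∀ v L {M} → M ∈ insertions v L → ∃₂ λ L₁ L₂ → L ≡ L₁ ++ L₂ × M ≡ L₁ ++ v ∷ L₂
∈-insertions⁻ v []       (here refl) = [] , [] , refl , refl
∈-insertions⁻ v (x ∷ xs) (here refl) = [] , x ∷ xs , refl , refl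
∈-insertions⁻ v (x ∷ xs) (there p) with ∈-map⁻ (x ∷_) p
... | M , q , refl with ∈-insertions⁻ v xs q
...   | L₁ , L₂ , refl , refl = x ∷ L₁ , L₂ , refl , refl

perms : ℕ → List (List ℕ)
perms zero    = [] ∷ []
perms (suc m) = concatMap (insertions (suc m)) (perms m)

∈-perms⁻ : ∀ m {L} → L ∈ perms (suc m) →
  ∃₂ λ L₁ L₂ → L₁ ++ L₂ ∈ perms m × L ≡ L₁ ++ suc m ∷ L₂
∈-perms⁻ m p with find-concatMap (perms m) p
  where
  find-concatMap : ∀ Ls {L} → L ∈ concatMap (insertions (suc m)) Ls → ∃ λ L′ → L′ ∈ Ls × L ∈ insertions (suc m) L′
  find-concatMap (L′ ∷ Ls) p with ∈-++⁻ (insertions (suc m) L′) p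
  ... | inj₁ q = L′ , here refl , q
  ... | inj₂ q with find-concatMap Ls q
  ...   | M , r , s = M , there r , s
... | L′ , q , r with ∈-insertions⁻ (suc m) L′ r
...   | L₁ , L₂ , refl , refl = L₁ , L₂ , q , refl

length-insert : ∀ {A : Set} (as : List A) c bs → length (as ++ c ∷ bs) ≡ suc (length (as ++ bs))
length-insert as c bs = trans (Listₚ.length-++ as) (trans (ℕₚ.+-suc (length as) (length bs))
  (cong suc (sym (Listₚ.length-++ as))))

perms-length : ∀ m {L} → L ∈ perms m → length L ≡ m
perms-length zero    (here refl) = refl
perms-length (suc m) p with ∈-perms⁻ m p
... | L₁ , L₂ , q , refl = trans (length-insert L₁ (suc m) L₂) (cong suc (perms-length m q))

All-insert⁻ : ∀ {A : Set} {P : A → Set} as {c bs} → All P (as ++ c ∷ bs) → P c × All P (as ++ bs)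
All-insert⁻ []       (p ∷ ps) = p , ps
All-insert⁻ (a ∷ as) (p ∷ ps) with All-insert⁻ as ps
... | q , qs = q , p ∷ qs

All-insert⁺ : ∀ {A : Set} {P : A → Set} as {c bs} → P c → All P (as ++ bs) → All P (as ++ c ∷ bs)
All-insert⁺ []       p ps       = p ∷ ps
All-insert⁺ (a ∷ as) p (q ∷ qs) = q ∷ All-insert⁺ as p qs

perms-bound : ∀ m {L} → L ∈ perms m → All (_≤ m) L
perms-bound zero    (here refl) = []
perms-bound (suc m) p with ∈-perms⁻ m p
... | L₁ , L₂ , q , refl = All-insert⁺ L₁ ℕₚ.≤-refl (All.map ℕₚ.m≤n⇒m≤1+n (perms-bound m q))

perms-positive : ∀ m {L} → L ∈ perms m → All (1 ≤_) L
perms-positive zero    (here refl) = []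
perms-positive (suc m) p with ∈-perms⁻ m p
... | L₁ , L₂ , q , refl = All-insert⁺ L₁ (s≤s z≤n) (perms-positive m q)

wordInv : List ℕ → ℕ
wordInv []       = 0
wordInv (x ∷ xs) = count (_<ᵇ x) xs ℕ.+ wordInv xs

<ᵇ-true : ∀ {m n} → m < n → (m <ᵇ n) ≡ true
<ᵇ-true p = Equivalence.to T-≡ (ℕₚ.<⇒<ᵇ p)

bool-iff : ∀ {b c} → (b ≡ true → c ≡ true) → (c ≡ true → b ≡ true) → b ≡ c
bool-iff {true}  {c}     f g = sym (f refl)
bool-iff {false} {true}  f g = g refl
bool-iff {false} {false} f g = refl

<ᵇ-false : ∀ {m n} → n ≤ m → (m <ᵇ n) ≡ false
<ᵇ-false {m} {n} p with m <ᵇ n in e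
... | false = refl
... | true  = contradiction (ℕₚ.<ᵇ⇒< m n (Equivalence.from T-≡ e)) (ℕₚ.≤⇒≯ p)

count-all : ∀ {A : Set} {p : A → Bool} xs → All (λ x → p x ≡ true) xs → count p xs ≡ length xs
count-all []       []       = refl
count-all {p = p} (x ∷ xs) (q ∷ qs) rewrite q = cong suc (count-all xs qs)

count-insert-false : ∀ {A : Set} (p : A → Bool) as c bs → p c ≡ false → count p (as ++ c ∷ bs) ≡ count p (as ++ bs)
count-insert-false p []       c bs e rewrite e = refl
count-insert-false p (a ∷ as) c bs e with p a
... | true  = cong suc (count-insert-false p as c bs e)
... | false = count-insert-false p as c bs e

wordInv-insert : ∀ v L₁ L₂ → All (_< v) (L₁ ++ L₂) → wordInv (L₁ ++ v ∷ L₂) ≡ length L₂ ℕ.+ wordInv (L₁ ++ L₂)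
wordInv-insert v []       L₂ b = cong (ℕ._+ wordInv L₂) (count-all L₂ (All.map <ᵇ-true b))
wordInv-insert v (x ∷ L₁) L₂ (p ∷ b) = begin
  count (_<ᵇ x) (L₁ ++ v ∷ L₂) ℕ.+ wordInv (L₁ ++ v ∷ L₂)
    ≡⟨ cong₂ ℕ._+_ (count-insert-false (_<ᵇ x) L₁ v L₂ (<ᵇ-false (ℕₚ.<⇒≤ p))) (wordInv-insert v L₁ L₂ b) ⟩
  count (_<ᵇ x) (L₁ ++ L₂) ℕ.+ (length L₂ ℕ.+ wordInv (L₁ ++ L₂))
    ≡⟨ lemma (count (_<ᵇ x) (L₁ ++ L₂)) (length L₂) _ ⟩
  length L₂ ℕ.+ (count (_<ᵇ x) (L₁ ++ L₂) ℕ.+ wordInv (L₁ ++ L₂)) ∎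
  where lemma : ∀ a b c → a ℕ.+ (b ℕ.+ c) ≡ b ℕ.+ (a ℕ.+ c)
        lemma = ℕSolver.solve-∀

_≼_ : Cell → Cell → Bool
a ≼ b = (row a ≤ᵇ row b) ∧ (col a ≤ᵇ col b)

maximal : Cell → List Cell → Bool
maximal c = allᵇ (λ b → not (c ≼ b))

module _ {A : Set} {p : A → Bool} where

  allᵇ⁻ : ∀ xs → allᵇ p xs ≡ true → ∀ {x} → x ∈ xs → p x ≡ true
  allᵇ⁻ (x ∷ xs) e (here refl) = proj₁ (∧-split e)
  allᵇ⁻ (x ∷ xs) e (there q)   = allᵇ⁻ xs (proj₂ (∧-split {p x} e)) q

  allᵇ⁺ : ∀ xs → (∀ {x} → x ∈ xs → p x ≡ true) → allᵇ p xs ≡ true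
  allᵇ⁺ []       f = refl
  allᵇ⁺ (x ∷ xs) f = ∧-join (f (here refl)) (allᵇ⁺ xs (f ∘ there))

  allᵇ-++ : ∀ xs ys → allᵇ p (xs ++ ys) ≡ allᵇ p xs ∧ allᵇ p ys
  allᵇ-++ []       ys = refl
  allᵇ-++ (x ∷ xs) ys = trans (cong (p x ∧_) (allᵇ-++ xs ys)) (sym (∧-assoc (p x) (allᵇ p xs) (allᵇ p ys)))

∈-pairs⁺ : ∀ {A : Set} {a b : A} {xs} → a ∈ xs → b ∈ xs → (a , b) ∈ pairs xs
∈-pairs⁺ {A} {a} {b} {xs} p q = go xs p
  where
  go : ∀ ys → a ∈ ys → (a , b) ∈ concatMap (λ c → map (c ,_) xs) ys
  go (y ∷ ys) (here refl) = ∈-++⁺ˡ (∈-map⁺ (a ,_) q)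
  go (y ∷ ys) (there r)   = ∈-++⁺ʳ (map (y ,_) xs) (go ys r)

∈-pairs⁻ : ∀ {A : Set} {a b : A} xs → (a , b) ∈ pairs xs → a ∈ xs × b ∈ xs
∈-pairs⁻ {A} {a} {b} xs p = go xs p
  where
  go : ∀ ys → (a , b) ∈ concatMap (λ c → map (c ,_) xs) ys → a ∈ ys × b ∈ xs
  go (y ∷ ys) q with ∈-++⁻ (map (y ,_) xs) q
  ... | inj₁ r with ∈-map⁻ (y ,_) r
  ...   | b , s , refl = here refl , s
  go (y ∷ ys) q | inj₂ r with go ys r
  ...   | s , t = there s , t

Standard : List Cell → Labelling → Set
Standard cs t = ∀ {a b} → a ∈ cs → b ∈ cs → (a ≼ b) ≡ true → t a ≤ t b

standard⁻ : ∀ cs t → isStandard cs t ≡ true → Standard cs t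
standard⁻ cs t e {a} {b} p q r with allᵇ⁻ (pairs cs) e (∈-pairs⁺ p q)
... | h rewrite r = true-≤ h

standard⁺ : ∀ cs t → Standard cs t → isStandard cs t ≡ true
standard⁺ cs t s = allᵇ⁺ (pairs cs) λ {ab} p → check ab (∈-pairs⁻ cs p)
  where
  check : ∀ ab → proj₁ ab ∈ cs × proj₂ ab ∈ cs → (not (proj₁ ab ≼ proj₂ ab) ∨ (t (proj₁ ab) ≤ᵇ t (proj₂ ab))) ≡ true
  check (a , b) (p , q) with a ≼ b in e
  ... | false = refl
  ... | true  = ≤ᵇ-true (s p q e)

cellEq-refl : ∀ c → cellEq c c ≡ true
cellEq-refl (i , j) = ∧-join (≡ᵇ-refl i) (≡ᵇ-refl j)

cellEq⇒≡ : ∀ c d → cellEq c d ≡ true → c ≡ d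
cellEq⇒≡ (i , j) (i′ , j′) e with ∧-split {i ≡ᵇ i′} e
... | e₁ , e₂ = cong₂ _,_ (≡ᵇ⇒≡ i i′ e₁) (≡ᵇ⇒≡ j j′ e₂)

≢⇒cellEq : ∀ {c d} → c ≢ d → cellEq c d ≡ false
≢⇒cellEq {c} {d} n with cellEq c d in e
... | false = refl
... | true  = contradiction (cellEq⇒≡ c d e) n

tab-other : ∀ as {c bs} L₁ {v L₂ d} → c ≢ d → length as ≡ length L₁ →
  tab (as ++ c ∷ bs) (L₁ ++ v ∷ L₂) d ≡ tab (as ++ bs) (L₁ ++ L₂) d
tab-other []       []       n _ rewrite ≢⇒cellEq n = refl
tab-other (a ∷ as) (x ∷ L₁) {d = d} n p with cellEq a d
... | true  = refl
... | false = tab-other as L₁ n (ℕₚ.suc-injective p)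

tab-here : ∀ as {c bs} L₁ {v L₂} → c ∉ as → length as ≡ length L₁ → tab (as ++ c ∷ bs) (L₁ ++ v ∷ L₂) c ≡ v
tab-here []       {c} []       n _ rewrite cellEq-refl c = refl
tab-here (a ∷ as) (x ∷ L₁) n p rewrite ≢⇒cellEq (n ∘ here ∘ sym) = tab-here as L₁ (n ∘ there) (ℕₚ.suc-injective p)

tab-bound : ∀ cs L {v} d → 0 < v → All (_< v) L → tab cs L d < v
tab-bound []       L       d p b = p
tab-bound (c ∷ cs) []      d p b = p
tab-bound (c ∷ cs) (x ∷ L) d p (q ∷ b) with cellEq c d
... | true  = q
... | false = tab-bound cs L d p b

∈-insert⁻ : ∀ {A : Set} as {c : A} {bs d} → d ∈ as ++ c ∷ bs → d ≡ c ⊎ d ∈ as ++ bs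
∈-insert⁻ []       (here e)  = inj₁ e
∈-insert⁻ []       (there p) = inj₂ p
∈-insert⁻ (a ∷ as) (here e)  = inj₂ (here e)
∈-insert⁻ (a ∷ as) (there p) with ∈-insert⁻ as p
... | inj₁ e = inj₁ e
... | inj₂ q = inj₂ (there q)

∈-insert⁺ : ∀ {A : Set} as {c : A} {bs d} → d ∈ as ++ bs → d ∈ as ++ c ∷ bs
∈-insert⁺ []       p         = there p
∈-insert⁺ (a ∷ as) (here e)  = here e
∈-insert⁺ (a ∷ as) (there p) = there (∈-insert⁺ as p)

-- The largest label can be exceeded by no other, so nothing may lie weakly below and to the right
-- of its cell; and if nothing does, the cell imposes no further condition.
isStandard-insert : ∀ as c bs L₁ v L₂ → c ∉ as ++ bs → length as ≡ length L₁ → 0 < v → All (_< v) (L₁ ++ L₂) →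
  isStandard (as ++ c ∷ bs) (tab (as ++ c ∷ bs) (L₁ ++ v ∷ L₂))
  ≡ maximal c (as ++ bs) ∧ isStandard (as ++ bs) (tab (as ++ bs) (L₁ ++ L₂))
isStandard-insert as c bs L₁ v L₂ c∉ len v>0 bound = bool-iff to from
  where
  cs = as ++ c ∷ bs
  ds = as ++ bs
  t  = tab cs (L₁ ++ v ∷ L₂)
  t′ = tab ds (L₁ ++ L₂)

  ≢c : ∀ {d} → d ∈ ds → c ≢ d
  ≢c p refl = c∉ p

  t-other : ∀ {d} → d ∈ ds → t d ≡ t′ d
  t-other p = tab-other as L₁ (≢c p) len

  t-c : t c ≡ v
  t-c = tab-here as L₁ (c∉ ∘ ∈-++⁺ˡ) len

  c∈ : c ∈ cs
  c∈ = ∈-++⁺ʳ as (here refl)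

  to : isStandard cs t ≡ true → maximal c ds ∧ isStandard ds t′ ≡ true
  to e = ∧-join (allᵇ⁺ ds λ {b} p → not-below b p)
    (standard⁺ ds t′ λ p q r → subst₂ _≤_ (t-other p) (t-other q) (standard⁻ cs t e (∈-insert⁺ as p) (∈-insert⁺ as q) r))
    where
    not-below : ∀ b → b ∈ ds → not (c ≼ b) ≡ true
    not-below b p with c ≼ b in r
    ... | false = refl
    ... | true  = contradiction (subst₂ _≤_ t-c (t-other p) (standard⁻ cs t e c∈ (∈-insert⁺ as p) r))
                                (ℕₚ.<⇒≱ (tab-bound ds (L₁ ++ L₂) b v>0 bound))

  from : maximal c ds ∧ isStandard ds t′ ≡ true → isStandard cs t ≡ true
  from e with ∧-split {maximal c ds} e
  ... | e₁ , e₂ = standard⁺ cs t λ p q r → order p q r (∈-insert⁻ as p) (∈-insert⁻ as q)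
    where
    order : ∀ {a b} → a ∈ cs → b ∈ cs → (a ≼ b) ≡ true → a ≡ c ⊎ a ∈ ds → b ≡ c ⊎ b ∈ ds → t a ≤ t b
    order p q r (inj₁ refl) (inj₁ refl) = ℕₚ.≤-refl
    order p q r (inj₁ refl) (inj₂ q′) with allᵇ⁻ ds e₁ q′
    ... | h rewrite r = contradiction h λ ()
    order {a} p q r (inj₂ p′) (inj₁ refl) =
      subst₂ _≤_ (sym (t-other p′)) (sym t-c) (ℕₚ.<⇒≤ (tab-bound ds (L₁ ++ L₂) a v>0 bound))
    order p q r (inj₂ p′) (inj₂ q′) = subst₂ _≤_ (sym (t-other p′)) (sym (t-other q′)) (standard⁻ ds t′ e₂ p′ q′ r)

signedCount : List Cell → ℤ
signedCount cs = ∑ (perms (length cs)) (λ L → signPow (wordInv L) when isStandard cs (tab cs L))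

Sorted : List Cell → Set
Sorted = AllPairs (λ a b → (a ⊲ b) ≡ true)

⊲-irrefl : ∀ c → (c ⊲ c) ≡ false
⊲-irrefl (i , j) rewrite <ᵇ-irrefl i | <ᵇ-irrefl j | ≡ᵇ-refl i = refl

Sorted-split : ∀ as {c bs} → Sorted (as ++ c ∷ bs) → All (λ a → (a ⊲ c) ≡ true) as × All (λ b → (c ⊲ b) ≡ true) bs
Sorted-split []       (p ∷ s) = [] , p
Sorted-split (a ∷ as) (p ∷ s) with Sorted-split as s
... | q , r = proj₁ (All-insert⁻ as p) ∷ q , r

Sorted-distinct : ∀ as {c bs} → Sorted (as ++ c ∷ bs) → c ∉ as ++ bs
Sorted-distinct as {c} s p with Sorted-split as s | ∈-++⁻ as p
... | q , r | inj₁ p′ = contradiction (trans (sym (All.lookup q p′)) (⊲-irrefl c)) λ ()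
... | q , r | inj₂ p′ = contradiction (trans (sym (All.lookup r p′)) (⊲-irrefl c)) λ ()

-- The largest label sits at a maximal cell c and contributes one inversion for each cell after c.
signedCount-recursion : ∀ cs {m} → Sorted cs → length cs ≡ suc m →
  signedCount cs ≡ ∑splits cs (λ c ds k → signPow k * signedCount ds when maximal c ds)
signedCount-recursion cs {m} s len = begin
  ∑ (perms (length cs)) f
    ≡⟨ cong (λ n → ∑ (perms n) f) len ⟩
  ∑ (concatMap (insertions (suc m)) (perms m)) f
    ≡⟨ ∑-concatMap (insertions (suc m)) (perms m) f ⟩
  ∑ (perms m) (λ L → ∑ (insertions (suc m) L) f)
    ≡⟨ ∑-cong (perms m) (λ {L} p → ∑-insertions (suc m) cs L (trans len (cong suc (sym (perms-length m p)))) (inserted L p)) ⟩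
  ∑ (perms m) (λ L → ∑splits cs (g L))
    ≡⟨ ∑splits-∑ (perms m) cs g ⟩
  ∑splits cs (λ c ds k → ∑ (perms m) (λ L → g L c ds k))
    ≡⟨ ∑splits-cong cs (λ as c bs e → collect as c bs e) ⟩
  ∑splits cs (λ c ds k → signPow k * signedCount ds when maximal c ds) ∎
  where
  f : List ℕ → ℤ
  f L = signPow (wordInv L) when isStandard cs (tab cs L)
  g : List ℕ → Cell → List Cell → ℕ → ℤ
  g L c ds k = signPow k * (signPow (wordInv L) when isStandard ds (tab ds L)) when maximal c ds

  inserted : ∀ L → L ∈ perms m → ∀ as c bs L₁ L₂ → cs ≡ as ++ c ∷ bs → L ≡ L₁ ++ L₂ → length as ≡ length L₁ →
    f (L₁ ++ suc m ∷ L₂) ≡ g L c (as ++ bs) (length bs)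
  inserted L p as c bs L₁ L₂ refl refl e = begin
    (signPow (wordInv (L₁ ++ suc m ∷ L₂)) when isStandard cs (tab cs (L₁ ++ suc m ∷ L₂)))
      ≡⟨ cong₂ _when_ (trans (cong signPow (wordInv-insert (suc m) L₁ L₂ bound)) (signPow-+ (length L₂) _))
           (isStandard-insert as c bs L₁ (suc m) L₂ (Sorted-distinct as s) e (s≤s z≤n) bound) ⟩
    (signPow (length L₂) * w when maximal c ds ∧ isStandard ds (tab ds L))
      ≡⟨ when-∧ _ (maximal c ds) _ ⟩
    ((signPow (length L₂) * w when isStandard ds (tab ds L)) when maximal c ds)
      ≡⟨ cong (_when maximal c ds) (trans (sym (*-when (signPow (length L₂)) w _))
           (cong (λ n → signPow n * (w when isStandard ds (tab ds L))) (sym same-tail))) ⟩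
    g L c ds (length bs) ∎
    where
    ds = as ++ bs
    w = signPow (wordInv (L₁ ++ L₂))
    bound : All (_< suc m) (L₁ ++ L₂)
    bound = All.map s≤s (perms-bound m p)
    same-tail : length bs ≡ length L₂
    same-tail = ℕₚ.+-cancelˡ-≡ (length as) (length bs) (length L₂) (begin
      length as ℕ.+ length bs ≡⟨ sym (Listₚ.length-++ as) ⟩
      length (as ++ bs)       ≡⟨ ℕₚ.suc-injective (trans (sym (length-insert as c bs)) len) ⟩
      m                       ≡⟨ sym (perms-length m p) ⟩
      length (L₁ ++ L₂)       ≡⟨ Listₚ.length-++ L₁ ⟩
      length L₁ ℕ.+ length L₂ ≡⟨ cong (ℕ._+ length L₂) (sym e) ⟩
      length as ℕ.+ length L₂ ∎)

  collect : ∀ as c bs → cs ≡ as ++ c ∷ bs → ∑ (perms m) (λ L → g L c (as ++ bs) (length bs))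
    ≡ (signPow (length bs) * signedCount (as ++ bs) when maximal c (as ++ bs))
  collect as c bs refl = begin
    ∑ (perms m) (λ L → g L c ds (length bs))
      ≡⟨ ∑-when (perms m) _ (maximal c ds) ⟩
    (∑ (perms m) (λ L → signPow (length bs) * (signPow (wordInv L) when isStandard ds (tab ds L))) when maximal c ds)
      ≡⟨ cong (_when maximal c ds) (∑-* (perms m) (signPow (length bs)) _) ⟩
    (signPow (length bs) * ∑ (perms m) (λ L → signPow (wordInv L) when isStandard ds (tab ds L)) when maximal c ds)
      ≡⟨ cong (λ n → signPow (length bs) * ∑ (perms n) (λ L → signPow (wordInv L) when isStandard ds (tab ds L)) when maximal c ds)
           (sym (ℕₚ.suc-injective (trans (sym (length-insert as c bs)) len))) ⟩
    (signPow (length bs) * signedCount ds when maximal c ds) ∎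
    where ds = as ++ bs

-- Removing the largest label

length-rowCells : ∀ r a n → length (rowCells r a n) ≡ n
length-rowCells r a zero    = refl
length-rowCells r a (suc n) = cong suc (length-rowCells r (suc a) n)

⊑-sum : ∀ r {μ l} → μ ⊑ l → length (cells r l μ) ℕ.+ sum μ ≡ sum l
⊑-sum r ([] e) = e
⊑-sum r {μ} {x ∷ xs} (p ∷ q) = begin
  length (R ++ cells (suc r) xs (tl μ)) ℕ.+ sum μ
    ≡⟨ cong₂ ℕ._+_ (trans (Listₚ.length-++ R) (cong (ℕ._+ k) (length-rowCells r (hd μ) (x ℕ.∸ hd μ)))) (sum≡ μ) ⟩
  ((x ℕ.∸ hd μ) ℕ.+ k) ℕ.+ (hd μ ℕ.+ sum (tl μ))
    ≡⟨ lemma (x ℕ.∸ hd μ) k (hd μ) (sum (tl μ)) ⟩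
  ((x ℕ.∸ hd μ) ℕ.+ hd μ) ℕ.+ (k ℕ.+ sum (tl μ))
    ≡⟨ cong₂ ℕ._+_ (ℕₚ.m∸n+n≡m p) (⊑-sum (suc r) q) ⟩
  x ℕ.+ sum xs ∎
  where
  R = rowCells r (hd μ) (x ℕ.∸ hd μ)
  k = length (cells (suc r) xs (tl μ))
  lemma : ∀ a b c d → (a ℕ.+ b) ℕ.+ (c ℕ.+ d) ≡ (a ℕ.+ c) ℕ.+ (b ℕ.+ d)
  lemma = ℕSolver.solve-∀

⊑⇒⊑ᵇ : ∀ {μ l} → μ ⊑ l → (μ ⊑ᵇ l) ≡ true
⊑⇒⊑ᵇ {μ} ([] e)  = trans (cong (_≡ᵇ 0) e) refl
⊑⇒⊑ᵇ     (p ∷ q) = ∧-join (≤ᵇ-true p) (⊑⇒⊑ᵇ q)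

⊑ᵇ⇒⊑ : ∀ μ l → (μ ⊑ᵇ l) ≡ true → μ ⊑ l
⊑ᵇ⇒⊑ μ []      e = [] (≡ᵇ⇒≡ (sum μ) 0 e)
⊑ᵇ⇒⊑ μ (x ∷ l) e = true-≤ (proj₁ (∧-split e)) ∷ ⊑ᵇ⇒⊑ (tl μ) l (proj₂ (∧-split {hd μ ≤ᵇ x} e))

∈-rowCells⁻ : ∀ r a n {c} → c ∈ rowCells r a n → row c ≡ r × a < col c × col c ≤ a ℕ.+ n
∈-rowCells⁻ r a (suc n) (here refl) = refl , ℕₚ.≤-refl , ℕₚ.≤-trans (s≤s (ℕₚ.m≤m+n a n)) (ℕₚ.≤-reflexive (sym (ℕₚ.+-suc a n)))
∈-rowCells⁻ r a (suc n) (there p) with ∈-rowCells⁻ r (suc a) n p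
... | e , q , u = e , ℕₚ.<⇒≤ q , ℕₚ.≤-trans u (ℕₚ.≤-reflexive (sym (ℕₚ.+-suc a n)))

∈-rowCells⁺ : ∀ r a n {j} → a < j → j ≤ a ℕ.+ n → (r , j) ∈ rowCells r a n
∈-rowCells⁺ r a zero p q = contradiction (ℕₚ.≤-trans q (ℕₚ.≤-reflexive (ℕₚ.+-identityʳ a))) (ℕₚ.<⇒≱ p)
∈-rowCells⁺ r a (suc n) {j} p q with ℕₚ.m≤n⇒m<n∨m≡n p
... | inj₂ refl = here refl
... | inj₁ p′   = there (∈-rowCells⁺ r (suc a) n p′ (ℕₚ.≤-trans q (ℕₚ.≤-reflexive (ℕₚ.+-suc a n))))

∈-cells-row : ∀ r l μ {c} → c ∈ cells r l μ → r ≤ row c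
∈-cells-row r (x ∷ xs) μ p with ∈-++⁻ (rowCells r (hd μ) (x ℕ.∸ hd μ)) p
... | inj₁ q = ℕₚ.≤-reflexive (sym (proj₁ (∈-rowCells⁻ r (hd μ) _ q)))
... | inj₂ q = ℕₚ.<⇒≤ (∈-cells-row (suc r) xs (tl μ) q)

∈-cells-col : ∀ r {l μ y} → Partition (just y) l → μ ⊑ l → ∀ {c} → c ∈ cells r l μ → col c ≤ y
∈-cells-col r {x ∷ xs} {μ} (p ∷ q) (u ∷ v) m with ∈-++⁻ (rowCells r (hd μ) (x ℕ.∸ hd μ)) m
... | inj₁ k = ℕₚ.≤-trans (proj₂ (proj₂ (∈-rowCells⁻ r (hd μ) _ k))) (ℕₚ.≤-trans (ℕₚ.≤-reflexive (ℕₚ.m+[n∸m]≡n u)) p)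
... | inj₂ k = ℕₚ.≤-trans (∈-cells-col (suc r) q v k) p

≼-false-row : ∀ {c d} → row d < row c → (c ≼ d) ≡ false
≼-false-row {c} {d} p with row c ≤ᵇ row d in e
... | false = refl
... | true  = contradiction (true-≤ e) (ℕₚ.<⇒≱ p)

≼-false-col : ∀ {c d} → col d < col c → (c ≼ d) ≡ false
≼-false-col {c} {d} p with row c ≤ᵇ row d
... | false = refl
... | true with col c ≤ᵇ col d in e
...   | false = refl
...   | true  = contradiction (true-≤ e) (ℕₚ.<⇒≱ p)

maximal-false : ∀ {c d} cs → d ∈ cs → (c ≼ d) ≡ true → maximal c cs ≡ false
maximal-false {c} {d} cs p e with maximal c cs in h
... | false = refl
... | true  = contradiction (trans (sym (allᵇ⁻ cs h p)) (cong not e)) λ ()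

-- Every cell but the last has its right neighbour among the remaining cells, so the hypothesis
-- removes its term.
∑splits-row : ∀ r a n (f : Cell → List Cell → ℕ → ℤ) →
  (∀ j ds k → (r , suc j) ∈ ds → f (r , j) ds k ≡ 0ℤ) →
  ∑splits (rowCells r a (suc n)) f ≡ f (r , suc (a ℕ.+ n)) (rowCells r a n) 0
∑splits-row r a zero f z = trans (ℤₚ.+-identityʳ _) (cong (λ i → f (r , suc i) [] 0) (sym (ℕₚ.+-identityʳ a)))
∑splits-row r a (suc n) f z = trans
  (cong₂ _+_ (z (suc a) _ _ (here refl))
    (∑splits-row r (suc a) n (λ d ds → f d ((r , suc a) ∷ ds)) λ j ds k p → z j _ k (there p)))
  (trans (ℤₚ.+-identityˡ _) (cong (λ i → f (r , suc i) (rowCells r a (suc n)) 0) (sym (ℕₚ.+-suc a n))))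

drop-tl : ∀ i (l : List ℕ) → drop (suc i) l ≡ drop i (tl l)
drop-tl zero    []      = refl
drop-tl (suc i) []      = refl
drop-tl i       (x ∷ l) = refl

-- The maximal cells are the ends of the rows that can be shortened.  The exponent counts the cells of l
-- below row r + i: those of l / μ through k, those of μ through below.
∑splits-cells : ∀ {b b′} r l μ (H : List Cell → ℤ) (below : ℕ → ℕ) →
  (∀ i → below (r ℕ.+ i) ≡ sum (drop i (tl μ))) → Partition b l → Partition b′ μ → μ ⊑ l →
  ∑splits (cells r l μ) (λ c ds k → signPow (k ℕ.+ below (row c)) * H ds when maximal c ds)
  ≡ removeBoxes (λ m → H (cells r m μ) when μ ⊑ᵇ m) l
∑splits-cells r [] μ H below e p s q = refl
∑splits-cells {b} r (x ∷ xs) μ H below e (p ∷ p′) s (q ∷ q′) = trans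
  (∑splits-++ R rest term) (cong₂ _+_ (first x p q p′) others)
  where
  a = hd μ
  R = rowCells r a (x ℕ.∸ a)
  rest = cells (suc r) xs (tl μ)
  term : Cell → List Cell → ℕ → ℤ
  term c ds k = signPow (k ℕ.+ below (row c)) * H ds when maximal c ds

  Partition-tl : ∀ {b μ} → Partition b μ → Partition (just (hd μ)) (tl μ)
  Partition-tl []      = []
  Partition-tl (p ∷ q) = q

  row-length : ∀ n → suc (a ℕ.+ n) ℕ.∸ a ≡ suc n
  row-length n = trans (cong (ℕ._∸ a) (sym (ℕₚ.+-suc a n))) (ℕₚ.m+n∸m≡n a (suc n))

  others : ∑splits rest (λ d ds → term d (R ++ ds)) ≡ 1ℤ * removeBoxes (λ m → H (cells r (x ∷ m) μ) when μ ⊑ᵇ x ∷ m) xs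
  others = begin
    ∑splits rest (λ d ds → term d (R ++ ds))
      -- The cells of row `r` lie above `c`, so they do not affect its maximality.
      ≡⟨ ∑splits-cong rest (λ as c bs e′ → cong (signPow (length bs ℕ.+ below (row c)) * H (R ++ as ++ bs) when_)
           (trans (allᵇ-++ R (as ++ bs)) (cong (_∧ maximal c (as ++ bs)) (allᵇ⁺ R λ m →
             cong not (≼-false-row {c} (subst (_< row c) (sym (proj₁ (∈-rowCells⁻ r a _ m)))
               (∈-cells-row (suc r) xs (tl μ) (subst (c ∈_) (sym e′) (∈-++⁺ʳ as (here refl)))))))))) ⟩
    ∑splits rest (λ c ds k → signPow (k ℕ.+ below (row c)) * H (R ++ ds) when maximal c ds)
      ≡⟨ ∑splits-cells (suc r) xs (tl μ) (H ∘ (R ++_)) below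
           (λ i → trans (cong below (sym (ℕₚ.+-suc r i))) (trans (e (suc i)) (cong sum (drop-tl i (tl μ))))) p′ (Partition-tl s) q′ ⟩
    removeBoxes (λ m → H (R ++ cells (suc r) m (tl μ)) when tl μ ⊑ᵇ m) xs
      ≡⟨ remove-cong xs (λ {m} _ → cong (λ c → H (cells r (x ∷ m) μ) when c ∧ (tl μ ⊑ᵇ m)) (sym (≤ᵇ-true q))) ⟩
    removeBoxes (λ m → H (cells r (x ∷ m) μ) when μ ⊑ᵇ x ∷ m) xs
      ≡⟨ sym (ℤₚ.*-identityˡ _) ⟩
    1ℤ * removeBoxes (λ m → H (cells r (x ∷ m) μ) when μ ⊑ᵇ x ∷ m) xs ∎

  first : ∀ x → x ≤ᴮ b → a ≤ x → Partition (just x) xs →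
    ∑splits (rowCells r a (x ℕ.∸ a)) (λ d ds k → term d (ds ++ rest) (k ℕ.+ length rest))
    ≡ (signPow (sum xs) * (H (cells r (pred x ∷ xs) μ) when μ ⊑ᵇ pred x ∷ xs) when hd xs <ᵇ x)
  first x p q p′ with ℕₚ.m≤n⇒m<n∨m≡n q
  -- This row has no cell outside `μ`; correspondingly, shortening it would break the containment of
  -- `μ`.
  ... | inj₂ refl rewrite ℕₚ.n∸n≡0 a = sym (empty a refl)
    where
    empty : ∀ y → y ≡ a → (signPow (sum xs) * (H (cells r (pred y ∷ xs) μ) when (a ≤ᵇ pred y) ∧ (tl μ ⊑ᵇ xs)) when hd xs <ᵇ y) ≡ 0ℤ
    empty zero    _ = refl
    empty (suc y) h rewrite sym h | <ᵇ-irrefl y = trans (cong (_when hd xs <ᵇ suc y) (ℤₚ.*-zeroʳ (signPow (sum xs)))) (when-0 (hd xs <ᵇ suc y))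
  ... | inj₁ a<x with ℕₚ.m≤n⇒∃[o]m+o≡n a<x
  ...   | n , refl rewrite row-length n = begin
    ∑splits (rowCells r a (suc n)) (λ d ds k → term d (ds ++ rest) (k ℕ.+ length rest))
      ≡⟨ ∑splits-row r a n (λ d ds k → term d (ds ++ rest) (k ℕ.+ length rest)) (λ j ds k m → cong (signPow (k ℕ.+ length rest ℕ.+ below r) * H (ds ++ rest) when_)
           (maximal-false {r , j} (ds ++ rest) (∈-++⁺ˡ m) (∧-join (≤ᵇ-true (ℕₚ.≤-refl {r})) (≤ᵇ-true (ℕₚ.n≤1+n j))))) ⟩
    (signPow (length rest ℕ.+ below r) * H (rowCells r a n ++ rest) when maximal c (rowCells r a n ++ rest))
      ≡⟨ cong₂ (λ k m → signPow k * H (rowCells r a n ++ rest) when m) below-row end-maximal ⟩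
    (signPow (sum xs) * H (rowCells r a n ++ rest) when hd xs <ᵇ x′)
      ≡⟨ cong₂ (λ k m → signPow (sum xs) * (H (rowCells r a k ++ rest) when m) when hd xs <ᵇ x′)
           (sym (ℕₚ.m+n∸m≡n a n)) (sym (∧-join (≤ᵇ-true (ℕₚ.m≤m+n a n)) (⊑⇒⊑ᵇ q′))) ⟩
    (signPow (sum xs) * (H (cells r (a ℕ.+ n ∷ xs) μ) when μ ⊑ᵇ a ℕ.+ n ∷ xs) when hd xs <ᵇ x′) ∎
    where
    c = r , suc (a ℕ.+ n)
    x′ = suc (a ℕ.+ n)
    below-row : length rest ℕ.+ below r ≡ sum xs
    below-row = trans (cong (length rest ℕ.+_) (trans (cong below (sym (ℕₚ.+-identityʳ r))) (e 0))) (⊑-sum (suc r) q′)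
    rest-maximal : maximal c rest ≡ (hd xs <ᵇ x′)
    rest-maximal = bool-iff to from
      where
      -- The cell directly below `c` lies outside `μ`: as `μ` is a partition, its next row ends at
      -- column `a` or before. So `c` is not maximal if the next row of the outer shape reaches it.
      covered : ∀ {zs ν} → x′ ≤ hd zs → hd ν ≤ a → ν ⊑ zs → (suc r , x′) ∈ cells (suc r) zs ν
      covered {z ∷ zs} {ν} u v (w ∷ _) = ∈-++⁺ˡ (∈-rowCells⁺ (suc r) (hd ν) (z ℕ.∸ hd ν) (s≤s (ℕₚ.≤-trans v (ℕₚ.m≤m+n a n)))
        (ℕₚ.≤-trans u (ℕₚ.≤-reflexive (sym (ℕₚ.m+[n∸m]≡n w)))))
      to : maximal c rest ≡ true → (hd xs <ᵇ x′) ≡ true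
      to h with ℕₚ.<-≤-connex (hd xs) x′
      ... | inj₁ u = <ᵇ-true u
      ... | inj₂ u = contradiction (trans (sym h) (maximal-false {c} rest (covered u (hd≤ (Partition-tl s)) q′)
                       (∧-join (≤ᵇ-true (ℕₚ.n≤1+n r)) (≤ᵇ-true (ℕₚ.≤-refl {x′}))))) λ ()
      from : (hd xs <ᵇ x′) ≡ true → maximal c rest ≡ true
      from h = allᵇ⁺ rest λ m → cong not (≼-false-col {c} (s≤s (ℕₚ.≤-trans
        (∈-cells-col (suc r) (Partition-bound ℕₚ.≤-refl p′) q′ m) (ℕₚ.≤-pred (<ᴮ⇒≤ᴮ (just x′) h)))))
    end-maximal : maximal c (rowCells r a n ++ rest) ≡ (hd xs <ᵇ x′)
    end-maximal = trans (allᵇ-++ (rowCells r a n) rest) (trans (cong (_∧ maximal c rest)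
      (allᵇ⁺ (rowCells r a n) λ m → cong not (≼-false-col {c} (s≤s (proj₂ (proj₂ (∈-rowCells⁻ r a n m))))))) rest-maximal)

rowCells-Sorted : ∀ r a n → Sorted (rowCells r a n)
rowCells-Sorted r a zero    = []
rowCells-Sorted r a (suc n) = All.tabulate (λ {c} p → before c (∈-rowCells⁻ r (suc a) n p)) ∷ rowCells-Sorted r (suc a) n
  where
  before : ∀ c → row c ≡ r × suc a < col c × col c ≤ suc a ℕ.+ n → ((r , suc a) ⊲ c) ≡ true
  before (_ , j) (refl , q , _) rewrite <ᵇ-irrefl r | ≡ᵇ-refl r = <ᵇ-true q

⊲-row : ∀ {c d} → row c < row d → (c ⊲ d) ≡ true
⊲-row {i , j} {i′ , j′} p rewrite <ᵇ-true p = refl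

cells-Sorted : ∀ r l μ → Sorted (cells r l μ)
cells-Sorted r []       μ = []
cells-Sorted r (x ∷ xs) μ = AllPairsₚ.++⁺ (rowCells-Sorted r (hd μ) (x ℕ.∸ hd μ)) (cells-Sorted (suc r) xs (tl μ))
  (All.tabulate λ {c} p → All.tabulate λ {d} q → ⊲-row {c} {d}
    (subst (_< row d) (sym (proj₁ (∈-rowCells⁻ r (hd μ) _ p))) (∈-cells-row (suc r) xs (tl μ) q)))

-- The sign in front stands for the inversions between a cell of the skew shape and the cells of the
-- inner shape below it, which do not depend on the labels.
weightedCount : (ℕ → ℕ) → List Cell → ℤ
weightedCount below cs = signPow (sum (map (below ∘ row) cs)) * signedCount cs

sum-insert : ∀ as x bs → sum (as ++ x ∷ bs) ≡ x ℕ.+ sum (as ++ bs)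
sum-insert []       x bs = refl
sum-insert (a ∷ as) x bs = trans (cong (a ℕ.+_) (sum-insert as x bs)) (lemma a x (sum (as ++ bs)))
  where lemma : ∀ a b c → a ℕ.+ (b ℕ.+ c) ≡ b ℕ.+ (a ℕ.+ c)
        lemma = ℕSolver.solve-∀

weightedCount-recursion : ∀ below cs {m} → Sorted cs → length cs ≡ suc m →
  weightedCount below cs
  ≡ ∑splits cs (λ c ds k → signPow (k ℕ.+ below (row c)) * weightedCount below ds when maximal c ds)
weightedCount-recursion below cs s len = begin
  σ cs * signedCount cs
    ≡⟨ cong (σ cs *_) (signedCount-recursion cs s len) ⟩
  σ cs * ∑splits cs (λ c ds k → signPow k * signedCount ds when maximal c ds)
    ≡⟨ sym (∑splits-* (σ cs) cs _) ⟩
  ∑splits cs (λ c ds k → σ cs * (signPow k * signedCount ds when maximal c ds))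
    ≡⟨ ∑splits-cong cs (λ as c bs e → trans (*-when (σ cs) _ (maximal c (as ++ bs))) (cong (_when maximal c (as ++ bs)) (combine as c bs e))) ⟩
  ∑splits cs (λ c ds k → signPow (k ℕ.+ below (row c)) * weightedCount below ds when maximal c ds) ∎
  where
  κ = below ∘ row
  σ : List Cell → ℤ
  σ ds = signPow (sum (map κ ds))
  combine : ∀ as c bs → cs ≡ as ++ c ∷ bs → σ cs * (signPow (length bs) * signedCount (as ++ bs))
    ≡ signPow (length bs ℕ.+ κ c) * (σ (as ++ bs) * signedCount (as ++ bs))
  combine as c bs refl = begin
    σ (as ++ c ∷ bs) * (signPow (length bs) * signedCount (as ++ bs))
      ≡⟨ cong (λ n → signPow n * (signPow (length bs) * signedCount (as ++ bs))) (trans (cong sum (Listₚ.map-++ κ as (c ∷ bs)))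
           (trans (sum-insert (map κ as) (κ c) (map κ bs)) (cong (λ L → κ c ℕ.+ sum L) (sym (Listₚ.map-++ κ as bs))))) ⟩
    signPow (κ c ℕ.+ sum (map κ (as ++ bs))) * (signPow (length bs) * signedCount (as ++ bs))
      ≡⟨ cong (_* (signPow (length bs) * signedCount (as ++ bs))) (signPow-+ (κ c) _) ⟩
    signPow (κ c) * σ (as ++ bs) * (signPow (length bs) * signedCount (as ++ bs))
      ≡⟨ lemma (signPow (κ c)) (σ (as ++ bs)) (signPow (length bs)) (signedCount (as ++ bs)) ⟩
    signPow (length bs) * signPow (κ c) * (σ (as ++ bs) * signedCount (as ++ bs))
      ≡⟨ cong (_* (σ (as ++ bs) * signedCount (as ++ bs))) (sym (signPow-+ (length bs) (κ c))) ⟩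
    signPow (length bs ℕ.+ κ c) * (σ (as ++ bs) * signedCount (as ++ bs)) ∎
    where lemma : ∀ a b c d → a * b * (c * d) ≡ c * a * (b * d)
          lemma = solve-∀

⊑-RemoveBox : ∀ {μ l m} → RemoveBox l m → μ ⊑ m → μ ⊑ l
⊑-RemoveBox (here _)  (p ∷ q) = ℕₚ.m≤n⇒m≤1+n p ∷ q
⊑-RemoveBox (there c) (p ∷ q) = p ∷ ⊑-RemoveBox c q

≈ᵇ⇒⊑ : ∀ μ l → (μ ≈ᵇ l) ≡ true → μ ⊑ l
≈ᵇ⇒⊑ μ       []      e = [] (≈ᵇ⇒sum μ [] e)
≈ᵇ⇒⊑ []      (x ∷ l) e = z≤n ∷ []⊑ l
≈ᵇ⇒⊑ (a ∷ μ) (x ∷ l) e = ℕₚ.≤-reflexive (≡ᵇ⇒≡ a x (proj₁ (∧-split e))) ∷ ≈ᵇ⇒⊑ μ l (proj₂ (∧-split {a ≡ᵇ x} e))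

⊑⇒≈ᵇ : ∀ {μ l} → μ ⊑ l → sum μ ≡ sum l → (μ ≈ᵇ l) ≡ true
⊑⇒≈ᵇ {[]}    ([] _) e = refl
⊑⇒≈ᵇ {a ∷ μ} ([] s) e = ∧-join (cong (_≡ᵇ 0) (hd≡0 (a ∷ μ) s)) (⊑⇒≈ᵇ {μ} ([] (sum-tl≡0 (a ∷ μ) s)) (sum-tl≡0 (a ∷ μ) s))
⊑⇒≈ᵇ {μ} {x ∷ l} (p ∷ q) e = trans (≈ᵇ-∷ μ x l) (∧-join (trans (cong (_≡ᵇ x) hd≡x) (≡ᵇ-refl x))
  (⊑⇒≈ᵇ q (ℕₚ.+-cancelˡ-≡ x _ _ (trans (cong (ℕ._+ sum (tl μ)) (sym hd≡x)) e′))))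
  where
  e′ : hd μ ℕ.+ sum (tl μ) ≡ x ℕ.+ sum l
  e′ = trans (sym (sum≡ μ)) e
  ⊑-sum-≤ : sum (tl μ) ≤ sum l
  ⊑-sum-≤ = ℕₚ.≤-trans (ℕₚ.m≤n+m (sum (tl μ)) _) (ℕₚ.≤-reflexive (⊑-sum 0 q))
  hd≡x : hd μ ≡ x
  hd≡x = ℕₚ.≤-antisym p (ℕₚ.+-cancelʳ-≤ (sum l) x (hd μ) (ℕₚ.≤-trans (ℕₚ.≤-reflexive (sym e′)) (ℕₚ.+-monoʳ-≤ (hd μ) ⊑-sum-≤)))

-- Rows are numbered from 1, so dropping `i` parts leaves the rows strictly below row `i`.
below : List ℕ → ℕ → ℕ
below μ i = sum (drop i μ)

module _ {μ : List ℕ} (μ-Partition : Partition nothing μ) where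

  -- Both sides obey the same recursion, one by removing a box and one by removing the largest
  -- label. Removing boxes cannot create containment of `μ`, so shapes without it contribute
  -- nothing. The condition on sizes makes `n` the number of labels, so that none is left at 0.
  chains≡weightedCount : ∀ n {l} → Partition nothing l → sum l ≡ sum μ ℕ.+ n →
    chains μ n l ≡ (weightedCount (below μ) (cells 1 l μ) when μ ⊑ᵇ l)
  chains≡weightedCount zero {l} p e = trans (cong (1ℤ when_) same) (when-cong (μ ⊑ᵇ l) λ h → sym (trivial h))
    where
    same : (μ ≈ᵇ l) ≡ (μ ⊑ᵇ l)
    same = bool-iff (⊑⇒⊑ᵇ ∘ ≈ᵇ⇒⊑ μ l) (λ h → ⊑⇒≈ᵇ (⊑ᵇ⇒⊑ μ l h) (sym (trans e (ℕₚ.+-identityʳ _))))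
    trivial : (μ ⊑ᵇ l) ≡ true → weightedCount (below μ) (cells 1 l μ) ≡ 1ℤ
    trivial h with cells 1 l μ | ⊑-sum 1 (⊑ᵇ⇒⊑ μ l h)
    ... | []     | _  = refl
    ... | c ∷ cs | e′ = contradiction (trans e′ (trans e (ℕₚ.+-identityʳ _))) (ℕₚ.<⇒≢ (s≤s (ℕₚ.m≤n+m (sum μ) (length cs))) ∘ sym)
  chains≡weightedCount (suc n) {l} p e = trans
    (remove-cong l λ c → chains≡weightedCount n (RemoveBox-Partition p c)
      (ℕₚ.suc-injective (trans (sym (RemoveBox-sum c)) (trans e (ℕₚ.+-suc (sum μ) n)))))
    removed
    where
    removed : removeBoxes (λ m → weightedCount (below μ) (cells 1 m μ) when μ ⊑ᵇ m) l ≡ (weightedCount (below μ) (cells 1 l μ) when μ ⊑ᵇ l)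
    removed with μ ⊑ᵇ l in h
    ... | true = sym (trans
      (weightedCount-recursion (below μ) (cells 1 l μ) (cells-Sorted 1 l μ) (ℕₚ.+-cancelʳ-≡ (sum μ) _ (suc n)
        (trans (⊑-sum 1 (⊑ᵇ⇒⊑ μ l h)) (trans e (ℕₚ.+-comm (sum μ) (suc n))))))
      (∑splits-cells 1 l μ (weightedCount (below μ)) (below μ) (λ i → cong sum (drop-tl i μ)) p μ-Partition (⊑ᵇ⇒⊑ μ l h)))
    ... | false = trans (remove-cong l λ {m} c → cong (weightedCount (below μ) (cells 1 m μ) when_) (outside c)) (remove-0 1ℤ l)
      where
      outside : ∀ {m} → RemoveBox l m → (μ ⊑ᵇ m) ≡ false
      outside {m} c with μ ⊑ᵇ m in h′
      ... | false = refl
      ... | true  = contradiction (trans (sym (⊑⇒⊑ᵇ (⊑-RemoveBox c (⊑ᵇ⇒⊑ μ m h′)))) h) λ ()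

-- Enumeration of tableaux

∑-↭ : ∀ {A : Set} {xs ys : List A} (f : A → ℤ) → xs ↭ ys → ∑ xs f ≡ ∑ ys f
∑-↭ f ↭-refl        = refl
∑-↭ f (prep x p)    = cong (f x +_) (∑-↭ f p)
∑-↭ f (swap x y p)  = trans (cong (λ z → f x + (f y + z)) (∑-↭ f p)) (lemma (f x) (f y) _)
  where lemma : ∀ a b c → a + (b + c) ≡ b + (a + c)
        lemma = solve-∀
∑-↭ f (↭-trans p q) = trans (∑-↭ f p) (∑-↭ f q)

∈-concatMap : ∀ {A B : Set} {f : A → List B} xs {y} → y ∈ concatMap f xs → ∃ λ x → x ∈ xs × y ∈ f x
∈-concatMap {f = f} (x ∷ xs) p with ∈-++⁻ (f x) p
... | inj₁ q = x , here refl , q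
... | inj₂ q with ∈-concatMap xs q
...   | z , r , s = z , there r , s

concatMap-∈ : ∀ {A B : Set} (f : A → List B) {xs x y} → x ∈ xs → y ∈ f x → y ∈ concatMap f xs
concatMap-∈ f {x ∷ xs} (here refl) q = ∈-++⁺ˡ q
concatMap-∈ f {x ∷ xs} (there p)   q = ∈-++⁺ʳ (f x) (concatMap-∈ f p q)

-- Since `g` recovers the index of a block from each of its elements, the blocks are disjoint.
Unique-concatMap : ∀ {A B : Set} (f : A → List B) (g : B → A) xs → Unique xs →
  (∀ {x} → x ∈ xs → Unique (f x)) → (∀ {x y} → x ∈ xs → y ∈ f x → g y ≡ x) → Unique (concatMap f xs)
Unique-concatMap f g []       u      uf inverse = []
Unique-concatMap f g (x ∷ xs) (n ∷ u) uf inverse = AllPairsₚ.++⁺ (uf (here refl))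
  (Unique-concatMap f g xs u (uf ∘ there) (inverse ∘ there))
  (All.tabulate λ p → All.tabulate λ q → separate p (∈-concatMap xs q))
  where
  separate : ∀ {y z} → y ∈ f x → (∃ λ x′ → x′ ∈ xs × z ∈ f x′) → y ≢ z
  separate p (x′ , q , r) refl = All.lookup n q (trans (sym (inverse (here refl) p)) (inverse (there q) r))

Unique-filterᵇ : ∀ {A : Set} (p : A → Bool) xs → Unique xs → Unique (filterᵇ p xs)
Unique-filterᵇ p []       []      = []
Unique-filterᵇ p (x ∷ xs) (n ∷ u) with p x
... | true  = All-filterᵇ xs n ∷ Unique-filterᵇ p xs u
  where
  All-filterᵇ : ∀ {Q : _ → Set} ys → All Q ys → All Q (filterᵇ p ys)
  All-filterᵇ []       []       = []
  All-filterᵇ (y ∷ ys) (q ∷ qs) with p y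
  ... | true  = q ∷ All-filterᵇ ys qs
  ... | false = All-filterᵇ ys qs
... | false = Unique-filterᵇ p xs u

∈-filterᵇ⁻ : ∀ {A : Set} (p : A → Bool) xs {x} → x ∈ filterᵇ p xs → x ∈ xs × p x ≡ true
∈-filterᵇ⁻ p (x ∷ xs) q with p x in e
∈-filterᵇ⁻ p (x ∷ xs) (here refl) | true = here refl , e
∈-filterᵇ⁻ p (x ∷ xs) (there q)   | true with ∈-filterᵇ⁻ p xs q
... | r , s = there r , s
∈-filterᵇ⁻ p (x ∷ xs) q | false with ∈-filterᵇ⁻ p xs q
... | r , s = there r , s

∈-filterᵇ⁺ : ∀ {A : Set} (p : A → Bool) xs {x} → x ∈ xs → p x ≡ true → x ∈ filterᵇ p xs
∈-filterᵇ⁺ p (x ∷ xs) (here refl) e rewrite e = here refl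
∈-filterᵇ⁺ p (x ∷ xs) (there q) e with p x
... | true  = there (∈-filterᵇ⁺ p xs q e)
... | false = ∈-filterᵇ⁺ p xs q e

Unique-lists : ∀ n {xs} → Unique xs → Unique (lists n xs)
Unique-lists zero    u = [] ∷ []
Unique-lists (suc n) {xs} u = Unique-concatMap _ hd xs u
  (λ {x} _ → Uniqueₚ.map⁺ Listₚ.∷-injectiveʳ (Unique-lists n u))
  (λ {x} _ q → inverse (∈-map⁻ (x ∷_) q))
  where
  inverse : ∀ {x y} → (∃ λ l → l ∈ lists n xs × y ≡ x ∷ l) → hd y ≡ x
  inverse (_ , _ , refl) = refl

∈-lists⁺ : ∀ n xs {L} → length L ≡ n → All (_∈ xs) L → L ∈ lists n xs
∈-lists⁺ zero    xs {[]}    e []       = here refl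
∈-lists⁺ (suc n) xs {x ∷ L} e (p ∷ ps) =
  concatMap-∈ (λ y → map (y ∷_) (lists n xs)) p (∈-map⁺ (x ∷_) (∈-lists⁺ n xs (ℕₚ.suc-injective e) ps))

∈-fromTo⁺ : ∀ m {v} → 1 ≤ v → v ≤ m → v ∈ fromTo 1 m
∈-fromTo⁺ m {suc v} p q = ∈-map⁺ suc (∈-upTo⁺ q)

∈-fromTo⁻ : ∀ m {v} → v ∈ fromTo 1 m → 1 ≤ v × v ≤ m
∈-fromTo⁻ m p with ∈-map⁻ suc p
... | w , q , refl = s≤s z≤n , ∈-upTo⁻ q

∈-anyᵇ : ∀ v L → anyᵇ (v ≡ᵇ_) L ≡ true → v ∈ L
∈-anyᵇ v (x ∷ L) e with v ≡ᵇ x in h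
... | true  = here (≡ᵇ⇒≡ v x h)
... | false = there (∈-anyᵇ v L e)

anyᵇ-∈ : ∀ {v L} → v ∈ L → anyᵇ (v ≡ᵇ_) L ≡ true
anyᵇ-∈ {v} (here refl) rewrite ≡ᵇ-refl v = refl
anyᵇ-∈ {v} {x ∷ L} (there p) with v ≡ᵇ x
... | true  = refl
... | false = anyᵇ-∈ p

∈-insertions⁺ : ∀ v L₁ L₂ → L₁ ++ v ∷ L₂ ∈ insertions v (L₁ ++ L₂)
∈-insertions⁺ v []       []       = here refl
∈-insertions⁺ v []       (x ∷ L₂) = here refl
∈-insertions⁺ v (x ∷ L₁) L₂       = there (∈-map⁺ (x ∷_) (∈-insertions⁺ v L₁ L₂))

-- A pigeonhole argument: deleting one occurrence of the largest label leaves a word one shorter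
-- that still contains all the others, so in the end there is no room for a repetition.
∈-perms⁺ : ∀ m {L} → length L ≡ m → (∀ v → 1 ≤ v → v ≤ m → v ∈ L) → L ∈ perms m
∈-perms⁺ zero    {[]} e f = here refl
∈-perms⁺ (suc m) {L} e f with ∈-∃++ (f (suc m) (s≤s z≤n) ℕₚ.≤-refl)
... | L₁ , L₂ , refl = concatMap-∈ (insertions (suc m))
  (∈-perms⁺ m (ℕₚ.suc-injective (trans (sym (length-insert L₁ (suc m) L₂)) e)) smaller) (∈-insertions⁺ (suc m) L₁ L₂)
  where
  smaller : ∀ v → 1 ≤ v → v ≤ m → v ∈ L₁ ++ L₂
  smaller v p q with ∈-insert⁻ L₁ (f v p (ℕₚ.m≤n⇒m≤1+n q))
  ... | inj₁ refl = contradiction q (ℕₚ.<⇒≱ ℕₚ.≤-refl)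
  ... | inj₂ r    = r

perms-surjective : ∀ m {L} → L ∈ perms m → ∀ v → 1 ≤ v → v ≤ m → v ∈ L
perms-surjective zero    p v q r = contradiction r (ℕₚ.<⇒≱ q)
perms-surjective (suc m) p v q r with ∈-perms⁻ m p | ℕₚ.m≤n⇒m<n∨m≡n r
... | L₁ , L₂ , s , refl | inj₁ (s≤s r′) = ∈-insert⁺ L₁ (perms-surjective m s v q r′)
... | L₁ , L₂ , s , refl | inj₂ refl     = ∈-++⁺ʳ L₁ (here refl)

Unique-insertions : ∀ v L → v ∉ L → Unique (insertions v L)
Unique-insertions v []       n = [] ∷ []
Unique-insertions v (x ∷ xs) n =
  All.tabulate (λ p e → n (here (Listₚ.∷-injectiveˡ (trans e (proj₂ (proj₂ (∈-map⁻ (x ∷_) p)))))))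
  ∷ Uniqueₚ.map⁺ Listₚ.∷-injectiveʳ (Unique-insertions v xs (n ∘ there))

-- It undoes the insertion of a fresh label, and so tells from which shorter word a permutation was
-- built.
delete : ℕ → List ℕ → List ℕ
delete v = filterᵇ (λ x → not (v ≡ᵇ x))

delete-∉ : ∀ v L → v ∉ L → delete v L ≡ L
delete-∉ v []      n = refl
delete-∉ v (x ∷ L) n with v ≡ᵇ x in e
... | true  = contradiction (here (≡ᵇ⇒≡ v x e)) n
... | false = cong (x ∷_) (delete-∉ v L (n ∘ there))

delete-insert : ∀ v L₁ L₂ → delete v (L₁ ++ v ∷ L₂) ≡ delete v (L₁ ++ L₂)
delete-insert v [] L₂ rewrite ≡ᵇ-refl v = refl
delete-insert v (x ∷ L₁) L₂ with v ≡ᵇ x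
... | true  = delete-insert v L₁ L₂
... | false = cong (x ∷_) (delete-insert v L₁ L₂)

Unique-perms : ∀ m → Unique (perms m)
Unique-perms zero    = [] ∷ []
Unique-perms (suc m) = Unique-concatMap (insertions (suc m)) (delete (suc m)) (perms m) (Unique-perms m)
  (λ {L} p → Unique-insertions (suc m) L (fresh p)) (λ p q → inverse p (∈-insertions⁻ (suc m) _ q))
  where
  fresh : ∀ {L} → L ∈ perms m → suc m ∉ L
  fresh p q = ℕₚ.<⇒≱ ℕₚ.≤-refl (All.lookup (perms-bound m p) q)
  inverse : ∀ {L M} → L ∈ perms m → (∃₂ λ L₁ L₂ → L ≡ L₁ ++ L₂ × M ≡ L₁ ++ suc m ∷ L₂) → delete (suc m) M ≡ L
  inverse p (L₁ , L₂ , refl , refl) = trans (delete-insert (suc m) L₁ L₂) (delete-∉ (suc m) (L₁ ++ L₂) (fresh p))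

surjective : ℕ → List ℕ → Bool
surjective m L = allᵇ (λ v → anyᵇ (v ≡ᵇ_) L) (fromTo 1 m)

-- The definition of `syts` filters all words, the recursion inserts largest labels. Both lists are
-- free of repetitions and have the same members.
surjective-lists↭perms : ∀ m → filterᵇ (surjective m) (lists m (fromTo 1 m)) ↭ perms m
surjective-lists↭perms m = ∼bag⇒↭ (unique∧set⇒bag
  (Unique-filterᵇ (surjective m) _ (Unique-lists m (Uniqueₚ.map⁺ ℕₚ.suc-injective (Uniqueₚ.upTo⁺ m)))) (Unique-perms m)
  (mk⇔ to from))
  where
  to : ∀ {L} → L ∈ filterᵇ (surjective m) (lists m (fromTo 1 m)) → L ∈ perms m
  to {L} p with ∈-filterᵇ⁻ (surjective m) (lists m (fromTo 1 m)) p
  ... | q , e = ∈-perms⁺ m (lists-length m (fromTo 1 m) q) λ v r s →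
    ∈-anyᵇ v L (allᵇ⁻ (fromTo 1 m) e (∈-fromTo⁺ m r s))
  from : ∀ {L} → L ∈ perms m → L ∈ filterᵇ (surjective m) (lists m (fromTo 1 m))
  from {L} p = ∈-filterᵇ⁺ (surjective m) (lists m (fromTo 1 m))
    (∈-lists⁺ m (fromTo 1 m) (perms-length m p) (All.tabulate λ q →
      ∈-fromTo⁺ m (All.lookup (perms-positive m p) q) (All.lookup (perms-bound m p) q)))
    (allᵇ⁺ (fromTo 1 m) λ {v} q → anyᵇ-∈ (perms-surjective m p v (proj₁ (∈-fromTo⁻ m q)) (proj₂ (∈-fromTo⁻ m q))))

I≡∑perms : ∀ l μ → I l μ ≡ ∑ (perms (length (skewCells l μ)))
  (λ L → signSkew l μ (tab (skewCells l μ) L) when isStandard (skewCells l μ) (tab (skewCells l μ) L))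
I≡∑perms l μ = begin
  ∑ (filterᵇ (λ L → surjective m L ∧ std L) R) sgn
    ≡⟨ ∑-filterᵇ (λ L → surjective m L ∧ std L) R sgn ⟩
  ∑ R (λ L → sgn L when surjective m L ∧ std L)
    ≡⟨ ∑-cong R (λ {L} _ → when-∧ (sgn L) (surjective m L) (std L)) ⟩
  ∑ R (λ L → (sgn L when std L) when surjective m L)
    ≡⟨ sym (∑-filterᵇ (surjective m) R _) ⟩
  ∑ (filterᵇ (surjective m) R) (λ L → sgn L when std L)
    ≡⟨ ∑-↭ _ (surjective-lists↭perms m) ⟩
  ∑ (perms m) (λ L → sgn L when std L) ∎
  where
  cs = skewCells l μ
  m = length cs
  R = lists m (fromTo 1 m)
  sgn : List ℕ → ℤ
  sgn L = signSkew l μ (tab cs L)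
  std : List ℕ → Bool
  std L = isStandard cs (tab cs L)

-- Signs of skew tableaux

∑ℕ : {A : Set} → List A → (A → ℕ) → ℕ
∑ℕ xs f = sum (map f xs)

module _ {A : Set} where

  ∑ℕ-cong : ∀ (xs : List A) {f g} → (∀ {x} → x ∈ xs → f x ≡ g x) → ∑ℕ xs f ≡ ∑ℕ xs g
  ∑ℕ-cong []       e = refl
  ∑ℕ-cong (x ∷ xs) e = cong₂ ℕ._+_ (e (here refl)) (∑ℕ-cong xs (e ∘ there))

  ∑ℕ-++ : ∀ (xs ys : List A) f → ∑ℕ (xs ++ ys) f ≡ ∑ℕ xs f ℕ.+ ∑ℕ ys f
  ∑ℕ-++ []       ys f = refl
  ∑ℕ-++ (x ∷ xs) ys f = trans (cong (f x ℕ.+_) (∑ℕ-++ xs ys f)) (sym (ℕₚ.+-assoc (f x) _ _))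

  ∑ℕ-+ : ∀ (xs : List A) f g → ∑ℕ xs (λ x → f x ℕ.+ g x) ≡ ∑ℕ xs f ℕ.+ ∑ℕ xs g
  ∑ℕ-+ []       f g = refl
  ∑ℕ-+ (x ∷ xs) f g = trans (cong (f x ℕ.+ g x ℕ.+_) (∑ℕ-+ xs f g)) (lemma (f x) (g x) (∑ℕ xs f) (∑ℕ xs g))
    where lemma : ∀ a b c d → a ℕ.+ b ℕ.+ (c ℕ.+ d) ≡ (a ℕ.+ c) ℕ.+ (b ℕ.+ d)
          lemma = ℕSolver.solve-∀

  ∑ℕ-0 : ∀ (xs : List A) → ∑ℕ xs (λ _ → 0) ≡ 0
  ∑ℕ-0 []       = refl
  ∑ℕ-0 (x ∷ xs) = ∑ℕ-0 xs

  ∑ℕ-1 : ∀ (xs : List A) → ∑ℕ xs (λ _ → 1) ≡ length xs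
  ∑ℕ-1 []       = refl
  ∑ℕ-1 (x ∷ xs) = cong suc (∑ℕ-1 xs)

  count≡∑ℕ : ∀ (p : A → Bool) xs → count p xs ≡ ∑ℕ xs (bit ∘ p)
  count≡∑ℕ p []       = refl
  count≡∑ℕ p (x ∷ xs) with p x
  ... | true  = cong suc (count≡∑ℕ p xs)
  ... | false = count≡∑ℕ p xs

count-pairs : ∀ {A : Set} (p : A × A → Bool) xs → count p (pairs xs) ≡ ∑ℕ xs (λ a → ∑ℕ xs (λ b → bit (p (a , b))))
count-pairs p xs = trans (count≡∑ℕ p (pairs xs)) (go xs)
  where
  inner : ∀ a ys → ∑ℕ (map (a ,_) ys) (bit ∘ p) ≡ ∑ℕ ys (λ b → bit (p (a , b)))
  inner a []       = refl
  inner a (y ∷ ys) = cong (bit (p (a , y)) ℕ.+_) (inner a ys)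
  go : ∀ ys → ∑ℕ (concatMap (λ a → map (a ,_) xs) ys) (bit ∘ p) ≡ ∑ℕ ys (λ a → ∑ℕ xs (λ b → bit (p (a , b))))
  go []       = refl
  go (y ∷ ys) = trans (∑ℕ-++ (map (y ,_) xs) _ (bit ∘ p)) (cong₂ ℕ._+_ (inner y xs) (go ys))

straightCells : ℕ → List ℕ → List Cell
straightCells r μ = cells r μ []

∑ℕ-straight : ∀ r μ f → ∑ℕ (straightCells r μ) f ≡ ∑ℕ (rowCells r 0 (hd μ)) f ℕ.+ ∑ℕ (straightCells (suc r) (tl μ)) f
∑ℕ-straight r []      f = refl
∑ℕ-straight r (x ∷ μ) f = ∑ℕ-++ (rowCells r 0 x) _ f

rowCells-++ : ∀ r a m n → rowCells r a (m ℕ.+ n) ≡ rowCells r a m ++ rowCells r (a ℕ.+ m) n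
rowCells-++ r a zero    n = cong (λ i → rowCells r i n) (sym (ℕₚ.+-identityʳ a))
rowCells-++ r a (suc m) n = cong ((r , suc a) ∷_) (trans (rowCells-++ r (suc a) m n)
  (cong (λ i → rowCells r (suc a) m ++ rowCells r i n) (sym (ℕₚ.+-suc a m))))

straightCells-zero : ∀ r μ → sum μ ≡ 0 → straightCells r μ ≡ []
straightCells-zero r []         e = refl
straightCells-zero r (zero ∷ μ) e = straightCells-zero (suc r) μ e

∑ℕ-skew : ∀ r {l μ} f → μ ⊑ l → ∑ℕ (straightCells r l) f ≡ ∑ℕ (straightCells r μ) f ℕ.+ ∑ℕ (cells r l μ) f
∑ℕ-skew r {μ = μ} f ([] e) rewrite straightCells-zero r μ e = refl
∑ℕ-skew r {x ∷ xs} {μ} f (p ∷ q) = begin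
  ∑ℕ (straightCells r (x ∷ xs)) f
    ≡⟨ ∑ℕ-++ (rowCells r 0 x) _ f ⟩
  ∑ℕ (rowCells r 0 x) f ℕ.+ ∑ℕ (straightCells (suc r) xs) f
    ≡⟨ cong₂ ℕ._+_ (trans (cong (λ R → ∑ℕ R f) (trans (cong (rowCells r 0) (sym (ℕₚ.m+[n∸m]≡n p))) (rowCells-++ r 0 (hd μ) (x ℕ.∸ hd μ))))
         (∑ℕ-++ (rowCells r 0 (hd μ)) _ f)) (∑ℕ-skew (suc r) f q) ⟩
  (A ℕ.+ B) ℕ.+ (C ℕ.+ D)
    ≡⟨ lemma A B C D ⟩
  (A ℕ.+ C) ℕ.+ (B ℕ.+ D)
    ≡⟨ cong₂ ℕ._+_ (sym (∑ℕ-straight r μ f)) (sym (∑ℕ-++ (rowCells r (hd μ) (x ℕ.∸ hd μ)) _ f)) ⟩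
  ∑ℕ (straightCells r μ) f ℕ.+ ∑ℕ (cells r (x ∷ xs) μ) f ∎
  where
  A = ∑ℕ (rowCells r 0 (hd μ)) f
  B = ∑ℕ (rowCells r (hd μ) (x ℕ.∸ hd μ)) f
  C = ∑ℕ (straightCells (suc r) (tl μ)) f
  D = ∑ℕ (cells (suc r) xs (tl μ)) f
  lemma : ∀ a b c d → (a ℕ.+ b) ℕ.+ (c ℕ.+ d) ≡ (a ℕ.+ c) ℕ.+ (b ℕ.+ d)
  lemma = ℕSolver.solve-∀

∈-cells⁻ : ∀ r {l μ c} → μ ⊑ l → c ∈ cells r l μ → ∃ λ i → row c ≡ r ℕ.+ i × at μ i < col c × col c ≤ at l i
∈-cells⁻ r {x ∷ xs} {μ} (p ∷ q) m with ∈-++⁻ (rowCells r (hd μ) (x ℕ.∸ hd μ)) m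
... | inj₁ k with ∈-rowCells⁻ r (hd μ) _ k
...   | e , u , v = 0 , trans e (sym (ℕₚ.+-identityʳ r)) , u , ℕₚ.≤-trans v (ℕₚ.≤-reflexive (ℕₚ.m+[n∸m]≡n p))
∈-cells⁻ r {x ∷ xs} {μ} (p ∷ q) m | inj₂ k with ∈-cells⁻ (suc r) q k
... | i , e , u , v = suc i , trans e (sym (ℕₚ.+-suc r i)) , subst (_< _) (at-tl μ i) u , v

∈-skew⇒inShape : ∀ {l μ c} → μ ⊑ l → c ∈ cells 1 l μ → inShape μ c ≡ false
∈-skew⇒inShape {l} {μ} {_ , j} q m with ∈-cells⁻ 1 q m
... | i , refl , u , _ with 1 ≤ᵇ j | j ≤ᵇ at μ i in e
...   | false | _     = refl
...   | true  | false = refl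
...   | true  | true  = contradiction (true-≤ e) (ℕₚ.<⇒≱ u)

∈-straight⇒inShape : ∀ {μ c} → c ∈ straightCells 1 μ → inShape μ c ≡ true
∈-straight⇒inShape {μ} {_ , j} m with ∈-cells⁻ 1 ([]⊑ μ) m
... | i , refl , u , v = ∧-join (≤ᵇ-true u) (≤ᵇ-true v)

rowReading-bound : ∀ {μ c} → c ∈ straightCells 1 μ → rowReading μ c ≤ size μ
rowReading-bound {μ} {_ , j} m with ∈-cells⁻ 1 ([]⊑ μ) m
... | i , refl , _ , v = ℕₚ.≤-trans (ℕₚ.+-monoʳ-≤ (sum (map (part μ) (fromTo 1 i))) v)
  (subst (λ L → sum L ℕ.+ at μ i ≤ sum μ) (sym shape) (prefix i μ (at μ) (λ _ → refl)))
  where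
  shape : map (part μ) (fromTo 1 i) ≡ applyUpTo (at μ) i
  shape = trans (sym (Listₚ.map-∘ (upTo i))) (Listₚ.map-upTo (at μ) i)
  prefix : ∀ i μ (f : ℕ → ℕ) → (∀ k → f k ≡ at μ k) → sum (applyUpTo f i) ℕ.+ at μ i ≤ sum μ
  prefix zero    μ f e = ℕₚ.≤-trans (ℕₚ.m≤m+n (hd μ) (sum (tl μ))) (ℕₚ.≤-reflexive (sym (sum≡ μ)))
  prefix (suc i) μ f e = ℕₚ.≤-trans (ℕₚ.≤-reflexive (ℕₚ.+-assoc (f 0) _ _)) (ℕₚ.≤-trans
    (ℕₚ.+-mono-≤ (ℕₚ.≤-reflexive (e 0)) (ℕₚ.≤-trans (ℕₚ.≤-reflexive (cong (sum (applyUpTo (f ∘ suc) i) ℕ.+_) (sym (at-tl μ i))))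
      (prefix i (tl μ) (f ∘ suc) (λ k → trans (e (suc k)) (sym (at-tl μ k))))))
    (ℕₚ.≤-reflexive (sym (sum≡ μ))))

length-straight : ∀ r μ → length (straightCells r μ) ≡ sum μ
length-straight r μ = trans (sym (ℕₚ.+-identityʳ _)) (⊑-sum r ([]⊑ μ))

⊲-false : ∀ {c d} → row d ≤ row c → (row c ≡ row d → col d ≤ col c) → (c ⊲ d) ≡ false
⊲-false {i , j} {i′ , j′} p q with i <ᵇ i′ in e
... | true = contradiction (ℕₚ.<ᵇ⇒< i i′ (Equivalence.from T-≡ e)) (ℕₚ.≤⇒≯ p)
... | false with i ≡ᵇ i′ in e′
...   | false = refl
...   | true  = <ᵇ-false (q (≡ᵇ⇒≡ i i′ e′))

-- In its own row a cell outside `μ` has all cells of `μ` to its left, so only the lower rows come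
-- after it.
∑ℕ-below : ∀ r i j μ → at μ i < j → ∑ℕ (straightCells r μ) (λ b → bit ((r ℕ.+ i , j) ⊲ b)) ≡ sum (drop i (tl μ))
∑ℕ-below r zero j μ p = begin
  ∑ℕ (straightCells r μ) (λ b → bit ((r ℕ.+ 0 , j) ⊲ b))
    ≡⟨ cong (λ k → ∑ℕ (straightCells r μ) (λ b → bit ((k , j) ⊲ b))) (ℕₚ.+-identityʳ r) ⟩
  ∑ℕ (straightCells r μ) (λ b → bit ((r , j) ⊲ b))
    ≡⟨ ∑ℕ-straight r μ _ ⟩
  ∑ℕ (rowCells r 0 (hd μ)) (λ b → bit ((r , j) ⊲ b)) ℕ.+ ∑ℕ (straightCells (suc r) (tl μ)) (λ b → bit ((r , j) ⊲ b))
    ≡⟨ cong₂ ℕ._+_ (∑ℕ-cong (rowCells r 0 (hd μ)) same-row) (∑ℕ-cong (straightCells (suc r) (tl μ)) λ {b} m →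
         cong bit (⊲-row {r , j} {b} (∈-cells-row (suc r) (tl μ) [] m))) ⟩
  ∑ℕ (rowCells r 0 (hd μ)) (λ _ → 0) ℕ.+ ∑ℕ (straightCells (suc r) (tl μ)) (λ _ → 1)
    ≡⟨ cong₂ ℕ._+_ (∑ℕ-0 (rowCells r 0 (hd μ))) (trans (∑ℕ-1 (straightCells (suc r) (tl μ))) (length-straight (suc r) (tl μ))) ⟩
  sum (tl μ) ∎
  where
  same-row : ∀ {b} → b ∈ rowCells r 0 (hd μ) → bit ((r , j) ⊲ b) ≡ 0
  same-row {b} m with ∈-rowCells⁻ r 0 (hd μ) m
  ... | e , _ , v = cong bit (⊲-false {r , j} {b} (ℕₚ.≤-reflexive e) λ _ → ℕₚ.≤-trans v (ℕₚ.<⇒≤ p))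
∑ℕ-below r (suc i) j μ p = begin
  ∑ℕ (straightCells r μ) (λ b → bit ((r ℕ.+ suc i , j) ⊲ b))
    ≡⟨ cong (λ k → ∑ℕ (straightCells r μ) (λ b → bit ((k , j) ⊲ b))) (ℕₚ.+-suc r i) ⟩
  ∑ℕ (straightCells r μ) (λ b → bit ((suc r ℕ.+ i , j) ⊲ b))
    ≡⟨ ∑ℕ-straight r μ _ ⟩
  ∑ℕ (rowCells r 0 (hd μ)) (λ b → bit ((suc r ℕ.+ i , j) ⊲ b)) ℕ.+ ∑ℕ (straightCells (suc r) (tl μ)) (λ b → bit ((suc r ℕ.+ i , j) ⊲ b))
    ≡⟨ cong₂ ℕ._+_ (trans (∑ℕ-cong (rowCells r 0 (hd μ)) above) (∑ℕ-0 (rowCells r 0 (hd μ))))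
         (∑ℕ-below (suc r) i j (tl μ) (subst (_< j) (sym (at-tl μ i)) p)) ⟩
  sum (drop i (tl (tl μ)))
    ≡⟨ cong sum (sym (drop-tl i (tl μ))) ⟩
  sum (drop (suc i) (tl μ)) ∎
  where
  above : ∀ {b} → b ∈ rowCells r 0 (hd μ) → bit ((suc r ℕ.+ i , j) ⊲ b) ≡ 0
  above {b} m with ∈-rowCells⁻ r 0 (hd μ) m
  ... | refl , _ , _ = cong bit (⊲-false {suc r ℕ.+ i , j} {b} (ℕₚ.≤-trans (ℕₚ.m≤m+n r i) (ℕₚ.n≤1+n _))
    λ e → contradiction e (ℕₚ.<⇒≢ (s≤s (ℕₚ.m≤m+n r i)) ∘ sym))

⊲-asym : ∀ {c d} → (c ⊲ d) ≡ true → (d ⊲ c) ≡ false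
⊲-asym {i , j} {i′ , j′} e with i <ᵇ i′ in p
... | true = ⊲-false {i′ , j′} {i , j} (ℕₚ.<⇒≤ i<i′) λ q → contradiction (sym q) (ℕₚ.<⇒≢ i<i′)
  where
  i<i′ : i < i′
  i<i′ = ℕₚ.<ᵇ⇒< i i′ (Equivalence.from T-≡ p)
... | false with ∧-split {i ≡ᵇ i′} e
...   | q , s with refl ← ≡ᵇ⇒≡ i i′ q = ⊲-false {i , j′} {i , j} ℕₚ.≤-refl λ _ →
  ℕₚ.<⇒≤ (ℕₚ.<ᵇ⇒< j j′ (Equivalence.from T-≡ s))

inversion : Labelling → Cell → Cell → ℕ
inversion t a b = bit ((a ⊲ b) ∧ (t b <ᵇ t a))

inv≡∑ℕ : ∀ l t → inv l t ≡ ∑ℕ (straightCells 1 l) (λ a → ∑ℕ (straightCells 1 l) (inversion t a))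
inv≡∑ℕ l t = trans (cong (λ cs → count _ (pairs cs)) (skewCells≡cells l [])) (count-pairs _ (straightCells 1 l))

-- In a sorted list the relation `⊲` is the order of occurrence, so inversions of the labelling are
-- those of its reading word.
∑ℕ-inversion-Sorted : ∀ cs t → Sorted cs → ∑ℕ cs (λ a → ∑ℕ cs (inversion t a)) ≡ wordInv (map t cs)
∑ℕ-inversion-Sorted []       t []      = refl
∑ℕ-inversion-Sorted (c ∷ cs) t (p ∷ s) = cong₂ ℕ._+_ head-row (begin
  ∑ℕ cs (λ a → inversion t a c ℕ.+ ∑ℕ cs (inversion t a))
    ≡⟨ ∑ℕ-cong cs (λ {a} m → cong (λ z → bit (z ∧ (t c <ᵇ t a)) ℕ.+ ∑ℕ cs (inversion t a)) (⊲-asym {c} {a} (All.lookup p m))) ⟩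
  ∑ℕ cs (λ a → ∑ℕ cs (inversion t a))
    ≡⟨ ∑ℕ-inversion-Sorted cs t s ⟩
  wordInv (map t cs) ∎)
  where
  head-row : inversion t c c ℕ.+ ∑ℕ cs (inversion t c) ≡ count (_<ᵇ t c) (map t cs)
  head-row = begin
    inversion t c c ℕ.+ ∑ℕ cs (inversion t c)
      ≡⟨ cong₂ ℕ._+_ (cong (λ z → bit (z ∧ (t c <ᵇ t c))) (⊲-irrefl c))
           (∑ℕ-cong cs λ {b} m → cong (λ z → bit (z ∧ (t b <ᵇ t c))) (All.lookup p m)) ⟩
    ∑ℕ cs (λ b → bit (t b <ᵇ t c))
      ≡⟨ cong sum (Listₚ.map-∘ cs) ⟩
    ∑ℕ (map t cs) (λ x → bit (x <ᵇ t c))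
      ≡⟨ sym (count≡∑ℕ (_<ᵇ t c) (map t cs)) ⟩
    count (_<ᵇ t c) (map t cs) ∎

map-tab : ∀ cs L → Sorted cs → length L ≡ length cs → map (tab cs L) cs ≡ L
map-tab []       []      s       e = refl
map-tab (c ∷ cs) (x ∷ L) (p ∷ s) e = cong₂ _∷_ first (trans (Listₚ.map-cong-local (All.map later p)) (map-tab cs L s (ℕₚ.suc-injective e)))
  where
  first : (if cellEq c c then x else tab cs L c) ≡ x
  first rewrite cellEq-refl c = refl
  later : ∀ {d} → (c ⊲ d) ≡ true → (if cellEq c d then x else tab cs L d) ≡ tab cs L d
  later {d} h with cellEq c d in q
  ... | false = refl
  ... | true with refl ← cellEq⇒≡ c d q = contradiction (trans (sym h) (⊲-irrefl c)) λ ()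

<ᵇ-cancelʳ : ∀ k x y → (x ℕ.+ k <ᵇ y ℕ.+ k) ≡ (x <ᵇ y)
<ᵇ-cancelʳ k x y = bool-iff
  (λ h → <ᵇ-true (ℕₚ.+-cancelʳ-< k x y (<ᴮ⇒≤ᴮ (just (y ℕ.+ k)) h)))
  (λ h → <ᵇ-true (ℕₚ.+-monoˡ-< k (<ᴮ⇒≤ᴮ (just y) h)))

tab-positive : ∀ cs L → Sorted cs → length L ≡ length cs → All (1 ≤_) L → ∀ {c} → c ∈ cs → 1 ≤ tab cs L c
tab-positive cs L s e p {c} m = All.lookup p (subst (tab cs L c ∈_) (map-tab cs L s e) (∈-map⁺ (tab cs L) m))

-- Labels inside `μ` are smaller than those outside. So a pair with the inner cell first is never an
-- inversion, a pair with the outer cell first always is one, and the pairs on one side give the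
-- inversions of the row reading and of `L`.
inv-◇ : ∀ {l μ} L → μ ⊑ l → length L ≡ length (cells 1 l μ) → All (1 ≤_) L →
  inv l (rowReading μ ◇[ μ ] tab (cells 1 l μ) L)
  ≡ inv μ (rowReading μ) ℕ.+ (∑ℕ (cells 1 l μ) (below μ ∘ row) ℕ.+ wordInv L)
inv-◇ {l} {μ} L q len pos = begin
  inv l t
    ≡⟨ inv≡∑ℕ l t ⟩
  ∑ℕ S (λ a → ∑ℕ S (inversion t a))
    ≡⟨ ∑ℕ-skew 1 _ q ⟩
  ∑ℕ M (λ a → ∑ℕ S (inversion t a)) ℕ.+ ∑ℕ K (λ a → ∑ℕ S (inversion t a))
    ≡⟨ cong₂ ℕ._+_ (∑ℕ-cong M inner-row) (∑ℕ-cong K outer-row) ⟩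
  ∑ℕ M (λ a → ∑ℕ M (inversion (rowReading μ) a)) ℕ.+ ∑ℕ K (λ a → below μ (row a) ℕ.+ ∑ℕ K (inversion T a))
    ≡⟨ cong₂ ℕ._+_ (sym (inv≡∑ℕ μ (rowReading μ))) (trans (∑ℕ-+ K (below μ ∘ row) _)
         (cong (∑ℕ K (below μ ∘ row) ℕ.+_) (trans (∑ℕ-inversion-Sorted K T sorted) (cong wordInv (map-tab K L sorted len))))) ⟩
  inv μ (rowReading μ) ℕ.+ (∑ℕ K (below μ ∘ row) ℕ.+ wordInv L) ∎
  where
  S = straightCells 1 l
  M = straightCells 1 μ
  K = cells 1 l μ
  T = tab K L
  t = rowReading μ ◇[ μ ] T
  sorted = cells-Sorted 1 l μ

  on-M : ∀ {c} → c ∈ M → t c ≡ rowReading μ c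
  on-M {c} m = cong (λ z → if z then rowReading μ c else T c ℕ.+ size μ) (∈-straight⇒inShape {μ} m)

  on-K : ∀ {c} → c ∈ K → t c ≡ T c ℕ.+ size μ
  on-K {c} m = cong (λ z → if z then rowReading μ c else T c ℕ.+ size μ) (∈-skew⇒inShape q m)

  M≤K : ∀ {a b} → a ∈ M → b ∈ K → t a < t b
  M≤K {a} {b} m k = subst₂ _<_ (sym (on-M m)) (sym (on-K k))
    (ℕₚ.≤-<-trans (rowReading-bound {μ} m) (ℕₚ.+-monoˡ-≤ (size μ) (tab-positive K L sorted len pos k)))

  inner-row : ∀ {a} → a ∈ M → ∑ℕ S (inversion t a) ≡ ∑ℕ M (inversion (rowReading μ) a)
  inner-row {a} m = begin
    ∑ℕ S (inversion t a)
      ≡⟨ ∑ℕ-skew 1 (inversion t a) q ⟩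
    ∑ℕ M (inversion t a) ℕ.+ ∑ℕ K (inversion t a)
      ≡⟨ cong₂ ℕ._+_ (∑ℕ-cong M λ {b} m′ → cong₂ (λ u v → bit ((a ⊲ b) ∧ (u <ᵇ v))) (on-M m′) (on-M m))
           (trans (∑ℕ-cong K λ {b} k → trans (cong (λ z → bit ((a ⊲ b) ∧ z)) (<ᵇ-false (ℕₚ.<⇒≤ (M≤K m k)))) (bit-∧-false (a ⊲ b))) (∑ℕ-0 K)) ⟩
    ∑ℕ M (inversion (rowReading μ) a) ℕ.+ 0
      ≡⟨ ℕₚ.+-identityʳ _ ⟩
    ∑ℕ M (inversion (rowReading μ) a) ∎
    where
    bit-∧-false : ∀ c → bit (c ∧ false) ≡ 0
    bit-∧-false true  = refl
    bit-∧-false false = refl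

  outer-row : ∀ {a} → a ∈ K → ∑ℕ S (inversion t a) ≡ below μ (row a) ℕ.+ ∑ℕ K (inversion T a)
  outer-row {a} k = begin
    ∑ℕ S (inversion t a)
      ≡⟨ ∑ℕ-skew 1 (inversion t a) q ⟩
    ∑ℕ M (inversion t a) ℕ.+ ∑ℕ K (inversion t a)
      ≡⟨ cong₂ ℕ._+_ (∑ℕ-cong M λ {b} m → trans (cong (λ z → bit ((a ⊲ b) ∧ z)) (<ᵇ-true (M≤K m k))) (cong bit (∧-identityʳ (a ⊲ b))))
           (∑ℕ-cong K λ {b} k′ → cong (λ z → bit ((a ⊲ b) ∧ z)) (trans (cong₂ _<ᵇ_ (on-K k′) (on-K k)) (<ᵇ-cancelʳ (size μ) (T b) (T a)))) ⟩
    ∑ℕ M (λ b → bit (a ⊲ b)) ℕ.+ ∑ℕ K (inversion T a)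
      ≡⟨ cong (ℕ._+ ∑ℕ K (inversion T a)) (count-below k) ⟩
    below μ (row a) ℕ.+ ∑ℕ K (inversion T a) ∎
    where
    count-below : ∀ {a} → a ∈ K → ∑ℕ M (λ b → bit (a ⊲ b)) ≡ below μ (row a)
    count-below {_ , j} k with ∈-cells⁻ 1 q k
    ... | i , refl , u , _ = trans (∑ℕ-below 1 i j μ u) (cong sum (sym (drop-tl i μ)))

-- The sign of the row reading tableau occurs twice, once by itself and once inside the combined
-- tableau, and cancels.
I≡weightedCount : ∀ {l μ} (p : Partition nothing μ) → μ ⊑ l → I l μ ≡ weightedCount (below μ) (cells 1 l μ)
I≡weightedCount {l} {μ} p q = begin
  I l μ
    ≡⟨ I≡∑perms l μ ⟩
  ∑ (perms (length (skewCells l μ))) (λ L → signSkew l μ (tab (skewCells l μ) L) when isStandard (skewCells l μ) (tab (skewCells l μ) L))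
    ≡⟨ cong (λ cs → ∑ (perms (length cs)) (λ L → signSkew l μ (tab cs L) when isStandard cs (tab cs L))) (skewCells≡cells l μ) ⟩
  ∑ (perms (length K)) (λ L → signSkew l μ (tab K L) when isStandard K (tab K L))
    ≡⟨ ∑-cong (perms (length K)) (λ {L} m → trans (cong (_when isStandard K (tab K L)) (sign L m)) (sym (*-when σ (signPow (wordInv L)) _))) ⟩
  ∑ (perms (length K)) (λ L → σ * (signPow (wordInv L) when isStandard K (tab K L)))
    ≡⟨ ∑-* (perms (length K)) σ _ ⟩
  weightedCount (below μ) K ∎
  where
  K = cells 1 l μ
  σ = signPow (∑ℕ K (below μ ∘ row))
  sign : ∀ L → L ∈ perms (length K) → signSkew l μ (tab K L) ≡ σ * signPow (wordInv L)
  sign L m = begin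
    signPow i₀ * signPow (inv l (rowReading μ ◇[ μ ] tab K L))
      ≡⟨ cong (λ n → signPow i₀ * signPow n) (inv-◇ L q (perms-length (length K) m) (perms-positive (length K) m)) ⟩
    signPow i₀ * signPow (i₀ ℕ.+ (∑ℕ K (below μ ∘ row) ℕ.+ wordInv L))
      ≡⟨ cong (signPow i₀ *_) (signPow-+ i₀ _) ⟩
    signPow i₀ * (signPow i₀ * signPow (∑ℕ K (below μ ∘ row) ℕ.+ wordInv L))
      ≡⟨ signPow-self i₀ _ ⟩
    signPow (∑ℕ K (below μ ∘ row) ℕ.+ wordInv L)
      ≡⟨ signPow-+ (∑ℕ K (below μ ∘ row)) (wordInv L) ⟩
    σ * signPow (wordInv L) ∎
    where i₀ = inv μ (rowReading μ)

I≡chains : ∀ {μ} → Partition nothing μ → ∀ n l → Partition nothing l → μ ⊑ l → sum l ≡ size μ ℕ.+ n → I l μ ≡ chains μ n l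
I≡chains {μ} p n l s q e = trans (I≡weightedCount p q)
  (sym (trans (chains≡weightedCount p n s e) (cong (weightedCount (below μ) (cells 1 l μ) when_) (⊑⇒⊑ᵇ q))))

-- Coefficients of `F` through iterates of U

coeff-F : ∀ {α} → Partition nothing α → length α ≤ size α → ∀ n m →
  coeff (F n α) m ≡ up^ n (indicator (weight 1 α · m) ∘ weight 1) α
coeff-F {α} α-Partition length≤size n m = begin
  coeff (F n α) m
    ≡⟨ coeff≡eval (F n α) m ⟩
  eval (F n α) (indicator m)
    ≡⟨ eval-map (shapesOver α n) ⟩
  ∑ (shapesOver α n) (λ l → I l α * ind l)
    ≡⟨ ∑-filterᵇ q L _ ⟩
  ∑ L (λ l → I l α * ind l when q l)
    ≡⟨ ∑-cong L (λ {l} p → when-cong (q l) λ e → cong (_* ind l) (rewrite-I l (lists-length N (fromTo 0 N) p) e)) ⟩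
  ∑ L (λ l → up^ n (λ k → 1ℤ when k ≈ᵇ l) α * ind l when q l)
    ≡⟨ ∑-cong L (λ {l} _ → inside l) ⟩
  ∑ L (λ l → up^ n (λ k → (ind l when q l) when k ≈ᵇ l) α)
    ≡⟨ sym (up^-∑ n L (λ l k → (ind l when q l) when k ≈ᵇ l) α) ⟩
  up^ n (λ k → ∑ L (λ l → (ind l when q l) when k ≈ᵇ l)) α
    -- With the sum over shapes moved inside, it selects at each partition reached from `α` its one
    -- padded copy in `L`, which passes the filter.
    ≡⟨ up^-cong-AddBoxes n reachable ⟩
  up^ n (indicator (weight 1 α · m) ∘ weight 1) α ∎
  where
  N = size α ℕ.+ n
  L = lists N (fromTo 0 N)

  ind : List ℕ → ℤ
  ind l = indicator m (vStat l α , hStat l α , dStat l α)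

  q : List ℕ → Bool
  q l = weaklyDecreasing l ∧ (sum l ≡ᵇ N) ∧ contained α l

  eval-map : ∀ S → eval (map (λ l → (vStat l α , hStat l α , dStat l α) , I l α) S) (indicator m) ≡ ∑ S (λ l → I l α * ind l)
  eval-map []      = refl
  eval-map (l ∷ S) = cong (I l α * ind l +_) (eval-map S)

  rewrite-I : ∀ l → length l ≡ N → q l ≡ true → I l α ≡ up^ n (λ k → 1ℤ when k ≈ᵇ l) α
  rewrite-I l p e with ∧-split {weaklyDecreasing l} e
  ... | e₁ , e₂ with ∧-split {sum l ≡ᵇ N} e₂
  ...   | e₃ , e₄ = trans (I≡chains α-Partition n l l-Partition (contained⇒⊑ α l e₄) (≡ᵇ⇒≡ (sum l) N e₃))
                          (sym (up^-delta n α-Partition l-Partition))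
    where l-Partition = decreasing⇒Partition {nothing} l tt e₁

  inside : ∀ l → (up^ n (λ k → 1ℤ when k ≈ᵇ l) α * ind l when q l) ≡ up^ n (λ k → (ind l when q l) when k ≈ᵇ l) α
  inside l = begin
    (up^ n (λ k → 1ℤ when k ≈ᵇ l) α * ind l when q l)
      ≡⟨ cong (_when q l) (ℤₚ.*-comm (up^ n (λ k → 1ℤ when k ≈ᵇ l) α) (ind l)) ⟩
    (ind l * up^ n (λ k → 1ℤ when k ≈ᵇ l) α when q l)
      ≡⟨ scaled (q l) ⟩
    (ind l when q l) * up^ n (λ k → 1ℤ when k ≈ᵇ l) α
      ≡⟨ sym (up^-* n (ind l when q l) _ α) ⟩
    up^ n (λ k → (ind l when q l) * (1ℤ when k ≈ᵇ l)) α
      ≡⟨ up^-cong n α-Partition (λ {k} _ → trans (*-when (ind l when q l) 1ℤ (k ≈ᵇ l)) (cong (_when k ≈ᵇ l) (ℤₚ.*-identityʳ _))) ⟩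
    up^ n (λ k → (ind l when q l) when k ≈ᵇ l) α ∎
    where
    scaled : ∀ c → (ind l * up^ n (λ k → 1ℤ when k ≈ᵇ l) α when c) ≡ (ind l when c) * up^ n (λ k → 1ℤ when k ≈ᵇ l) α
    scaled true  = refl
    scaled false = sym (ℤₚ.*-zeroˡ (up^ n (λ k → 1ℤ when k ≈ᵇ l) α))

  reachable : ∀ {k} → AddBoxes n α k →
    ∑ L (λ l → (ind l when q l) when k ≈ᵇ l) ≡ indicator (weight 1 α · m) (weight 1 k)
  reachable {k} r = begin
    ∑ L (λ l → (ind l when q l) when k ≈ᵇ l)
      ≡⟨ ∑-lists-point N N k (λ l → ind l when q l) short (ℕₚ.≤-reflexive (AddBoxes-sum r)) ⟩
    (ind (pad N k) when q (pad N k))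
      ≡⟨ cong (ind (pad N k) when_) (∧-join (Partition⇒decreasing (pad N k) (Partition-pad N k (AddBoxes-Partition α-Partition r)))
           (∧-join (trans (cong (_≡ᵇ N) (trans (sum-pad N k short) (AddBoxes-sum r))) (≡ᵇ-refl N)) (⊑⇒contained α (pad N k) inside-pad))) ⟩
    ind (pad N k)
      ≡⟨ sym (indicator-cancel (weight 1 α) _ m) ⟩
    indicator (weight 1 α · m) (weight 1 α · (vStat (pad N k) α , hStat (pad N k) α , dStat (pad N k) α))
      ≡⟨ cong (indicator (weight 1 α · m)) (trans (sym (weight-stats inside-pad)) (weight-pad 1 N k short)) ⟩
    indicator (weight 1 α · m) (weight 1 k) ∎
    where
    -- The listed shapes have exactly N parts, so padding works only if `k` has at most N; the
    -- hypothesis `length α ≤ size α` guarantees this.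
    short : length k ≤ N
    short = ℕₚ.≤-trans (AddBoxes-length r) (ℕₚ.+-monoˡ-≤ n length≤size)
    inside-pad : α ⊑ pad N k
    inside-pad = ⊑-pad N k short (⊑-AddBoxes (⊑-refl α) r)

coeff-F-δ : ∀ k n m → coeff (F n (δ k)) m ≡ up^ n (shifted k m ∘ weight 1) (δ k)
coeff-F-δ k = coeff-F (δ-Partition k tt) (length≤sum k)
  where
  length≤sum : ∀ k → length (δ k) ≤ size (δ k)
  length≤sum zero    = z≤n
  length≤sum (suc k) = s≤s (ℕₚ.≤-trans (length≤sum k) (ℕₚ.m≤n+m (size (δ k)) k))

coeff-F-even : ∀ k n m → coeff (F (2 ℕ.* n) (δ k)) m ≡ up^ (n ℕ.* 2 ℕ.+ 0) (shifted k m ∘ weight 1) (δ k)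
coeff-F-even k n m = trans (cong (λ i → coeff (F i (δ k)) m) (trans (ℕₚ.*-comm 2 n) (sym (ℕₚ.+-identityʳ _)))) (coeff-F-δ k _ m)

coeff-F-odd : ∀ k n m → coeff (F (suc (2 ℕ.* n)) (δ k)) m ≡ up^ (n ℕ.* 2 ℕ.+ 1) (shifted k m ∘ weight 1) (δ k)
coeff-F-odd k n m = trans (cong (λ i → coeff (F i (δ k)) m)
  (trans (cong suc (ℕₚ.*-comm 2 n)) (ℕₚ.+-comm 1 (n ℕ.* 2)))) (coeff-F-δ k _ m)

theorem4p13 : (k n : ℕ) →
    (F (2 ℕ.* n) (δ k) ≈ₚ (X +ₚ Y) ^ₚ n)
    × (k ℕ.% 4 ≡ 0 → F (suc (2 ℕ.* n)) (δ k) ≈ₚ (X +ₚ Y) ^ₚ n)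
    × (k ℕ.% 4 ≡ 1 → F (suc (2 ℕ.* n)) (δ k) ≈ₚ (X +ₚ Y) ^ₚ suc n)
    × (k ℕ.% 4 ≡ 2 → F (suc (2 ℕ.* n)) (δ k) ≈ₚ X *ₚ Y *ₚ Z *ₚ (X +ₚ Y) ^ₚ n)
    × (k ℕ.% 4 ≡ 3 → F (suc (2 ℕ.* n)) (δ k) ≈ₚ 0ₚ)
theorem4p13 k n =
    (λ a b c → trans (coeff-F-even k n _) (even-coeff k n (a , b , c)))
  , (λ e a b c → trans (coeff-F-odd k n _) (odd-coeff-0 k n (a , b , c) e))
  , (λ e a b c → trans (coeff-F-odd k n _) (odd-coeff-1 k n (a , b , c) e))
  , (λ e a b c → trans (coeff-F-odd k n _) (odd-coeff-2 k n (a , b , c) e))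
  , (λ e a b c → trans (coeff-F-odd k n _) (odd-coeff-3 k n (a , b , c) e))
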